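{- As $m \to + \infty$, $$\frac{16}{3 \sqrt 3} m^3 \lesssim \mathsf{D} (\mathcal{B}^{(3)}_m) \lesssim \frac{1372}{81}\, \pi\, m^3.$$
   Context: For positive sequences, $u_m\lesssim v_m$ means $\liminf_{m\to+\infty} v_m/u_m\ge 1$. A minimal zero-sum sequence over a subset $X$ of an abelian group is a finite unordered sequence (multiset) of elements of $X$ summing to $0$ with no non-empty proper subsequence summing to $0$; $\mathsf{D}(X)$ is the largest length of such a sequence. $\mathcal{B}^{(3)}_m=\{(u_1,u_2,u_3)\in\mathbb{Z}^3 : u_1^2+u_2^2+u_3^2\le m^2\}$. -}

module Defs where

open import Data.Nat as ℕ using (ℕ; zero; suc)
open import Data.Integer as ℤ using (ℤ; +_)
open import Data.Rational as ℚ using (ℚ; _/_)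
open import Data.Product using (_×_; _,_; ∃)
open import Data.Sum using (_⊎_)
open import Data.List using (List; []; _∷_; length; foldr)
open import Data.List.Relation.Unary.All using (All)
open import Data.List.Relation.Binary.Sublist.Propositional using (_⊆_)
open import Relation.Binary.PropositionalEquality using (_≡_)

ℤ³ : Set
ℤ³ = ℤ × ℤ × ℤ

0³ : ℤ³
0³ = (+ 0 , + 0 , + 0)

_+³_ : ℤ³ → ℤ³ → ℤ³
(a , b , c) +³ (x , y , z) = (a ℤ.+ x , b ℤ.+ y , c ℤ.+ z)

sum³ : List ℤ³ → ℤ³
sum³ = foldr _+³_ 0³

InBall : ℕ → ℤ³ → Set
InBall m (a , b , c) = a ℤ.* a ℤ.+ b ℤ.* b ℤ.+ c ℤ.* c ℤ.≤ (+ m) ℤ.* (+ m)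

-- A sequence (multiset) over X is represented by a list; sub-multisets
-- correspond to sublists (order is irrelevant for all notions below).
-- Minimal zero-sum sequence over X: non-empty, all terms in X, sum 0, and no
-- non-empty proper subsequence has sum 0.
MinimalZeroSum : (ℤ³ → Set) → List ℤ³ → Set
MinimalZeroSum X S =
  (0 ℕ.< length S) × All X S × sum³ S ≡ 0³ ×
  (∀ (T : List ℤ³) → T ⊆ S → 0 ℕ.< length T → length T ℕ.< length S →
     sum³ T ≡ 0³ → Data.Empty.⊥)
  where import Data.Empty

ℕ→ℚ : ℕ → ℚ
ℕ→ℚ n = (+ n) / 1

cube : ℕ → ℚ
cube m = ℕ→ℚ (m ℕ.* m ℕ.* m)

-- q < 16 / (3 √3)   (equivalently q ≤ 0, or q > 0 and 27 q² < 256)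
BelowLowerConst : ℚ → Set
BelowLowerConst q = q ℚ.≤ ℚ.0ℚ ⊎ (ℚ.0ℚ ℚ.< q × ((+ 27) / 1) ℚ.* (q ℚ.* q) ℚ.< (+ 256) / 1)

-- Leibniz upper bounds for π/4:  leib n = Σ_{k=0}^{2n} (-1)^k / (2k+1).
-- These decrease strictly to π/4, so  π < q  iff  ∃ n, 4·leib n < q.
leib : ℕ → ℚ
leib zero = ℚ.1ℚ
leib (suc n) = leib n ℚ.- ((+ 1) / (suc (2 ℕ.+ 4 ℕ.* n))) ℚ.+ ((+ 1) / (suc (4 ℕ.+ 4 ℕ.* n)))

PiLessThan : ℚ → Set
PiLessThan q = ∃ λ n → ((+ 4) / 1) ℚ.* leib n ℚ.< q

AboveUpperConst : ℚ → Set
AboveUpperConst q = PiLessThan (((+ 81) / 1372) ℚ.* q)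

{-# OPTIONS --safe #-}
-- Lower bound: four integer vectors near the vertices of a regular tetrahedron of circumradius m have a one-dimensional
-- lattice of relations, generated by their 3 × 3 minors as soon as these are coprime (here two of them differ by 1).
-- The generator is a minimal zero-sum sequence of length 6 · volume ~ 16 m³ / (3 √3).
--
-- Upper bound: a zero-sum sequence in the ball of radius m can be ordered so that all its partial sums have norm at most
-- 7 m / 3 (by a theorem of Banaszczyk, the Steinitz constant of a d-dimensional normed space is at most d - 1 + 1 / d).
-- The partial sums of a minimal zero-sum sequence are distinct, so its length is at most the number of lattice points
-- in a ball of volume (4 π / 3) (7 / 3)³ m³ = (1372 π / 81) m³.
--
-- For the ordering, vectors are removed one at a time while the remaining ones keep weights λ in [0 , 1] with
-- Σ λ v = 0.  The sum of the remaining vectors is then Σ (1 - λ) v, whose norm is at most m Σ (1 - λ).  Lowering the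
-- total weight until Σ (1 - λ) = 10 / 3 leaves at most four fractional weights; if no weight is 0, there are exactly
-- four, and moving along the linear relation of these four vectors in both directions shows which two of them can be
-- removed next.
--
-- For the count, the ball is cut into discs and these into thin sectors; the areas of the sectors add up to a Riemann
-- sum of 1 / (1 + t²) on [0 , 1], and the truncated geometric series bounds it by the partial sums of the Leibniz series.
module Submission where

open import Defs
open import Data.Nat as ℕ using (ℕ)
open import Data.Rational as ℚ using (ℚ)
open import Data.Product using (_×_; _,_; ∃)
open import Data.List using (List; length)

-- At deficit `Σ (1 - λ) = 4` the classical argument is immediate: four positive fractional weights
-- cannot miss a total of 4, so some weight is 0, and its removal leaves deficit 3, hence the
-- Steinitz constant 3. Removing at `10 / 3` leaves `7 / 3`, but now four positive weights of total
-- `2 / 3` may survive; this is the obstacle. With total `2 / 3` at most one weight exceeds `1 / 3`,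
-- so a vector of weight at most `1 / 3` can be removed ahead of its turn: as long as it stays in
-- the balance it costs at most `1 / 3`, on top of a deficit of 2. The two regimes, with and without
-- such a debt, are two mutually recursive invariants. No real number occurs. Weights are integers
-- over a common denominator, the simplex step is an integer kernel vector with a ratio test, norms
-- are compared through pairings with test vectors, and the square root of 3 disappears by comparing
-- squared lengths with sixth powers of the radius. The number π enters only through upper bounds
-- from the Leibniz series, and the count needs nothing else.

-- Kernel vectors and ratio tests over the integers.

module IntegerLinearAlgebra where

  open import Data.Integer hiding (suc)
  open import Data.Integer.Properties
  open import Data.Integer.Tactic.RingSolver using (solve-∀)
  open import Data.Nat as ℕ using (ℕ; suc)
  import Data.Nat.Properties as ℕₚ
  open import Data.Product using (_×_; _,_; ∃; proj₁; proj₂; ∃₂)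
  open import Data.Sum using (inj₁; inj₂)
  open import Data.List as List using (List; []; _∷_; length; _++_)
  import Data.List.Properties as Listₚ
  open import Data.List.Relation.Unary.All as All using (All; []; _∷_)
  import Data.List.Relation.Unary.All.Properties as Allₚ
  open import Data.List.Relation.Unary.Any as Any using (Any; here; there)
  open import Data.List.Membership.Propositional using (find)
  open import Data.List.Membership.Propositional.Properties using (∈-∃++)
  open import Data.Vec as Vec using (Vec; []; _∷_; zipWith; replicate; head; tail)
  open import Relation.Nullary using (¬_; yes; no; contradiction)
  open import Relation.Binary.PropositionalEquality

  0≤+ : ∀ {i j} → 0ℤ ≤ i → 0ℤ ≤ j → 0ℤ ≤ i + j
  0≤+ = +-mono-≤

  0≤* : ∀ {i j} → 0ℤ ≤ i → 0ℤ ≤ j → 0ℤ ≤ i * j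
  0≤* {+ i} {+ j} _ _ = subst (0ℤ ≤_) (pos-* i j) (+≤+ ℕ.z≤n)

  0<* : ∀ {i j} → 0ℤ < i → 0ℤ < j → 0ℤ < i * j
  0<* {+[1+ i ]} {+[1+ j ]} _ _ = +<+ (ℕ.s≤s ℕ.z≤n)
  0<* {+ 0} (+<+ ()) _
  0<* {+[1+ i ]} {+ 0} _ (+<+ ())

  0≤ℕ : ∀ n → 0ℤ ≤ + n
  0≤ℕ n = +≤+ ℕ.z≤n

  0<⇒0≤ : ∀ {i} → 0ℤ < i → 0ℤ ≤ i
  0<⇒0≤ = <⇒≤

  0<+0≤ : ∀ {i j} → 0ℤ < i → 0ℤ ≤ j → 0ℤ < i + j
  0<+0≤ = +-mono-<-≤

  ≤-by : ∀ {i j e} → e ≡ j - i → 0ℤ ≤ e → i ≤ j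
  ≤-by eq h = 0≤i-j⇒j≤i (subst (0ℤ ≤_) eq h)

  <-by : ∀ {i j e} → e ≡ j - i → 0ℤ < e → i < j
  <-by {i} {j} eq h = subst₂ _<_ (+-identityʳ i) (l i j) (+-monoʳ-< i (subst (0ℤ <_) eq h))
    where
    l : ∀ i j → i + (j - i) ≡ j
    l = solve-∀

  0≤-by : ∀ {e f} → e ≡ f → 0ℤ ≤ e → 0ℤ ≤ f
  0≤-by = subst (0ℤ ≤_)

  dif : ∀ {i j} → i ≤ j → 0ℤ ≤ j - i
  dif = i≤j⇒0≤j-i

  dif< : ∀ {i j} → i < j → 0ℤ < j - i
  dif< {i} {j} h = subst (_< j - i) (+-inverseʳ i) (+-monoˡ-< (- i) h)

  infixl 7 _∙_

  _∙_ : ∀ {n} → Vec ℤ n → Vec ℤ n → ℤ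
  [] ∙ [] = 0ℤ
  (a ∷ u) ∙ (b ∷ v) = a * b + u ∙ v

  ∙-zeroʳ : ∀ {n} (u : Vec ℤ n) → u ∙ replicate n 0ℤ ≡ 0ℤ
  ∙-zeroʳ [] = refl
  ∙-zeroʳ (a ∷ u) = cong₂ _+_ (*-zeroʳ a) (∙-zeroʳ u)

  ∙-elim : ∀ {n} (c a : ℤ) (u ρ β : Vec ℤ n) →
    zipWith (λ x y → c * x - a * y) u ρ ∙ β ≡ c * (u ∙ β) - a * (ρ ∙ β)
  ∙-elim c a [] [] [] = l c a
    where
    l : ∀ c a → 0ℤ ≡ c * 0ℤ - a * 0ℤ
    l = solve-∀
  ∙-elim c a (x ∷ u) (y ∷ ρ) (b ∷ β) =
    trans (cong (λ t → (c * x - a * y) * b + t) (∙-elim c a u ρ β)) (l c a x y b (u ∙ β) (ρ ∙ β))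
    where
    l : ∀ c a x y b p q → (c * x - a * y) * b + (c * p - a * q) ≡ c * (x * b + p) - a * (y * b + q)
    l = solve-∀

  ∙-scaleʳ : ∀ {n} (c : ℤ) (u β : Vec ℤ n) → u ∙ Vec.map (c *_) β ≡ c * (u ∙ β)
  ∙-scaleʳ c [] [] = sym (*-zeroʳ c)
  ∙-scaleʳ c (x ∷ u) (b ∷ β) = trans (cong (λ t → x * (c * b) + t) (∙-scaleʳ c u β)) (l c x b (u ∙ β))
    where
    l : ∀ c x b p → x * (c * b) + c * p ≡ c * (x * b + p)
    l = solve-∀

  NonZeroVec : ∀ {n} → Vec ℤ n → Set
  NonZeroVec {n} α = α ≢ replicate n 0ℤ

  scale-nonzero : ∀ {n} c (β : Vec ℤ n) → c ≢ 0ℤ → NonZeroVec β → NonZeroVec (Vec.map (c *_) β)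
  scale-nonzero c [] _ h = λ _ → h refl
  scale-nonzero c (b ∷ β) c≢0 h eq with i*j≡0⇒i≡0∨j≡0 c (cong head eq)
  ... | inj₁ c≡0 = c≢0 c≡0
  ... | inj₂ refl = scale-nonzero c β c≢0 (λ β≡0 → h (cong (0ℤ ∷_) β≡0)) (cong tail eq)

  -- Gaussian elimination without fractions: a row with non-zero leading entry `c` is the pivot, the
  -- other rows are cross-multiplied to lose their first entry, and the solution of the smaller
  -- system is scaled by `c` so that the pivot row determines the first unknown as an integer.
  kernel : ∀ n (A : List (Vec ℤ n)) → length A ℕ.< n →
    ∃ λ (α : Vec ℤ n) → NonZeroVec α × All (λ ρ → ρ ∙ α ≡ 0ℤ) A
  kernel (suc n) A |A|<n with All.all? (λ ρ → head ρ ≟ 0ℤ) A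
  ... | yes zs = 1ℤ ∷ replicate n 0ℤ , (λ ()) , All.map (λ {ρ} → e₁ ρ) zs
    where
    e₁ : ∀ (ρ : Vec ℤ (suc n)) → head ρ ≡ 0ℤ → ρ ∙ (1ℤ ∷ replicate n 0ℤ) ≡ 0ℤ
    e₁ (.0ℤ ∷ ρ) refl = trans (+-identityˡ (ρ ∙ replicate n 0ℤ)) (∙-zeroʳ ρ)
  ... | no ¬zs with find (Allₚ.¬All⇒Any¬ (λ ρ → head ρ ≟ 0ℤ) A ¬zs)
  ... | (c ∷ ρ) , ρ∈A , c≢0 with ∈-∃++ ρ∈A
  ... | xs , ys , refl = α , α≢0 , Allₚ.++⁺ (All.map (λ {r} → back r) (Allₚ.++⁻ˡ xs ker)) (pivot ∷ All.map (λ {r} → back r) (Allₚ.++⁻ʳ xs ker))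
    where
    reduce : Vec ℤ (suc n) → Vec ℤ n
    reduce (a ∷ u) = zipWith (λ x y → c * x - a * y) u ρ
    shorter : length (List.map reduce (xs ++ ys)) ℕ.< n
    shorter = ℕ.s≤s⁻¹ (subst (ℕ._< suc n) (begin
      length (xs ++ (c ∷ ρ) ∷ ys) ≡⟨ Listₚ.length-++ xs ⟩
      length xs ℕ.+ suc (length ys) ≡⟨ ℕₚ.+-suc (length xs) (length ys) ⟩
      suc (length xs ℕ.+ length ys) ≡⟨ cong suc (Listₚ.length-++ xs) ⟨
      suc (length (xs ++ ys)) ≡⟨ cong suc (Listₚ.length-map reduce (xs ++ ys)) ⟨
      suc (length (List.map reduce (xs ++ ys))) ∎) |A|<n)
      where open ≡-Reasoning
    rec = kernel n (List.map reduce (xs ++ ys)) shorter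
    β = proj₁ rec
    α = - (ρ ∙ β) ∷ Vec.map (c *_) β
    α≢0 : NonZeroVec α
    α≢0 eq = scale-nonzero c β c≢0 (proj₁ (proj₂ rec)) (cong tail eq)
    ker : All (λ r → reduce r ∙ β ≡ 0ℤ) (xs ++ ys)
    ker = Allₚ.map⁻ (proj₂ (proj₂ rec))
    pivot : (c ∷ ρ) ∙ α ≡ 0ℤ
    pivot = trans (cong (λ t → c * - (ρ ∙ β) + t) (∙-scaleʳ c ρ β)) (l c (ρ ∙ β))
      where
      l : ∀ c p → c * - p + c * p ≡ 0ℤ
      l = solve-∀
    back : ∀ r → reduce r ∙ β ≡ 0ℤ → r ∙ α ≡ 0ℤ
    back (a ∷ u) eq = trans (cong (λ t → a * - (ρ ∙ β) + t) (∙-scaleʳ c u β))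
      (trans (l a c (ρ ∙ β) (u ∙ β)) (trans (sym (∙-elim c a u ρ β)) eq))
      where
      l : ∀ a c p q → a * - p + c * q ≡ c * q - a * p
      l = solve-∀

  -- A constraint (s , r) stands for the inequality p r ≤ q s in the unknown ratio p / q; the smallest s / r with r positive is the last ratio that meets them all.
  Slack : ℤ → ℤ → ℤ × ℤ → ℤ
  Slack q p (s , r) = q * s - p * r

  min-ratio : ∀ (cs : List (ℤ × ℤ)) → All (λ c → 0ℤ ≤ proj₁ c) cs → Any (λ c → 0ℤ < proj₂ c) cs →
    ∃₂ λ q p → 0ℤ < q × 0ℤ ≤ p × All (λ c → 0ℤ ≤ Slack q p c) cs ×
      Any (λ c → 0ℤ < proj₂ c × Slack q p c ≡ 0ℤ) cs
  min-ratio ((s , r) ∷ cs) (0≤s ∷ 0≤cs) ev with Any.any? (λ c → 0ℤ <? proj₂ c) cs | 0ℤ <? r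
  ... | no none | no r≯0 = contradiction ev λ { (here r>0) → r≯0 r>0 ; (there x) → none x }
  ... | no none | yes 0<r = r , s , 0<r , 0≤s , 0≤-by (l s r) ≤-refl ∷ rest 0≤cs none , here (0<r , l′ s r)
    where
    l : ∀ s r → 0ℤ ≡ r * s - s * r
    l = solve-∀
    l′ : ∀ s r → r * s - s * r ≡ 0ℤ
    l′ = solve-∀
    l″ : ∀ s r s′ r′ → r * s′ + s * (0ℤ - r′) ≡ r * s′ - s * r′
    l″ = solve-∀
    rest : ∀ {cs} → All (λ c → 0ℤ ≤ proj₁ c) cs → ¬ Any (λ c → 0ℤ < proj₂ c) cs → All (λ c → 0ℤ ≤ Slack r s c) cs
    rest [] _ = []
    rest {(s′ , r′) ∷ _} (h ∷ hs) no-one =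
      0≤-by (l″ s r s′ r′) (0≤+ (0≤* (0<⇒0≤ 0<r) h) (0≤* 0≤s (dif (≮⇒≥ (λ r′>0 → no-one (here r′>0))))))
      ∷ rest hs (λ x → no-one (there x))
  ... | yes some | d with min-ratio cs 0≤cs some
  ... | q , p , 0<q , 0≤p , ok , ev′ with 0ℤ ≤? q * s - p * r
  ... | yes h = q , p , 0<q , 0≤p , h ∷ ok , there ev′
  -- The new constraint fails at `p / q`. As `0 ≤ s`, this forces `0 < r`, and its own ratio `s / r`
  -- is smaller than `p / q`, so the earlier constraints survive.
  ... | no h = r , s , 0<r , 0≤s , 0≤-by (l s r) ≤-refl ∷ All.zipWith (λ (a , b) → rest a b) (0≤cs , ok) , here (0<r , l′ s r)
    where
    l : ∀ s r → 0ℤ ≡ r * s - s * r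
    l = solve-∀
    l′ : ∀ s r → r * s - s * r ≡ 0ℤ
    l′ = solve-∀
    gap : 0ℤ < p * r - q * s
    gap = <-by (k p q r s) (dif< (≰⇒> h))
      where
      k : ∀ p q r s → 0ℤ - (q * s - p * r) ≡ (p * r - q * s) - 0ℤ
      k = solve-∀
    0<r : 0ℤ < r
    0<r = ≰⇒> λ r≤0 → <-irrefl refl (<-≤-trans gap (≤-by (k p q r s) (0≤+ (0≤* 0≤p (dif r≤0)) (0≤* (0<⇒0≤ 0<q) 0≤s))))
      where
      k : ∀ p q r s → p * (0ℤ - r) + q * s ≡ 0ℤ - (p * r - q * s)
      k = solve-∀
    rest : ∀ {c} → 0ℤ ≤ proj₁ c → 0ℤ ≤ Slack q p c → 0ℤ ≤ Slack r s c
    rest {s′ , r′} h₁ h₂ with 0ℤ ≤? r′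
    ... | yes 0≤r′ = *-cancelˡ-≤-pos 0ℤ (r * s′ - s * r′) q {{positive 0<q}} (≤-by (k p q r s s′ r′) (0≤+ (0≤* (0<⇒0≤ 0<r) h₂) (0≤* 0≤r′ (0<⇒0≤ gap))))
      where
      k : ∀ p q r s s′ r′ → r * (q * s′ - p * r′) + r′ * (p * r - q * s) ≡ q * (r * s′ - s * r′) - q * 0ℤ
      k = solve-∀
    ... | no r′<0 = 0≤-by (k r s s′ r′) (0≤+ (0≤* (0<⇒0≤ 0<r) h₁) (0≤* 0≤s (0<⇒0≤ (dif< (≰⇒> r′<0)))))
      where
      k : ∀ r s s′ r′ → r * s′ + s * (0ℤ - r′) ≡ r * s′ - s * r′
      k = solve-∀

-- Rearranging a zero-sum sequence with all partial sums of norm at most `7 m / 3`.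

module SteinitzLemma where

  open import Data.Integer hiding (suc)
  open import Data.Integer.Properties
  open import Data.Integer.Tactic.RingSolver using (solve-∀)
  open import Data.Nat as ℕ using (ℕ; zero; suc)
  import Data.Nat.Properties as ℕₚ
  open import Data.Product using (_×_; _,_; ∃; proj₁; proj₂; Σ; ∃₂)
  open import Data.Sum using (_⊎_; inj₁; inj₂; [_,_]′)
  open import Data.List as List using (List; []; _∷_; length; _++_; map)
  import Data.List.Properties as Listₚ
  open import Data.List.Relation.Unary.All as All using (All; []; _∷_)
  import Data.List.Relation.Unary.All.Properties as Allₚ
  open import Data.List.Relation.Unary.Any as Any using (Any; here; there)
  import Data.List.Relation.Unary.Any.Properties as Anyₚ
  open import Data.List.Relation.Binary.Permutation.Propositional
  open import Data.List.Relation.Binary.Permutation.Propositional.Properties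
  open import Data.Vec as Vec using (Vec; []; _∷_)
  open import Relation.Nullary using (¬_; Dec; yes; no; contradiction)
  open import Relation.Binary.PropositionalEquality hiding (trans)
  import Relation.Binary.PropositionalEquality as ≡
  open import Data.Unit using (⊤; tt)
  open IntegerLinearAlgebra

  ∑ : ∀ {A : Set} → (A → ℤ) → List A → ℤ
  ∑ f [] = 0ℤ
  ∑ f (x ∷ xs) = f x + ∑ f xs

  module _ {A : Set} where

    ∑-↭ : ∀ (f : A → ℤ) {xs ys} → xs ↭ ys → ∑ f xs ≡ ∑ f ys
    ∑-↭ f refl = refl
    ∑-↭ f (prep x p) = cong (λ t → f x + t) (∑-↭ f p)
    ∑-↭ f (swap x y p) = ≡.trans (cong (λ t → f x + (f y + t)) (∑-↭ f p)) (l (f x) (f y) _)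
      where
      l : ∀ a b c → a + (b + c) ≡ b + (a + c)
      l = solve-∀
    ∑-↭ f (trans p q) = ≡.trans (∑-↭ f p) (∑-↭ f q)

    ∑-++ : ∀ (f : A → ℤ) xs ys → ∑ f (xs ++ ys) ≡ ∑ f xs + ∑ f ys
    ∑-++ f [] ys = sym (+-identityˡ _)
    ∑-++ f (x ∷ xs) ys = ≡.trans (cong (λ t → f x + t) (∑-++ f xs ys)) (sym (+-assoc (f x) _ _))

    ∑-nonneg : ∀ {f : A → ℤ} {xs} → All (λ x → 0ℤ ≤ f x) xs → 0ℤ ≤ ∑ f xs
    ∑-nonneg [] = ≤-refl
    ∑-nonneg (h ∷ hs) = +-mono-≤ h (∑-nonneg hs)

  infixl 7 _·_

  _·_ : ℤ³ → ℤ³ → ℤ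
  (a , b , c) · (x , y , z) = a * x + b * y + c * z

  ·-comm : ∀ u v → u · v ≡ v · u
  ·-comm (a , b , c) (x , y , z) = l a b c x y z
    where
    l : ∀ a b c x y z → a * x + b * y + c * z ≡ x * a + y * b + z * c
    l = solve-∀

  ·-+³ : ∀ u v Q → (u +³ v) · Q ≡ u · Q + v · Q
  ·-+³ (a , b , c) (a′ , b′ , c′) (x , y , z) = l a b c a′ b′ c′ x y z
    where
    l : ∀ a b c a′ b′ c′ x y z →
        (a + a′) * x + (b + b′) * y + (c + c′) * z ≡ a * x + b * y + c * z + (a′ * x + b′ * y + c′ * z)
    l = solve-∀

  ·-sum³ : ∀ L Q → sum³ L · Q ≡ ∑ (_· Q) L
  ·-sum³ [] (x , y , z) = l x y z
    where
    l : ∀ x y z → 0ℤ * x + 0ℤ * y + 0ℤ * z ≡ 0ℤ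
    l = solve-∀
  ·-sum³ (v ∷ L) Q = ≡.trans (·-+³ v (sum³ L) Q) (cong (λ t → v · Q + t) (·-sum³ L Q))

  infixr 7 _·³_

  _·³_ : ℤ → ℤ³ → ℤ³
  k ·³ (x , y , z) = k * x , k * y , k * z

  ·³-· : ∀ k u Q → (k ·³ u) · Q ≡ k * (u · Q)
  ·³-· k (a , b , c) (x , y , z) = l k a b c x y z
    where
    l : ∀ k a b c x y z → k * a * x + k * b * y + k * c * z ≡ k * (a * x + b * y + c * z)
    l = solve-∀

  ·-·³ : ∀ k u Q → u · (k ·³ Q) ≡ k * (u · Q)
  ·-·³ k u Q = ≡.trans (·-comm u (k ·³ Q)) (≡.trans (·³-· k Q u) (cong (k *_) (·-comm Q u)))

  ≡³ : ∀ {a b c x y z : ℤ} → a ≡ x → b ≡ y → c ≡ z → (a , b , c) ≡ (x , y , z)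
  ≡³ refl refl refl = refl

  sum³-↭ : ∀ {xs ys} → xs ↭ ys → sum³ xs ≡ sum³ ys
  sum³-↭ refl = refl
  sum³-↭ (prep x p) = cong (x +³_) (sum³-↭ p)
  sum³-↭ (swap (a , b , c) (a′ , b′ , c′) p) = ≡.trans (cong (λ t → (a , b , c) +³ ((a′ , b′ , c′) +³ t)) (sum³-↭ p)) (≡³ (l a a′ _) (l b b′ _) (l c c′ _))
    where
    l : ∀ x y z → x + (y + z) ≡ y + (x + z)
    l = solve-∀
  sum³-↭ (trans p q) = ≡.trans (sum³-↭ p) (sum³-↭ q)

  -- The ball of radius `m` and its support function.

  module Steinitz (m : ℕ) where

    mm : ℤ
    mm = + m * + m

    0≤mm : 0ℤ ≤ mm
    0≤mm = 0≤* (0≤ℕ m) (0≤ℕ m)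

    Ball : ℤ³ → Set
    Ball = InBall m

    -- The squared form of `|p| ≤ 7 m / 3`.
    Good : ℤ³ → Set
    Good p = + 9 * (p · p) ≤ + 49 * mm

    -- Twice the gap is the sum of the gaps in the two ball conditions and of `|u - v|²`, so no
    -- square root is needed.
    ball-· : ∀ u v → Ball u → Ball v → u · v ≤ mm
    ball-· u@(a , b , c) v@(x , y , z) hu hv = *-cancelˡ-≤-pos (u · v) mm (+ 2)
      (≤-by (l a b c x y z mm) (0≤+ (0≤+ (dif hu) (dif hv)) (0≤+ (0≤+ (sq (a - x)) (sq (b - y))) (sq (c - z)))))
      where
      sq : ∀ i → 0ℤ ≤ i * i
      sq (+ n) = 0≤* {+ n} {+ n} (+≤+ ℕ.z≤n) (+≤+ ℕ.z≤n)
      sq -[1+ n ] = +≤+ ℕ.z≤n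
      l : ∀ a b c x y z mm → (mm - (a * a + b * b + c * c)) + (mm - (x * x + y * y + z * z))
          + ((a - x) * (a - x) + (b - y) * (b - y) + (c - z) * (c - z))
          ≡ + 2 * mm - + 2 * (a * x + b * y + c * z)
      l = solve-∀

    -ball : ∀ {w} → Ball w → Ball (- 1ℤ ·³ w)
    -ball {a , b , c} = subst (_≤ mm) (l a b c)
      where
      l : ∀ a b c → a * a + b * b + c * c ≡ - 1ℤ * a * (- 1ℤ * a) + - 1ℤ * b * (- 1ℤ * b) + - 1ℤ * c * (- 1ℤ * c)
      l = solve-∀

    -- The hypothesis says that the support function of p is at most W / N times that of the ball, that is, p ∈ (W / N) · Ball.
    good-by-support : ∀ {N W} p → 0ℤ < N → 0ℤ ≤ W → + 3 * W ≤ + 7 * N →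
      (∀ Q X → (∀ v → Ball v → v · Q ≤ X) → N * (p · Q) ≤ W * X) → Good p
    good-by-support {N} {W} p 0<N 0≤W W≤N supp =
      *-cancelˡ-≤-pos (+ 9 * (p · p)) (+ 49 * mm) (N * N) {{positive (0<* 0<N 0<N)}}
        (≤-by (l N W (p · p) mm) (0≤+ (0≤* (0≤ℕ 9) (dif twice))
          (0≤* 0≤mm (0≤* (dif W≤N) (0≤+ (0≤* (0≤ℕ 3) 0≤W) (0≤* (0≤ℕ 7) (0<⇒0≤ 0<N)))))))
      where
      -- The ball is its own polar up to the factor `mm`: every ball vector is a test vector with
      -- bound `mm`. This gives the bound `W * mm` for the test vector `N ·³ p`, and the second use
      -- of the hypothesis yields `N² |p|² ≤ W² mm`.
      once : ∀ v → Ball v → v · (N ·³ p) ≤ W * mm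
      once v hv = subst (_≤ W * mm) (sym (≡.trans (·-·³ N v p) (cong (N *_) (·-comm v p))))
        (supp v mm (λ u hu → ball-· u v hu hv))
      twice : N * (N * (p · p)) ≤ W * (W * mm)
      twice = subst (λ t → N * t ≤ W * (W * mm)) (·-·³ N p p) (supp (N ·³ p) (W * mm) once)
      l : ∀ N W P M → + 9 * (W * (W * M) - N * (N * P)) + M * ((+ 7 * N - + 3 * W) * (+ 3 * W + + 7 * N))
          ≡ N * N * (+ 49 * M) - N * N * (+ 9 * P)
      l = solve-∀

    -- Zero-sum systems with fractional weights.

    Item : Set
    Item = ℤ³ × ℤ

    Ok : ℤ → Item → Set
    Ok N (v , n) = Ball v × 0ℤ ≤ n × n ≤ N

    vecs : List Item → List ℤ³
    vecs = map proj₁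

    moment : ℤ³ → List Item → ℤ
    moment Q = ∑ (λ (v , n) → n * (v · Q))

    -- The deficit `Σ (1 - λ)`, multiplied by the common denominator.
    defect : ℤ → List Item → ℤ
    defect N = ∑ (λ (v , n) → N - n)

    -- A fractional zero-sum subsystem with common denominator N: the vectors of O have weight N / N, those of L the weights n / N, and w is a discarded vector of weight c / N.
    record St (N : ℤ) (O : List ℤ³) (L : List Item) (w : ℤ³) (c : ℤ) : Set where
      constructor st
      field
        0<N : 0ℤ < N
        okO : All Ball O
        okL : All (Ok N) L
        okw : Ball w
        0≤c : 0ℤ ≤ c
        c≤N : + 3 * c ≤ N
        zero-sum : ∀ Q → N * ∑ (_· Q) O + moment Q L + c * (w · Q) ≡ 0ℤ
    open St public

    St-↭ : ∀ {N O L L′ w c} → L ↭ L′ → St N O L w c → St N O L′ w c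
    St-↭ {N} {O} {L} {L′} {w} {c} p s = record
      { 0<N = 0<N s ; okO = okO s ; okw = okw s ; 0≤c = 0≤c s ; c≤N = c≤N s
      ; okL = All-resp-↭ p (okL s)
      ; zero-sum = λ Q → ≡.trans (cong (λ t → N * ∑ (_· Q) O + t + c * (w · Q)) (sym (∑-↭ _ p))) (zero-sum s Q) }

    full : ℤ → List ℤ³ → List Item
    full N = map (_, N)

    vecs-full : ∀ N O → vecs (full N O) ≡ O
    vecs-full N [] = refl
    vecs-full N (v ∷ O) = cong (v ∷_) (vecs-full N O)

    defect-full : ∀ N O → defect N (full N O) ≡ 0ℤ
    defect-full N [] = refl
    defect-full N (v ∷ O) = cong₂ _+_ (+-inverseʳ N) (defect-full N O)

    moment-full : ∀ N Q O → moment Q (full N O) ≡ N * ∑ (_· Q) O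
    moment-full N Q [] = sym (*-zeroʳ N)
    moment-full N Q (v ∷ O) = ≡.trans (cong (λ t → N * (v · Q) + t) (moment-full N Q O)) (sym (*-distribˡ-+ N _ _))

    -- A vector of weight 1 is an item with `n = N` and costs no deficit, so it may pass between `O`
    -- and `L`; `emit` is the converse.
    absorb : ∀ {N O L w c} → St N O L w c → St N [] (full N O ++ L) w c
    absorb {N} {O} {L} {w} {c} s = record
      { 0<N = 0<N s ; okO = [] ; okw = okw s ; 0≤c = 0≤c s ; c≤N = c≤N s
      ; okL = Allₚ.++⁺ (Allₚ.map⁺ (All.map (λ h → h , 0<⇒0≤ (0<N s) , ≤-refl) (okO s))) (okL s)
      ; zero-sum = λ Q → ≡.trans (cong (λ t → N * 0ℤ + t + c * (w · Q)) (≡.trans (∑-++ _ (full N O) L) (cong (_+ moment Q L) (moment-full N Q O))))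
          (≡.trans (l N (∑ (_· Q) O) (moment Q L) (c * (w · Q))) (zero-sum s Q)) }
      where
      l : ∀ N a b d → N * 0ℤ + (N * a + b) + d ≡ N * a + b + d
      l = solve-∀

    vecs-absorb : ∀ N O L → vecs (full N O ++ L) ≡ O ++ vecs L
    vecs-absorb N O L = ≡.trans (Listₚ.map-++ proj₁ (full N O) L) (cong (_++ vecs L) (vecs-full N O))

    defect-absorb : ∀ N O L → defect N (full N O ++ L) ≡ defect N L
    defect-absorb N O L = ≡.trans (∑-++ _ (full N O) L) (≡.trans (cong (_+ defect N L) (defect-full N O)) (+-identityˡ _))

    emit : ∀ {N O L w c} O′ → All Ball O′ → St N O (full N O′ ++ L) w c → St N (O′ ++ O) L w c
    emit {N} {O} {L} {w} {c} O′ hO′ s = record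
      { 0<N = 0<N s ; okO = Allₚ.++⁺ hO′ (okO s) ; okw = okw s ; 0≤c = 0≤c s ; c≤N = c≤N s
      ; okL = Allₚ.++⁻ʳ (full N O′) (okL s)
      ; zero-sum = λ Q → ≡.trans (cong (λ t → N * t + moment Q L + c * (w · Q)) (∑-++ (_· Q) O′ O))
          (≡.trans (l N (∑ (_· Q) O) (∑ (_· Q) O′) (moment Q L) (c * (w · Q)))
          (≡.trans (cong (λ t → N * ∑ (_· Q) O + t + c * (w · Q)) (sym (≡.trans (∑-++ _ (full N O′) L) (cong (_+ moment Q L) (moment-full N Q O′)))))
          (zero-sum s Q))) }
      where
      l : ∀ N a a′ b d → N * (a′ + a) + b + d ≡ N * a + (N * a′ + b) + d
      l = solve-∀

    drop-zero : ∀ {N O v L w c} → St N O ((v , 0ℤ) ∷ L) w c → St N O L w c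
    drop-zero {N} {O} {v} {L} {w} {c} s = record
      { 0<N = 0<N s ; okO = okO s ; okw = okw s ; 0≤c = 0≤c s ; c≤N = c≤N s
      ; okL = All.tail (okL s)
      ; zero-sum = λ Q → ≡.trans (cong (λ t → N * ∑ (_· Q) O + t + c * (w · Q)) (sym (+-identityˡ (moment Q L)))) (zero-sum s Q) }

    -- Moving the weights along a linear relation.

    AItem : Set
    AItem = ℤ³ × ℤ × ℤ

    cur dir : AItem → Item
    cur (v , n , d) = v , n
    dir (v , n , d) = v , d

    δ : AItem → ℤ
    δ (v , n , d) = d

    -- The weight `n / N` changed by `(p / q) (d / N)`, over the new denominator `q * N`.
    stepped : ℤ → ℤ → AItem → Item
    stepped q p (v , n , d) = v , q * n + p * d

    moment-stepped : ∀ q p Q A → moment Q (map (stepped q p) A) ≡ q * moment Q (map cur A) + p * moment Q (map dir A)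
    moment-stepped q p Q [] = l q p
      where
      l : ∀ q p → 0ℤ ≡ q * 0ℤ + p * 0ℤ
      l = solve-∀
    moment-stepped q p Q ((v , n , d) ∷ A) = ≡.trans (cong (λ t → (q * n + p * d) * (v · Q) + t) (moment-stepped q p Q A)) (l q p n d (v · Q) _ _)
      where
      l : ∀ q p n d x a b → (q * n + p * d) * x + (q * a + p * b) ≡ q * (n * x + a) + p * (d * x + b)
      l = solve-∀

    defect-stepped : ∀ q p N A → defect (q * N) (map (stepped q p) A) ≡ q * defect N (map cur A) - p * ∑ δ A
    defect-stepped q p N [] = l q p
      where
      l : ∀ q p → 0ℤ ≡ q * 0ℤ - p * 0ℤ
      l = solve-∀
    defect-stepped q p N ((v , n , d) ∷ A) = ≡.trans (cong (λ t → q * N - (q * n + p * d) + t) (defect-stepped q p N A)) (l q p N n d _ _)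
      where
      l : ∀ q p N n d a b → q * N - (q * n + p * d) + (q * a - p * b) ≡ q * (N - n + a) - p * (d + b)
      l = solve-∀

    vecs-stepped : ∀ q p A → vecs (map (stepped q p) A) ≡ vecs (map cur A)
    vecs-stepped q p [] = refl
    vecs-stepped q p ((v , n , d) ∷ A) = cong (v ∷_) (vecs-stepped q p A)

    Event : ℤ → Item → Set
    Event N (v , n) = n ≡ 0ℤ ⊎ n ≡ N

    -- Each item contributes `0 ≤ n + (p / q) d ≤ N`. The discarded weight only has to stay
    -- non-negative: its upper bound persists because `dc ≤ 0`.
    constraints : ℤ → ℤ → ℤ → List AItem → List (ℤ × ℤ)
    constraints N c dc [] = (c , - dc) ∷ []
    constraints N c dc ((v , n , d) ∷ A) = (n , - d) ∷ (N - n , d) ∷ constraints N c dc A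

    constraints-nonneg : ∀ {N c} dc A → 0ℤ ≤ c → All (Ok N) (map cur A) → All (λ k → 0ℤ ≤ proj₁ k) (constraints N c dc A)
    constraints-nonneg dc [] h [] = h ∷ []
    constraints-nonneg dc (_ ∷ A) h ((_ , 0≤n , n≤N) ∷ hs) = 0≤n ∷ dif n≤N ∷ constraints-nonneg dc A h hs

    neg-pos : ∀ {i} → i < 0ℤ → 0ℤ < - i
    neg-pos = neg-mono-<

    constraints-pos : ∀ N c dc A → Any (λ a → δ a ≢ 0ℤ) A ⊎ dc < 0ℤ → Any (λ k → 0ℤ < proj₂ k) (constraints N c dc A)
    constraints-pos N c dc [] (inj₂ h) = here (neg-pos h)
    constraints-pos N c dc (_ ∷ A) (inj₂ h) = there (there (constraints-pos N c dc A (inj₂ h)))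
    constraints-pos N c dc (_ ∷ A) (inj₁ (there h)) = there (there (constraints-pos N c dc A (inj₁ h)))
    constraints-pos N c dc ((v , n , d) ∷ A) (inj₁ (here h)) with 0ℤ <? d
    ... | yes 0<d = there (here 0<d)
    ... | no d≤0 = here (neg-pos (≤∧≢⇒< (≮⇒≥ d≤0) h))

    slack⁻ : ∀ q p n d → q * n - p * - d ≡ q * n + p * d
    slack⁻ = solve-∀

    slack⁺ : ∀ q p N n d → q * (N - n) - p * d ≡ q * N - (q * n + p * d)
    slack⁺ = solve-∀

    constraints-ok : ∀ {N c dc} q p A → All (Ok N) (map cur A) → All (λ k → 0ℤ ≤ Slack q p k) (constraints N c dc A) →
      All (Ok (q * N)) (map (stepped q p) A) × 0ℤ ≤ q * c + p * dc
    constraints-ok {N} {c} {dc} q p [] [] (h ∷ []) = [] , 0≤-by (slack⁻ q p c dc) h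
    constraints-ok {N} {c} {dc} q p ((v , n , d) ∷ A) ((b , _) ∷ hs) (h ∷ h′ ∷ ks) with constraints-ok q p A hs ks
    ... | r , r′ = (b , 0≤-by (slack⁻ q p n d) h , ≤-by (slack⁺ q p N n d) h′) ∷ r , r′

    constraints-event : ∀ {N c dc} q p A → Any (λ k → 0ℤ < proj₂ k × Slack q p k ≡ 0ℤ) (constraints N c dc A) →
      Any (Event (q * N)) (map (stepped q p) A) ⊎ (dc < 0ℤ × q * c + p * dc ≡ 0ℤ)
    constraints-event {N} {c} {dc} q p [] (here (h , e)) = inj₂ (neg-cancel-< h , ≡.trans (sym (slack⁻ q p c dc)) e)
    constraints-event {N} {c} {dc} q p ((v , n , d) ∷ A) (here (h , e)) = inj₁ (here (inj₁ (≡.trans (sym (slack⁻ q p n d)) e)))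
    constraints-event {N} {c} {dc} q p ((v , n , d) ∷ A) (there (here (h , e))) =
      inj₁ (here (inj₂ (sym (i-j≡0⇒i≡j (q * N) (q * n + p * d) (≡.trans (sym (slack⁺ q p N n d)) e)))))
    constraints-event q p ((v , n , d) ∷ A) (there (there h)) with constraints-event q p A h
    ... | inj₁ x = inj₁ (there x)
    ... | inj₂ y = inj₂ y

    -- The ratio test stops at a tight constraint, and a non-zero `δ` or `dc < 0` guarantees that
    -- there is a constraint to stop it. The tight one tells what was reached: weight 0 or 1 of an
    -- item, or weight 0 of the discarded vector.
    move : ∀ {N O w c} A dc → St N O (map cur A) w c → (∀ Q → moment Q (map dir A) + dc * (w · Q) ≡ 0ℤ) →
      dc ≤ 0ℤ → Any (λ a → δ a ≢ 0ℤ) A ⊎ dc < 0ℤ →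
      ∃₂ λ q p → 0ℤ < q × 0ℤ ≤ p × St (q * N) O (map (stepped q p) A) w (q * c + p * dc) ×
        (Any (Event (q * N)) (map (stepped q p) A) ⊎ (dc < 0ℤ × q * c + p * dc ≡ 0ℤ))
    move {N} {O} {w} {c} A dc s dep dc≤0 nz
      with min-ratio (constraints N c dc A) (constraints-nonneg dc A (0≤c s) (okL s)) (constraints-pos N c dc A nz)
    ... | q , p , 0<q , 0≤p , ok , ev with constraints-ok q p A (okL s) ok
    ... | ok′ , 0≤c′ = q , p , 0<q , 0≤p , record
      { 0<N = 0<* 0<q (0<N s) ; okO = okO s ; okL = ok′ ; okw = okw s ; 0≤c = 0≤c′
      ; c≤N = ≤-by (l₁ q p N c dc) (0≤+ (0≤* (0<⇒0≤ 0<q) (dif (c≤N s))) (0≤* (0≤* (0≤ℕ 3) 0≤p) (dif dc≤0)))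
      ; zero-sum = λ Q → ≡.trans (cong (λ t → q * N * ∑ (_· Q) O + t + (q * c + p * dc) * (w · Q)) (moment-stepped q p Q A))
          (≡.trans (l₂ q p N c dc (∑ (_· Q) O) (moment Q (map cur A)) (moment Q (map dir A)) (w · Q))
          (≡.trans (cong₂ (λ a b → q * a + p * b) (zero-sum s Q) (dep Q)) (l₃ q p))) }
      , constraints-event q p A ev
      where
      l₁ : ∀ q p N c d → q * (N - + 3 * c) + + 3 * p * (0ℤ - d) ≡ q * N - + 3 * (q * c + p * d)
      l₁ = solve-∀
      l₂ : ∀ q p N c d o a b x → q * N * o + (q * a + p * b) + (q * c + p * d) * x ≡ q * (N * o + a + c * x) + p * (b + d * x)
      l₂ = solve-∀
      l₃ : ∀ q p → q * 0ℤ + p * 0ℤ ≡ 0ℤ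
      l₃ = solve-∀

    -- Linear relations between the vectors of a system.

    annotate : ∀ (L : List Item) → Vec ℤ (length L) → List AItem
    annotate [] [] = []
    annotate ((v , n) ∷ L) (a ∷ α) = (v , n , a) ∷ annotate L α

    cur-annotate : ∀ L α → map cur (annotate L α) ≡ L
    cur-annotate [] [] = refl
    cur-annotate ((v , n) ∷ L) (a ∷ α) = cong ((v , n) ∷_) (cur-annotate L α)

    row : (ℤ³ → ℤ) → ∀ (L : List Item) → Vec ℤ (length L)
    row f [] = []
    row f ((v , n) ∷ L) = f v ∷ row f L

    π₁ π₂ π₃ : ℤ³ → ℤ
    π₁ (x , y , z) = x
    π₂ (x , y , z) = y
    π₃ (x , y , z) = z

    moment-annotate : ∀ Q L α → moment Q (map dir (annotate L α)) ≡
      π₁ Q * (row π₁ L ∙ α) + π₂ Q * (row π₂ L ∙ α) + π₃ Q * (row π₃ L ∙ α)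
    moment-annotate (X , Y , Z) [] [] = l X Y Z
      where
      l : ∀ X Y Z → 0ℤ ≡ X * 0ℤ + Y * 0ℤ + Z * 0ℤ
      l = solve-∀
    moment-annotate Q@(X , Y , Z) (((x , y , z) , n) ∷ L) (a ∷ α) =
      ≡.trans (cong (λ t → a * (x * X + y * Y + z * Z) + t) (moment-annotate Q L α)) (l a x y z X Y Z _ _ _)
      where
      l : ∀ a x y z X Y Z p q r → a * (x * X + y * Y + z * Z) + (X * p + Y * q + Z * r)
          ≡ X * (x * a + p) + Y * (y * a + q) + Z * (z * a + r)
      l = solve-∀

    ∑δ-annotate : ∀ L α → ∑ δ (annotate L α) ≡ row (λ _ → 1ℤ) L ∙ α
    ∑δ-annotate [] [] = refl
    ∑δ-annotate ((v , n) ∷ L) (a ∷ α) = cong₂ _+_ (sym (*-identityˡ a)) (∑δ-annotate L α)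

    nonzero-annotate : ∀ L α → NonZeroVec α → Any (λ a → δ a ≢ 0ℤ) (annotate L α)
    nonzero-annotate [] [] h = contradiction refl h
    nonzero-annotate ((v , n) ∷ L) (a ∷ α) h with a ≟ 0ℤ
    ... | no a≢0 = here a≢0
    ... | yes refl = there (nonzero-annotate L α (λ { refl → h refl }))

    combine : ∀ X Y Z {p q r} → p ≡ 0ℤ → q ≡ 0ℤ → r ≡ 0ℤ → X * p + Y * q + Z * r ≡ 0ℤ
    combine X Y Z refl refl refl = l X Y Z
      where
      l : ∀ X Y Z → X * 0ℤ + Y * 0ℤ + Z * 0ℤ ≡ 0ℤ
      l = solve-∀

    -- Four vectors in dimension three are dependent. The sign is chosen so that moving forward does
    -- not lower the total weight.
    relation₃ : ∀ L → 3 ℕ.< length L → ∃ λ A → map cur A ≡ L × (∀ Q → moment Q (map dir A) ≡ 0ℤ) ×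
      0ℤ ≤ ∑ δ A × Any (λ a → δ a ≢ 0ℤ) A
    relation₃ L h with kernel (length L) (row π₁ L ∷ row π₂ L ∷ row π₃ L ∷ []) h
    ... | α , α≢0 , e₁ ∷ e₂ ∷ e₃ ∷ [] with 0ℤ ≤? row (λ _ → 1ℤ) L ∙ α
    ... | yes 0≤s = annotate L α , cur-annotate L α ,
      (λ Q → ≡.trans (moment-annotate Q L α) (combine (π₁ Q) (π₂ Q) (π₃ Q) e₁ e₂ e₃)) ,
      0≤-by (sym (∑δ-annotate L α)) 0≤s , nonzero-annotate L α α≢0
    ... | no s<0 = annotate L β , cur-annotate L β ,
      (λ Q → ≡.trans (moment-annotate Q L β) (combine (π₁ Q) (π₂ Q) (π₃ Q) (z (row π₁ L) e₁) (z (row π₂ L) e₂) (z (row π₃ L) e₃))) ,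
      0≤-by (≡.trans (k (row (λ _ → 1ℤ) L ∙ α)) (sym (≡.trans (∑δ-annotate L β) (∙-scaleʳ (- 1ℤ) (row (λ _ → 1ℤ) L) α)))) (0<⇒0≤ (dif< (≰⇒> s<0))) ,
      nonzero-annotate L β (scale-nonzero (- 1ℤ) α (λ ()) α≢0)
      where
      β = Vec.map (- 1ℤ *_) α
      z : ∀ u → u ∙ α ≡ 0ℤ → u ∙ β ≡ 0ℤ
      z u e = ≡.trans (∙-scaleʳ (- 1ℤ) u α) (cong (- 1ℤ *_) e)
      k : ∀ s → 0ℤ - s ≡ - 1ℤ * s
      k = solve-∀

    -- One more equation keeps the total weight fixed, at the price of a fifth vector.
    relation₄ : ∀ L → 4 ℕ.< length L → ∃ λ A → map cur A ≡ L × (∀ Q → moment Q (map dir A) ≡ 0ℤ) ×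
      ∑ δ A ≡ 0ℤ × Any (λ a → δ a ≢ 0ℤ) A
    relation₄ L h with kernel (length L) (row π₁ L ∷ row π₂ L ∷ row π₃ L ∷ row (λ _ → 1ℤ) L ∷ []) h
    ... | α , α≢0 , e₁ ∷ e₂ ∷ e₃ ∷ e₄ ∷ [] = annotate L α , cur-annotate L α ,
      (λ Q → ≡.trans (moment-annotate Q L α) (combine (π₁ Q) (π₂ Q) (π₃ Q) e₁ e₂ e₃)) ,
      ≡.trans (∑δ-annotate L α) e₄ , nonzero-annotate L α α≢0

    -- The discarded vector serves as the fifth one. Its entry in the last row is 0 because its
    -- weight does not count in the deficit, and the sign is chosen so that this weight cannot grow.
    relationʷ : ∀ L w → 3 ℕ.< length L → ∃₂ λ A dc → map cur A ≡ L × (∀ Q → moment Q (map dir A) + dc * (w · Q) ≡ 0ℤ) ×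
      ∑ δ A ≡ 0ℤ × dc ≤ 0ℤ × (Any (λ a → δ a ≢ 0ℤ) A ⊎ dc < 0ℤ)
    relationʷ L w h with kernel (suc (length L))
      ((π₁ w ∷ row π₁ L) ∷ (π₂ w ∷ row π₂ L) ∷ (π₃ w ∷ row π₃ L) ∷ (0ℤ ∷ row (λ _ → 1ℤ) L) ∷ []) (ℕ.s≤s h)
    ... | a ∷ α , α≢0 , e₁ ∷ e₂ ∷ e₃ ∷ e₄ ∷ [] with 0ℤ ≤? a
    ... | no a<0 = annotate L α , a , cur-annotate L α ,
      (λ Q → ≡.trans (cong (_+ a * (w · Q)) (moment-annotate Q L α)) (≡.trans (k Q) (combine (π₁ Q) (π₂ Q) (π₃ Q) e₁ e₂ e₃))) ,
      ≡.trans (∑δ-annotate L α) (≡.trans (sym (+-identityˡ _)) e₄) , <⇒≤ (≰⇒> a<0) , inj₂ (≰⇒> a<0)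
      where
      k : ∀ Q → π₁ Q * (row π₁ L ∙ α) + π₂ Q * (row π₂ L ∙ α) + π₃ Q * (row π₃ L ∙ α) + a * (w · Q)
        ≡ π₁ Q * (π₁ w * a + row π₁ L ∙ α) + π₂ Q * (π₂ w * a + row π₂ L ∙ α) + π₃ Q * (π₃ w * a + row π₃ L ∙ α)
      k (X , Y , Z) = l a (π₁ w) (π₂ w) (π₃ w) X Y Z _ _ _
        where
        l : ∀ a x y z X Y Z p q r → X * p + Y * q + Z * r + a * (x * X + y * Y + z * Z)
            ≡ X * (x * a + p) + Y * (y * a + q) + Z * (z * a + r)
        l = solve-∀
    ... | yes 0≤a = annotate L β , b , cur-annotate L β ,
      (λ Q → ≡.trans (cong (_+ b * (w · Q)) (moment-annotate Q L β)) (≡.trans (k Q) (combine (π₁ Q) (π₂ Q) (π₃ Q) (z (π₁ w) (row π₁ L) e₁) (z (π₂ w) (row π₂ L) e₂) (z (π₃ w) (row π₃ L) e₃)))) ,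
      ≡.trans (∑δ-annotate L β) (≡.trans (sym (+-identityˡ _)) (z 0ℤ (row (λ _ → 1ℤ) L) e₄)) , b≤0 , nz
      where
      b = - 1ℤ * a
      β = Vec.map (- 1ℤ *_) α
      z : ∀ x u → x * a + u ∙ α ≡ 0ℤ → x * b + u ∙ β ≡ 0ℤ
      z x u e = ≡.trans (∙-scaleʳ (- 1ℤ) (x ∷ u) (a ∷ α)) (cong (- 1ℤ *_) e)
      b≤0 : b ≤ 0ℤ
      b≤0 = ≤-by (l a) 0≤a
        where
        l : ∀ a → a ≡ 0ℤ - - 1ℤ * a
        l = solve-∀
      nz : Any (λ a → δ a ≢ 0ℤ) (annotate L β) ⊎ b < 0ℤ
      nz with b <? 0ℤ
      ... | yes h′ = inj₂ h′
      ... | no h′ = inj₁ (nonzero-annotate L β λ e → scale-nonzero (- 1ℤ) (a ∷ α) (λ ()) α≢0 (cong₂ _∷_ (≤-antisym b≤0 (≮⇒≥ h′)) e))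
      k : ∀ Q → π₁ Q * (row π₁ L ∙ β) + π₂ Q * (row π₂ L ∙ β) + π₃ Q * (row π₃ L ∙ β) + b * (w · Q)
        ≡ π₁ Q * (π₁ w * b + row π₁ L ∙ β) + π₂ Q * (π₂ w * b + row π₂ L ∙ β) + π₃ Q * (π₃ w * b + row π₃ L ∙ β)
      k (X , Y , Z) = l b (π₁ w) (π₂ w) (π₃ w) X Y Z _ _ _
        where
        l : ∀ a x y z X Y Z p q r → X * p + Y * q + Z * r + a * (x * X + y * Y + z * Z)
            ≡ X * (x * a + p) + Y * (y * a + q) + Z * (z * a + r)
        l = solve-∀

    -- Reduction to a vanishing weight or four fractional weights.

    Strict : ℤ → Item → Set
    Strict N (v , n) = Ball v × 0ℤ < n × n < N

    ¬event : ∀ {N x} → Strict N x → ¬ Event N x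
    ¬event (_ , 0<n , _) (inj₁ refl) = <-irrefl refl 0<n
    ¬event (_ , _ , n<N) (inj₂ refl) = <-irrefl refl n<N

    classify : ∀ N L → All (Ok N) L →
      (∃₂ λ v L′ → L ↭ (v , 0ℤ) ∷ L′) ⊎ (∃₂ λ O F → L ↭ full N O ++ F × All Ball O × All (Strict N) F)
    classify N [] [] = inj₂ ([] , [] , refl , [] , [])
    classify N ((v , n) ∷ L) ((b , 0≤n , n≤N) ∷ hs) with n ≟ 0ℤ | n ≟ N | classify N L hs
    ... | yes refl | _ | _ = inj₁ (v , L , refl)
    ... | no _ | _ | inj₁ (u , L′ , p) = inj₁ (u , (v , n) ∷ L′ , trans (prep _ p) (swap _ _ refl))
    ... | no _ | yes refl | inj₂ (O , F , p , hO , hF) = inj₂ (v ∷ O , F , prep _ p , b ∷ hO , hF)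
    ... | no n≢0 | no n≢N | inj₂ (O , F , p , hO , hF) = inj₂ (O , (v , n) ∷ F ,
      trans (prep _ p) (↭-sym (shift (v , n) (full N O) F)) , hO ,
      (b , ≤∧≢⇒< 0≤n (λ e → n≢0 (sym e)) , ≤∧≢⇒< n≤N n≢N) ∷ hF)

    -- A positive weight misses less than 1, so three of them fall short of deficit 3. Hence from
    -- deficit 3 on, if no weight is 0, at least four are fractional.
    few-strict : ∀ {N} F → 0ℤ < N → All (Strict N) F → length F ℕ.≤ 3 → defect N F < + 3 * N
    few-strict {N} F 0<N hs h = go F hs h
      where
      N≥ = 0<⇒0≤ 0<N
      go : ∀ F → All (Strict N) F → length F ℕ.≤ 3 → defect N F < + 3 * N
      go [] [] _ = <-by (l N) 0<N′
        where
        0<N′ = 0<* {+ 3} {N} (+<+ (ℕ.s≤s ℕ.z≤n)) 0<N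
        l : ∀ N → + 3 * N ≡ + 3 * N - 0ℤ
        l = solve-∀
      go ((_ , a) ∷ []) ((_ , 0<a , _) ∷ []) _ = <-by (l N a) (0<+0≤ 0<a (0≤* (0≤ℕ 2) N≥))
        where
        l : ∀ N a → a + + 2 * N ≡ + 3 * N - (N - a + 0ℤ)
        l = solve-∀
      go ((_ , a) ∷ (_ , b) ∷ []) ((_ , 0<a , _) ∷ (_ , 0<b , _) ∷ []) _ = <-by (l N a b) (0<+0≤ 0<a (0≤+ (0<⇒0≤ 0<b) N≥))
        where
        l : ∀ N a b → a + (b + N) ≡ + 3 * N - (N - a + (N - b + 0ℤ))
        l = solve-∀
      go ((_ , a) ∷ (_ , b) ∷ (_ , c) ∷ []) ((_ , 0<a , _) ∷ (_ , 0<b , _) ∷ (_ , 0<c , _) ∷ []) _ =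
        <-by (l N a b c) (0<+0≤ 0<a (0≤+ (0<⇒0≤ 0<b) (0<⇒0≤ 0<c)))
        where
        l : ∀ N a b c → a + (b + c) ≡ + 3 * N - (N - a + (N - b + (N - c + 0ℤ)))
        l = solve-∀
      go (_ ∷ _ ∷ _ ∷ _ ∷ _) _ (ℕ.s≤s (ℕ.s≤s (ℕ.s≤s ())))

    -- `W / 3` is the deficit before the removal; taking out a vector of weight 0 lowers it by
    -- exactly 1, hence `W - + 3`. The field `no-w` ensures that a system without debt does not
    -- acquire one.
    record Removal (W : ℤ) (B : List ℤ³) (w : ℤ³) (c : ℤ) : Set where
      field
        {v} : ℤ³
        {rest} : List Item
        {N′ c′} : ℤ
        perm : B ↭ v ∷ vecs rest
        state : St N′ [] rest w c′
        deficit : + 3 * defect N′ rest ≡ (W - + 3) * N′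
        no-w : c ≡ 0ℤ → c′ ≡ 0ℤ

    -- What is left when no weight was brought to 0: four items, weight 1 everywhere else, and the
    -- discarded weight used up.
    record Quad (W : ℤ) (B : List ℤ³) (w : ℤ³) : Set where
      field
        {O} : List ℤ³
        {F} : List Item
        {N′} : ℤ
        four : length F ≡ 4
        perm : B ↭ O ++ vecs F
        state : St N′ O F w 0ℤ
        deficit : + 3 * defect N′ F ≡ W * N′

    map-no-w : ∀ {W B w c c₁} → (c ≡ 0ℤ → c₁ ≡ 0ℤ) → Removal W B w c₁ → Removal W B w c
    map-no-w f r = record { perm = Removal.perm r ; state = Removal.state r ; deficit = Removal.deficit r ; no-w = λ e → Removal.no-w r (f e) }

    remove-zero : ∀ {W B N O F w c v F′} → St N O F w c → + 3 * defect N F ≡ W * N → B ↭ O ++ vecs F →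
      F ↭ (v , 0ℤ) ∷ F′ → Removal W B w c
    remove-zero {W} {B} {N} {O} {F} {w} {c} {v} {F′} s e p pF = record
      { perm = trans p (trans (++⁺ˡ O (map⁺ proj₁ pF)) (trans (shift v O (vecs F′)) (↭-reflexive (cong (v ∷_) (sym (vecs-absorb N O F′))))))
      ; state = absorb (drop-zero (St-↭ pF s))
      ; deficit = ≡.trans (cong (+ 3 *_) (defect-absorb N O F′)) (≡.trans (l N (defect N F′))
          (≡.trans (cong (_- + 3 * N) (≡.trans (cong (+ 3 *_) (sym (∑-↭ _ pF))) e)) (l′ W N)))
      ; no-w = λ e′ → e′ }
      where
      l : ∀ N d → + 3 * d ≡ + 3 * (N - 0ℤ + d) - + 3 * N
      l = solve-∀
      l′ : ∀ W N → W * N - + 3 * N ≡ (W - + 3) * N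
      l′ = solve-∀

    record Stage (W : ℤ) (B : List ℤ³) (w : ℤ³) (c : ℤ) : Set where
      field
        {N′} : ℤ
        {O} : List ℤ³
        {F} : List Item
        strict : All (Strict N′) F
        perm : B ↭ O ++ vecs F
        state : St N′ O F w c
        deficit : + 3 * defect N′ F ≡ W * N′

    size : ∀ {W B w c} → Stage W B w c → ℕ
    size S = length (Stage.F S)

    -- A zero weight ends the reduction, and weights equal to 1 migrate to `O`. So an event that is
    -- not a removal strictly shortens the list of fractional items, the measure on which `reduce`
    -- recurses.
    settle : ∀ {W B N w c} O F → St N O F w c → + 3 * defect N F ≡ W * N → B ↭ O ++ vecs F →
      Removal W B w c ⊎ Σ (Stage W B w c) λ S → size S ℕ.≤ length F × (Any (Event N) F → size S ℕ.< length F)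
    settle {W} {B} {N} {w} {c} O F s e p with classify N F (okL s)
    ... | inj₁ (v , F′ , pF) = inj₁ (remove-zero {O = O} s e p pF)
    ... | inj₂ (O₁ , F₁ , pF , hO , hF) = inj₂ (record
        { strict = hF
        ; state = emit O₁ hO (St-↭ pF s)
        ; deficit = ≡.trans (cong (+ 3 *_) (sym (≡.trans (∑-↭ _ pF) (defect-absorb N O₁ F₁)))) e
        ; perm = trans p (trans (++⁺ˡ O (trans (map⁺ proj₁ pF) (↭-reflexive (vecs-absorb N O₁ F₁))))
            (trans (↭-reflexive (sym (Listₚ.++-assoc O O₁ (vecs F₁)))) (++⁺ʳ (vecs F₁) (++-comm O O₁)))) } ,
        subst (length F₁ ℕ.≤_) (sym len) (ℕₚ.m≤n+m (length F₁) (length O₁)) , shorter)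
        where
        len : length F ≡ length O₁ ℕ.+ length F₁
        len = ≡.trans (↭-length pF) (≡.trans (Listₚ.length-++ (full N O₁)) (cong (ℕ._+ length F₁) (Listₚ.length-map _ O₁)))
        nonempty : ∀ O₁ → F ↭ full N O₁ ++ F₁ → Any (Event N) F → 0 ℕ.< length O₁
        nonempty [] pF ev = contradiction (Any-resp-↭ pF ev) (Allₚ.All¬⇒¬Any (All.map (λ {x} → ¬event {N} {x}) hF))
        nonempty (_ ∷ _) _ _ = ℕ.s≤s ℕ.z≤n
        shorter : Any (Event N) F → length F₁ ℕ.< length F
        shorter ev = subst (length F₁ ℕ.<_) (sym len) (ℕₚ.m<n+m (length F₁) (nonempty O₁ pF ev))

    too-few : ∀ {W B w c} {A : Set} → + 9 ≤ W → (S : Stage W B w c) → size S ℕ.≤ 3 → A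
    too-few {W} 9≤W S h = contradiction
      (≤-by (l N′ W) (0≤* (dif 9≤W) (0<⇒0≤ (0<N state))))
      (<⇒≱ (subst₂ _<_ deficit (l′ N′) (*-monoˡ-<-pos (+ 3) (few-strict F (0<N state) strict h))))
      where
      open Stage S
      l : ∀ N W → (W - + 9) * N ≡ W * N - + 9 * N
      l = solve-∀
      l′ : ∀ N → + 3 * (+ 3 * N) ≡ + 9 * N
      l′ = solve-∀

    step-deficit : ∀ {W N} q p A → ∑ δ A ≡ 0ℤ → + 3 * defect N (map cur A) ≡ W * N → + 3 * defect (q * N) (map (stepped q p) A) ≡ W * (q * N)
    step-deficit {W} {N} q p A z e = ≡.trans (cong (+ 3 *_) (≡.trans (defect-stepped q p N A) (cong (λ t → q * defect N (map cur A) - p * t) z)))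
      (≡.trans (l q p (defect N (map cur A))) (≡.trans (cong (q *_) e) (l′ q W N)))
      where
      l : ∀ q p d → + 3 * (q * d - p * 0ℤ) ≡ q * (+ 3 * d)
      l = solve-∀
      l′ : ∀ q W N → q * (W * N) ≡ W * (q * N)
      l′ = solve-∀

    Advanced : ∀ {W B w c} → Stage W B w c → ℤ → ℤ → Set
    Advanced {W} {B} {w} {c} S dc c′ = Removal W B w c′ ⊎
      Σ (Stage W B w c′) λ S′ → size S′ ℕ.≤ size S × (dc < 0ℤ × c′ ≡ 0ℤ ⊎ size S′ ℕ.< size S)

    advance : ∀ {W B w c} (S : Stage W B w c) A dc → map cur A ≡ Stage.F S →
      (∀ Q → moment Q (map dir A) + dc * (w · Q) ≡ 0ℤ) → ∑ δ A ≡ 0ℤ → dc ≤ 0ℤ → Any (λ a → δ a ≢ 0ℤ) A ⊎ dc < 0ℤ →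
      ∃ λ c′ → (c ≡ 0ℤ → dc ≡ 0ℤ → c′ ≡ 0ℤ) × Advanced S dc c′
    advance {W} {B} {w} {c} S A dc eq dep ∑δ≡0 dc≤0 nz = after
      (move {N = N′} {O = O} {w} {c} A dc (subst (λ F → St N′ O F w c) (sym eq) state) dep dc≤0 nz)
      where
      open Stage S
      len : ∀ q r → length (map (stepped q r) A) ≡ length F
      len q r = ≡.trans (Listₚ.length-map _ A) (≡.trans (sym (Listₚ.length-map _ A)) (cong length eq))
      still : ∀ q r → c ≡ 0ℤ → dc ≡ 0ℤ → q * c + r * dc ≡ 0ℤ
      still q r refl refl = l q r
        where
        l : ∀ q r → q * 0ℤ + r * 0ℤ ≡ 0ℤ
        l = solve-∀
      after : (∃₂ λ q p → 0ℤ < q × 0ℤ ≤ p × St (q * N′) O (map (stepped q p) A) w (q * c + p * dc) ×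
        (Any (Event (q * N′)) (map (stepped q p) A) ⊎ (dc < 0ℤ × q * c + p * dc ≡ 0ℤ))) →
        ∃ λ c′ → (c ≡ 0ℤ → dc ≡ 0ℤ → c′ ≡ 0ℤ) × Advanced S dc c′
      after (q , r , _ , _ , s′ , ev) = q * c + r * dc , still q r , settled
        (settle O _ s′ (step-deficit {W} {N′} q r A ∑δ≡0 (≡.trans (cong (λ L → + 3 * defect N′ L) eq) deficit))
          (subst (λ t → B ↭ O ++ t) (sym (≡.trans (vecs-stepped q r A) (cong vecs eq))) perm))
        where
        settled : _ → Advanced S dc (q * c + r * dc)
        settled (inj₁ rem) = inj₁ rem
        settled (inj₂ (S′ , ≤F , <F)) = inj₂ (S′ , subst (size S′ ℕ.≤_) (len q r) ≤F , progress ev)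
          where
          progress : _ → dc < 0ℤ × q * c + r * dc ≡ 0ℤ ⊎ size S′ ℕ.< size S
          progress (inj₁ any) = inj₂ (subst (size S′ ℕ.<_) (len q r) (<F any))
          progress (inj₂ z) = inj₁ z

    quad : ∀ {W B w c} (S : Stage W B w c) → c ≡ 0ℤ → size S ≡ 4 → Quad W B w
    quad {w = w} S c≡0 4F = record { four = 4F ; perm = perm ; state = subst (St N′ O F w) c≡0 state ; deficit = deficit }
      where open Stage S

    -- Either an item drops to 0 or the discarded weight runs out: an item reaching 1 would leave at
    -- most three fractional ones, which a deficit of at least 3 excludes.
    reduce-four : ∀ {W B w c} → + 9 ≤ W → (S : Stage W B w c) → c ≢ 0ℤ → 3 ℕ.< size S → size S ≡ 4 → Removal W B w c ⊎ Quad W B w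
    reduce-four {W} {B} {w} {c} 9≤W S c≢0 >3 4F = after (relationʷ (Stage.F S) w >3)
      where
      done : ∀ {c′} dc → Advanced S dc c′ → Removal W B w c ⊎ Quad W B w
      done dc (inj₁ rem) = inj₁ (map-no-w (λ c≡0 → contradiction c≡0 c≢0) rem)
      done dc (inj₂ (S′ , _ , inj₂ lt)) = too-few 9≤W S′ (ℕ.s≤s⁻¹ (subst (size S′ ℕ.<_) 4F lt))
      done dc (inj₂ (S′ , le , inj₁ (_ , c′≡0))) with size S′ ℕ.≤? 3
      ... | yes few = too-few 9≤W S′ few
      ... | no ¬few = inj₂ (quad S′ c′≡0 (ℕₚ.≤-antisym (subst (size S′ ℕ.≤_) 4F le) (ℕₚ.≰⇒> ¬few)))
      after : (∃₂ λ A dc → map cur A ≡ Stage.F S × (∀ Q → moment Q (map dir A) + dc * (w · Q) ≡ 0ℤ) ×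
        ∑ δ A ≡ 0ℤ × dc ≤ 0ℤ × (Any (λ a → δ a ≢ 0ℤ) A ⊎ dc < 0ℤ)) → Removal W B w c ⊎ Quad W B w
      after (A , dc , eq , dep , ∑δ≡0 , dc≤0 , nz) = done dc (proj₂ (proj₂ (advance S A dc eq dep ∑δ≡0 dc≤0 nz)))

    -- As long as five weights are fractional, or four of them and c > 0, there is a linear relation between these vectors with coefficient sum 0; moving the weights along it lets one of them reach 0 or 1, or c reach 0.
    reduce : ∀ {W B w c} k → + 9 ≤ W → (S : Stage W B w c) → size S ℕ.≤ k → Removal W B w c ⊎ Quad W B w
    reduce {W} {B} {w} {c} k 9≤W S h = go k h (size S ℕ.≤? 3) (size S ℕ.≟ 4) (c ≟ 0ℤ)
      where
      more : ∀ k → size S ℕ.≤ suc k → 4 ℕ.< size S → Removal W B w c ⊎ Quad W B w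
      more k h >4 = after (relation₄ (Stage.F S) >4)
        where
        done : ∀ {c′} → (c ≡ 0ℤ → 0ℤ ≡ 0ℤ → c′ ≡ 0ℤ) → Advanced S 0ℤ c′ → Removal W B w c ⊎ Quad W B w
        done f (inj₁ rem) = inj₁ (map-no-w (λ c≡0 → f c≡0 refl) rem)
        done f (inj₂ (S′ , _ , inj₁ (lt , _))) = contradiction lt (<-irrefl refl)
        done f (inj₂ (S′ , _ , inj₂ lt)) with reduce k 9≤W S′ (ℕ.s≤s⁻¹ (ℕₚ.≤-trans lt h))
        ... | inj₁ rem = inj₁ (map-no-w (λ c≡0 → f c≡0 refl) rem)
        ... | inj₂ q = inj₂ q
        after : (∃ λ A → map cur A ≡ Stage.F S × (∀ Q → moment Q (map dir A) ≡ 0ℤ) × ∑ δ A ≡ 0ℤ × Any (λ a → δ a ≢ 0ℤ) A) →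
          Removal W B w c ⊎ Quad W B w
        after (A , eq , dep , ∑δ≡0 , nz) = let (_ , f , adv) = advance S A 0ℤ eq (λ Q → cong (_+ 0ℤ) (dep Q)) ∑δ≡0 ≤-refl (inj₁ nz) in done f adv
      go : ∀ k → size S ℕ.≤ k → Dec (size S ℕ.≤ 3) → Dec (size S ≡ 4) → Dec (c ≡ 0ℤ) → Removal W B w c ⊎ Quad W B w
      go k h (yes few) _ _ = too-few 9≤W S few
      go k h (no ¬few) (yes 4F) (yes c≡0) = inj₂ (quad S c≡0 4F)
      go k h (no ¬few) (yes 4F) (no c≢0) = reduce-four 9≤W S c≢0 (ℕₚ.≰⇒> ¬few) 4F
      go zero h (no ¬few) (no ¬4) _ = contradiction (ℕₚ.≤-trans h ℕ.z≤n) ¬few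
      go (suc k) h (no ¬few) (no ¬4) _ = more k h (ℕₚ.≤∧≢⇒< (ℕₚ.≰⇒> ¬few) (λ e → ¬4 (sym e)))

    -- Raising the deficit by scaling all weights down.

    rescaled : ℤ → List Item → List Item
    rescaled κ = map (λ (v , n) → v , κ * n)

    moment-rescaled : ∀ κ Q L → moment Q (rescaled κ L) ≡ κ * moment Q L
    moment-rescaled κ Q [] = sym (*-zeroʳ κ)
    moment-rescaled κ Q ((v , n) ∷ L) = ≡.trans (cong (λ t → κ * n * (v · Q) + t) (moment-rescaled κ Q L)) (l κ n (v · Q) (moment Q L))
      where
      l : ∀ κ n x a → κ * n * x + κ * a ≡ κ * (n * x + a)
      l = solve-∀

    defect-rescaled : ∀ κ N N′ L → defect N′ (rescaled κ L) ≡ + length L * N′ - κ * (+ length L * N - defect N L)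
    defect-rescaled κ N N′ [] = l κ N N′
      where
      l : ∀ κ N N′ → 0ℤ ≡ 0ℤ * N′ - κ * (0ℤ * N - 0ℤ)
      l = solve-∀
    defect-rescaled κ N N′ ((v , n) ∷ L) = ≡.trans (cong (λ t → N′ - κ * n + t) (defect-rescaled κ N N′ L)) (l κ N N′ n (+ length L) (defect N L))
      where
      l : ∀ κ N N′ n k d → N′ - κ * n + (k * N′ - κ * (k * N - d)) ≡ (1ℤ + k) * N′ - κ * ((1ℤ + k) * N - (N - n + d))
      l = solve-∀

    vecs-rescaled : ∀ κ L → vecs (rescaled κ L) ≡ vecs L
    vecs-rescaled κ [] = refl
    vecs-rescaled κ ((v , n) ∷ L) = cong (v ∷_) (vecs-rescaled κ L)

    -- With `k` items and deficit `d`, the factor `(k - W / 3) / (k - d)` turns the total weight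
    -- `k - d` into `k - W / 3`. It is at most 1 because `d ≤ T / 3 ≤ W / 3`, so the upper bounds on
    -- all weights survive; `T < 3 k` keeps the new denominator positive.
    rescale : ∀ {N L w c} T W → St N [] L w c → + 3 * defect N L ≤ T * N → T ≤ W → W ≤ + 3 * + length L → T < + 3 * + length L →
      ∃₂ λ N′ κ → St N′ [] (rescaled κ L) w (κ * c) × + 3 * defect N′ (rescaled κ L) ≡ W * N′
    rescale {N} {L} {w} {c} T W s hd T≤W W≤ T< = N′ , κ , record
      { 0<N = <-by (l₀ N T k (defect N L)) (0<+0≤ (0<* (dif< T<) (0<N s)) (dif hd))
      ; okO = []
      ; okL = Allₚ.map⁺ (All.map (λ { {v , n} (b , 0≤n , n≤N) → b , 0≤* 0≤κ 0≤n ,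
          ≤-by (l₂ κ n N N′) (0≤+ (0≤* 0≤κ (dif n≤N)) κN≤) }) (okL s))
      ; okw = okw s
      ; 0≤c = 0≤* 0≤κ (0≤c s)
      ; c≤N = ≤-by (l₃ κ c N N′) (0≤+ (0≤* 0≤κ (dif (c≤N s))) κN≤)
      ; zero-sum = λ Q → ≡.trans (cong (λ t → N′ * 0ℤ + t + κ * c * (w · Q)) (moment-rescaled κ Q L))
          (≡.trans (l₄ N N′ κ (moment Q L) c (w · Q)) (≡.trans (cong (κ *_) (zero-sum s Q)) (*-zeroʳ κ))) } ,
      ≡.trans (cong (+ 3 *_) (defect-rescaled κ N N′ L)) (l₅ k N W (defect N L))
      where
      k = + length L
      κ = + 3 * k - W
      N′ = + 3 * (k * N - defect N L)
      0≤κ : 0ℤ ≤ κ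
      0≤κ = dif W≤
      l₀ : ∀ N T k d → (+ 3 * k - T) * N + (T * N - + 3 * d) ≡ + 3 * (k * N - d) - 0ℤ
      l₀ = solve-∀
      κN≤ : 0ℤ ≤ N′ - κ * N
      κN≤ = 0≤-by (l₁ N T W k (defect N L)) (0≤+ (dif hd) (0≤* (dif T≤W) (0<⇒0≤ (0<N s))))
        where
        l₁ : ∀ N T W k d → (T * N - + 3 * d) + (W - T) * N ≡ + 3 * (k * N - d) - (+ 3 * k - W) * N
        l₁ = solve-∀
      l₂ : ∀ κ n N N′ → κ * (N - n) + (N′ - κ * N) ≡ N′ - κ * n
      l₂ = solve-∀
      l₃ : ∀ κ c N N′ → κ * (N - + 3 * c) + (N′ - κ * N) ≡ N′ - + 3 * (κ * c)
      l₃ = solve-∀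
      l₄ : ∀ N N′ κ a c x → N′ * 0ℤ + κ * a + κ * c * x ≡ κ * (N * 0ℤ + a + c * x)
      l₄ = solve-∀
      l₅ : ∀ k N W d → + 3 * (k * (+ 3 * (k * N - d)) - (+ 3 * k - W) * (k * N - d)) ≡ W * (+ 3 * (k * N - d))
      l₅ = solve-∀

    rescale-reduce : ∀ {N L w c} T W → + 9 ≤ W → St N [] L w c → + 3 * defect N L ≤ T * N → T ≤ W → W ≤ + 3 * + length L → T < + 3 * + length L →
      Removal W (vecs L) w c ⊎ Quad W (vecs L) w
    rescale-reduce {N} {L} {w} {c} T W 9≤W s hd T≤W W≤ T< = after (rescale T W s hd T≤W W≤ T<)
      where
      after : (∃₂ λ N′ κ → St N′ [] (rescaled κ L) w (κ * c) × + 3 * defect N′ (rescaled κ L) ≡ W * N′) →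
        Removal W (vecs L) w c ⊎ Quad W (vecs L) w
      after (N′ , κ , s′ , e) = settled (settle [] (rescaled κ L) s′ e (↭-reflexive (sym (vecs-rescaled κ L))))
        where
        no-w : c ≡ 0ℤ → κ * c ≡ 0ℤ
        no-w refl = *-zeroʳ κ
        reduced : Removal W (vecs L) w (κ * c) ⊎ Quad W (vecs L) w → Removal W (vecs L) w c ⊎ Quad W (vecs L) w
        reduced (inj₁ r) = inj₁ (map-no-w no-w r)
        reduced (inj₂ q) = inj₂ q
        settled : _ → Removal W (vecs L) w c ⊎ Quad W (vecs L) w
        settled (inj₁ r) = inj₁ (map-no-w no-w r)
        settled (inj₂ (S , _)) = reduced (reduce (size S) 9≤W S ℕₚ.≤-refl)

    -- Bounding the sum of the remaining vectors by the deficit.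

    defect-nonneg : ∀ {N} L → All (Ok N) L → 0ℤ ≤ defect N L
    defect-nonneg L hs = ∑-nonneg (All.map (λ (_ , _ , n≤N) → dif n≤N) hs)

    defect-≤ : ∀ {N} L → All (Ok N) L → defect N L ≤ + length L * N
    defect-≤ [] [] = ≤-refl
    defect-≤ {N} ((v , n) ∷ L) ((_ , 0≤n , _) ∷ hs) = ≤-by (l N n (+ length L) (defect N L)) (0≤+ 0≤n (dif (defect-≤ L hs)))
      where
      l : ∀ N n k d → n + (k * N - d) ≡ (1ℤ + k) * N - (N - n + d)
      l = solve-∀

    support-def : ∀ {N X} Q L → All (Ok N) L → (∀ v → Ball v → v · Q ≤ X) → N * ∑ (_· Q) (vecs L) - moment Q L ≤ defect N L * X
    support-def {N} {X} Q [] [] hX = ≤-by (l N X) ≤-refl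
      where
      l : ∀ N X → 0ℤ ≡ 0ℤ * X - (N * 0ℤ - 0ℤ)
      l = solve-∀
    support-def {N} {X} Q ((v , n) ∷ L) ((b , _ , n≤N) ∷ hs) hX = ≤-by (l N X n (v · Q) _ _ _)
      (0≤+ (0≤* (dif n≤N) (dif (hX v b))) (dif (support-def Q L hs hX)))
      where
      l : ∀ N X n x s a d → (N - n) * (X - x) + (d * X - (N * s - a)) ≡ (N - n + d) * X - (N * (x + s) - (n * x + a))
      l = solve-∀

    -- By the balance, the sum of the vectors is `Σ (1 - λ) v - (c / N) w`, and `- w` lies in the
    -- ball as well; so the discarded weight is simply added to the deficit.
    good-state : ∀ {N L w c} → St N [] L w c → + 3 * (defect N L + c) ≤ + 7 * N → Good (sum³ (vecs L))
    good-state {N} {L} {w} {c} s h = good-by-support {N} {defect N L + c} (sum³ (vecs L)) (0<N s) (0≤+ (defect-nonneg L (okL s)) (0≤c s)) h λ Q X hX →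
      ≤-by (l N X (sum³ (vecs L) · Q) (moment Q L) c (w · Q) (defect N L) (zero-sum s Q))
        (0≤+ (dif (subst (λ t → N * t - moment Q L ≤ defect N L * X) (sym (·-sum³ (vecs L) Q)) (support-def Q L (okL s) hX)))
          (0≤* (0≤c s) (dif (subst (_≤ X) (·³-· (- 1ℤ) w Q) (hX (- 1ℤ ·³ w) (-ball {w} (okw s)))))))
      where
      l : ∀ N X P a c x d → N * 0ℤ + a + c * x ≡ 0ℤ →
        d * X - (N * P - a) + c * (X - - 1ℤ * x) ≡ (d + c) * X - N * P
      l N X P a c x d e = ≡.trans (l₁ N X P a c x d) (≡.trans (cong (λ t → (d + c) * X - N * P + t) e) (+-identityʳ _))
        where
        l₁ : ∀ N X P a c x d → d * X - (N * P - a) + c * (X - - 1ℤ * x) ≡ (d + c) * X - N * P + (N * 0ℤ + a + c * x)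
        l₁ = solve-∀

    good-few : ∀ B → All Ball B → length B ℕ.≤ 2 → Good (sum³ B)
    good-few B hB h = good-by-support {1ℤ} {+ length B} (sum³ B) (+<+ (ℕ.s≤s ℕ.z≤n)) (0≤ℕ (length B))
      (≤-trans (*-monoˡ-≤-nonNeg (+ 3) (+≤+ h)) (+≤+ (ℕₚ.m≤m+n 6 1))) λ Q X hX →
      subst (_≤ + length B * X) (≡.trans (sym (·-sum³ B Q)) (sym (*-identityˡ _))) (go Q X hX B hB)
      where
      go : ∀ Q X → (∀ v → Ball v → v · Q ≤ X) → ∀ B → All Ball B → ∑ (_· Q) B ≤ + length B * X
      go Q X hX [] [] = ≤-refl
      go Q X hX (v ∷ B) (b ∷ hB) = ≤-by (l (v · Q) _ X (+ length B)) (0≤+ (dif (hX v b)) (dif (go Q X hX B hB)))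
        where
        l : ∀ x s X k → (X - x) + (k * X - s) ≡ (1ℤ + k) * X - (x + s)
        l = solve-∀

    -- Vectors are removed from the front, so what remains is always a suffix.
    GoodTails : List ℤ³ → Set
    GoodTails [] = ⊤
    GoodTails (v ∷ R) = Good (sum³ (v ∷ R)) × GoodTails R

    Drain : List ℤ³ → Set
    Drain B = ∃ λ R → R ↭ B × GoodTails R

    drain-cons : ∀ {v B B′} → B ↭ v ∷ B′ → Good (sum³ B) → Drain B′ → Drain B
    drain-cons {v} p g (R , pR , gR) = v ∷ R , q , subst Good (sym (sum³-↭ q)) g , gR
      where q = trans (prep v pR) (↭-sym p)

    drain-few : ∀ B → All Ball B → length B ℕ.≤ 2 → Drain B
    drain-few [] [] _ = [] , refl , tt
    drain-few (v ∷ B) hB@(_ ∷ hB′) h = drain-cons refl (good-few (v ∷ B) hB h) (drain-few B hB′ (ℕₚ.≤-trans (ℕₚ.n≤1+n _) h))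

    -- In PState a discarded vector may still carry weight c / N ≤ 1 / 3, but the remaining deficit is at most 2; so the sum lies in (2 + 1 / 3) · Ball.
    NState PState : List Item → Set
    NState L = ∃₂ λ N w → St N [] L w 0ℤ × + 3 * defect N L ≤ + 9 * N × Good (sum³ (vecs L))
    PState L = ∃₂ λ N w → ∃ λ c → St N [] L w c × + 3 * defect N L ≤ + 6 * N

    good-P : ∀ L → PState L → Good (sum³ (vecs L))
    good-P L (N , w , c , s , h) = good-state s (≤-by (l N c (defect N L)) (0≤+ (dif h) (dif (c≤N s))))
      where
      l : ∀ N c d → + 6 * N - + 3 * d + (N - + 3 * c) ≡ + 7 * N - + 3 * (d + c)
      l = solve-∀

    -- Removing vectors when four fractional weights are left.

    DrainN DrainP : ℕ → Set
    DrainN k = ∀ L → length L ℕ.≤ k → NState L → Drain (vecs L)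
    DrainP k = ∀ L → length L ℕ.≤ k → PState L → Drain (vecs L)

    -- An item (v , x , y) carries the weights x / N₀ and y / N₁ of v in two zero-sum subsystems.
    record Pair (B : List ℤ³) (E : List AItem) : Set where
      field
        {O} : List ℤ³
        {N₀ N₁} : ℤ
        {w} : ℤ³
        s₀ : St N₀ O (map cur E) w 0ℤ
        s₁ : St N₁ O (map dir E) w 0ℤ
        light : + 10 * N₀ ≤ + 3 * defect N₀ (map cur E)
        vanish : Any (λ x → proj₂ x ≡ 0ℤ) (map cur E)
        perm : B ↭ O ++ vecs (map cur E)

    Pair-↭ : ∀ {B E E′} → E ↭ E′ → Pair B E → Pair B E′
    Pair-↭ p P = record
      { s₀ = St-↭ (map⁺ cur p) s₀ ; s₁ = St-↭ (map⁺ dir p) s₁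
      ; light = subst (λ t → + 10 * N₀ ≤ + 3 * t) (∑-↭ _ (map⁺ cur p)) light
      ; vanish = Any-resp-↭ (map⁺ cur p) vanish
      ; perm = trans perm (++⁺ˡ O (map⁺ proj₁ (map⁺ cur p))) }
      where open Pair P

    -- As `a` has weight 1, the balance writes the sum of `O`, `a`, `b`, `z` as
    -- `(1 - y₂) b + (1 - y₃) z - y₁ l`, with the `y` read as fractions. Its norm is at most
    -- `m (2 - (y₂ - y₁) - y₃)`, hence at most `2 m`: of `l` and `b`, the one with the smaller
    -- weight has to go.
    good-removed : ∀ {N O a l b z w y₁ y₂ y₃} → St N O ((a , N) ∷ (l , y₁) ∷ (b , y₂) ∷ (z , y₃) ∷ []) w 0ℤ → y₁ ≤ y₂ →
      Good (sum³ (O ++ a ∷ b ∷ z ∷ []))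
    good-removed {N} {O} {a} {l} {b} {z} {w} {y₁} {y₂} {y₃} s y₁≤y₂ with okL s
    ... | _ ∷ (bl , 0≤y₁ , _) ∷ (bb , _ , y₂≤N) ∷ (bz , 0≤y₃ , y₃≤N) ∷ [] =
      good-by-support {N} {(N - y₂) + (N - y₃) + y₁} (sum³ (O ++ a ∷ b ∷ z ∷ [])) (0<N s)
        (0≤+ (0≤+ (dif y₂≤N) (dif y₃≤N)) 0≤y₁)
        (≤-by (l₀ N y₁ y₂ y₃) (0≤+ (0≤+ (0<⇒0≤ (0<N s)) (0≤* (0≤ℕ 3) (dif y₁≤y₂))) (0≤* (0≤ℕ 3) 0≤y₃)))
        λ Q X hX → subst (λ t → N * t ≤ ((N - y₂) + (N - y₃) + y₁) * X) (sym (≡.trans (·-sum³ (O ++ a ∷ b ∷ z ∷ []) Q) (∑-++ (_· Q) O (a ∷ b ∷ z ∷ []))))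
          (≤-by (l₂ N X (∑ (_· Q) O) (a · Q) (l · Q) (b · Q) (z · Q) (w · Q) y₁ y₂ y₃ (zero-sum s Q))
            (0≤+ (0≤+ (0≤* (dif y₂≤N) (dif (hX b bb))) (0≤* (dif y₃≤N) (dif (hX z bz))))
              (0≤* 0≤y₁ (dif (subst (_≤ X) (·³-· (- 1ℤ) l Q) (hX (- 1ℤ ·³ l) (-ball {l} bl)))))))
      where
      l₀ : ∀ N x y z → N + + 3 * (y - x) + + 3 * z ≡ + 7 * N - + 3 * ((N - y) + (N - z) + x)
      l₀ = solve-∀
      l₂ : ∀ N X o a l b z w y₁ y₂ y₃ → N * o + (N * a + (y₁ * l + (y₂ * b + (y₃ * z + 0ℤ)))) + 0ℤ * w ≡ 0ℤ →
        (N - y₂) * (X - b) + (N - y₃) * (X - z) + y₁ * (X - - 1ℤ * l) ≡ ((N - y₂) + (N - y₃) + y₁) * X - N * (o + (a + (b + (z + 0ℤ))))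
      l₂ N X o a l b z w y₁ y₂ y₃ e = ≡.trans (l₁ N X o a l b z w y₁ y₂ y₃) (≡.trans (cong (λ t → ((N - y₂) + (N - y₃) + y₁) * X - N * (o + (a + (b + (z + 0ℤ)))) + t) e) (+-identityʳ _))
        where
        l₁ : ∀ N X o a l b z w y₁ y₂ y₃ →
          (N - y₂) * (X - b) + (N - y₃) * (X - z) + y₁ * (X - - 1ℤ * l) ≡
          ((N - y₂) + (N - y₃) + y₁) * X - N * (o + (a + (b + (z + 0ℤ)))) + (N * o + (N * a + (y₁ * l + (y₂ * b + (y₃ * z + 0ℤ)))) + 0ℤ * w)
        l₁ = solve-∀

    length-absorb : ∀ N O (L : List Item) → length (full N O ++ L) ≡ length O ℕ.+ length L
    length-absorb N O L = ≡.trans (Listₚ.length-++ (full N O)) (cong (ℕ._+ length L) (Listₚ.length-map _ O))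

    extract-zero : ∀ {L : List Item} → Any (λ x → proj₂ x ≡ 0ℤ) L → ∃₂ λ u L′ → L ↭ (u , 0ℤ) ∷ L′
    extract-zero {(u , .0ℤ) ∷ L} (here refl) = u , L , refl
    extract-zero {x ∷ L} (there h) with extract-zero h
    ... | u , L′ , p = u , x ∷ L′ , trans (prep x p) (swap x _ refl)

    -- The slot for a discarded vector is free, since its present occupant has weight 0, and a
    -- weight of at most `1 / 3` respects the bound `c≤N`.
    discard : ∀ {N O L w v n} → St N O ((v , n) ∷ L) w 0ℤ → + 3 * n ≤ N → St N O L v n
    discard {N} {O} {L} {w} {v} {n} s h with okL s
    ... | (b , 0≤n , _) ∷ hs = record
      { 0<N = 0<N s ; okO = okO s ; okL = hs ; okw = b ; 0≤c = 0≤n ; c≤N = h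
      ; zero-sum = λ Q → ≡.trans (l (N * ∑ (_· Q) O) (moment Q L) (n * (v · Q)) (w · Q)) (zero-sum s Q) }
      where
      l : ∀ a b c x → a + b + c ≡ a + (c + b) + 0ℤ * x
      l = solve-∀

    -- Removing l first is harmless by the second system; after that the vector whose weight vanishes in the first one can go, and l becomes the discarded vector of a PState.
    finish : ∀ {k B a l b z} → DrainN k → DrainP k → length B ℕ.≤ suc k → Good (sum³ B) → (P : Pair B (a ∷ l ∷ b ∷ z ∷ [])) →
      δ a ≡ Pair.N₁ P → δ l ≤ δ b → + 3 * proj₂ (cur l) ≤ Pair.N₀ P → Drain B
    finish {k} {B} {a@(va , xa , ya)} {l@(vl , xl , yl)} {b@(vb , xb , yb)} {z@(vz , xz , yz)} recN recP |B| gB P ya≡ yl≤ xl≤ =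
      drain-cons perm′ gB (rest (xl ≟ 0ℤ))
      where
      open Pair P
      T = map cur (a ∷ b ∷ z ∷ [])
      a-l : ∀ {A : Set} (x y : A) {zs} → x ∷ y ∷ zs ↭ y ∷ x ∷ zs
      a-l x y = swap x y refl
      s : St N₀ O (cur l ∷ T) w 0ℤ
      s = St-↭ (a-l (cur a) (cur l)) s₀
      perm′ : B ↭ vl ∷ O ++ vecs T
      perm′ = trans perm (trans (++⁺ˡ O (a-l va vl)) (shift vl O (vecs T)))
      gT : Good (sum³ (O ++ vecs T))
      gT = good-removed {N₁} {O} {va} {vl} {vb} {vz} {w} {yl} {yb} {yz} (subst (λ t → St N₁ O ((va , t) ∷ (vl , yl) ∷ (vb , yb) ∷ (vz , yz) ∷ []) w 0ℤ) ya≡ s₁) yl≤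
      okT = All.tail (okL s)
      |O| : length O ℕ.+ 3 ℕ.≤ k
      |O| = ℕ.s≤s⁻¹ (subst (ℕ._≤ suc k) (≡.trans (↭-length perm) (≡.trans (Listₚ.length-++ O) (ℕₚ.+-suc (length O) 3))) |B|)
      -- Whatever the weights, `t` items have deficit at most `t`: three items meet the bound 3 of
      -- `NState`, two the bound 2 of `PState`.
      kept : ∀ L → All (Ok N₀) L → ∀ t → length L ≡ t → + 3 * defect N₀ (full N₀ O ++ L) ≤ + 3 * (+ t * N₀)
      kept L hL t refl = *-monoˡ-≤-nonNeg (+ 3) (subst (_≤ + length L * N₀) (sym (defect-absorb N₀ O L)) (defect-≤ L hL))
      rest : Dec (xl ≡ 0ℤ) → Drain (O ++ vecs T)
      -- Here `l` itself has weight 0 in the first system and leaves no debt.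
      rest (yes xl≡0) = subst Drain (vecs-absorb N₀ O T) (recN (full N₀ O ++ T)
        (subst (ℕ._≤ k) (sym (length-absorb N₀ O T)) |O|)
        (N₀ , w , absorb (drop-zero {v = vl} (subst (λ t → St N₀ O ((vl , t) ∷ T) w 0ℤ) xl≡0 s)) ,
          subst (+ 3 * defect N₀ (full N₀ O ++ T) ≤_) (l₉ N₀) (kept T okT 3 refl) ,
          subst (λ t → Good (sum³ t)) (sym (vecs-absorb N₀ O T)) gT))
        where
        l₉ : ∀ N → + 3 * (+ 3 * N) ≡ + 9 * N
        l₉ = solve-∀
      rest (no xl≢0) = removed (extract-zero (vanish′ vanish))
        where
        vanish′ : Any (λ x → proj₂ x ≡ 0ℤ) (map cur (a ∷ l ∷ b ∷ z ∷ [])) → Any (λ x → proj₂ x ≡ 0ℤ) T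
        vanish′ (here e) = here e
        vanish′ (there (here e)) = contradiction e xl≢0
        vanish′ (there (there h)) = there h
        removed : (∃₂ λ u T′ → T ↭ (u , 0ℤ) ∷ T′) → Drain (O ++ vecs T)
        removed (u , T′ , pT) = drain-cons (trans (++⁺ˡ O (map⁺ proj₁ pT)) (shift u O (vecs T′))) gT
          (subst Drain (vecs-absorb N₀ O T′) (recP (full N₀ O ++ T′)
            (subst (ℕ._≤ k) (sym (≡.trans (length-absorb N₀ O T′) (cong (length O ℕ.+_) |T′|))) (ℕₚ.≤-trans (ℕₚ.+-monoʳ-≤ (length O) (ℕₚ.n≤1+n 2)) |O|))
            (N₀ , vl , xl , absorb s′ , subst (+ 3 * defect N₀ (full N₀ O ++ T′) ≤_) (l₆ N₀) (kept T′ (okL s′) 2 |T′|))))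
          where
          |T′| : length T′ ≡ 2
          |T′| = ℕₚ.suc-injective (sym (↭-length pT))
          s′ : St N₀ O T′ vl xl
          s′ = drop-zero (St-↭ pT (discard s xl≤))
          l₆ : ∀ N → + 3 * (+ 2 * N) ≡ + 6 * N
          l₆ = solve-∀

    flip : AItem → AItem
    flip (v , n , d) = v , n , - d

    cur-flip : ∀ A → map cur (map flip A) ≡ map cur A
    cur-flip A = sym (Listₚ.map-∘ A)

    moment-flip : ∀ Q A → moment Q (map dir (map flip A)) ≡ - moment Q (map dir A)
    moment-flip Q [] = refl
    moment-flip Q ((v , n , d) ∷ A) = ≡.trans (cong (λ t → - d * (v · Q) + t) (moment-flip Q A)) (l d (v · Q) _)
      where
      l : ∀ d x a → - d * x + - a ≡ - (d * x + a)
      l = solve-∀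

    ∑δ-flip : ∀ A → ∑ δ (map flip A) ≡ - ∑ δ A
    ∑δ-flip [] = refl
    ∑δ-flip ((v , n , d) ∷ A) = ≡.trans (cong (λ t → - d + t) (∑δ-flip A)) (sym (neg-distrib-+ d _))

    nonzero-flip : ∀ {A} → Any (λ a → δ a ≢ 0ℤ) A → Any (λ a → δ a ≢ 0ℤ) (map flip A)
    nonzero-flip h = Anyₚ.map⁺ (Any.map (λ d≢0 -d≡0 → d≢0 (neg-injective -d≡0)) h)

    any-event : ∀ {N L} → Any (Event N) L → Any (λ x → proj₂ x ≡ 0ℤ) L ⊎ Any (λ x → proj₂ x ≡ N) L
    any-event (here (inj₁ e)) = inj₁ (here e)
    any-event (here (inj₂ e)) = inj₂ (here e)
    any-event (there h) = [ (λ x → inj₁ (there x)) , (λ x → inj₂ (there x)) ]′ (any-event h)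

    move₀ : ∀ {N O w} A → St N O (map cur A) w 0ℤ → (∀ Q → moment Q (map dir A) ≡ 0ℤ) → Any (λ a → δ a ≢ 0ℤ) A →
      ∃₂ λ q p → 0ℤ < q × 0ℤ ≤ p × St (q * N) O (map (stepped q p) A) w 0ℤ × Any (Event (q * N)) (map (stepped q p) A)
    move₀ {N} {O} {w} A s dep nz = after (move {N} {O} {w} {0ℤ} A 0ℤ s (λ Q → cong (_+ 0ℤ) (dep Q)) ≤-refl (inj₁ nz))
      where
      l : ∀ q p → q * 0ℤ + p * 0ℤ ≡ 0ℤ
      l = solve-∀
      after : _ → _
      after (q , p , 0<q , 0≤p , s′ , inj₁ ev) = q , p , 0<q , 0≤p , subst (St (q * N) O (map (stepped q p) A) w) (l q p) s′ , ev
      after (_ , _ , _ , _ , _ , inj₂ (lt , _)) = contradiction lt (<-irrefl refl)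

    extract : ∀ {A : Set} {P : A → Set} {L} → Any P L → ∃₂ λ a L′ → P a × L ↭ a ∷ L′
    extract {L = a ∷ L} (here h) = a , L , h , refl
    extract {L = x ∷ L} (there h) with extract h
    ... | a , L′ , pa , p = a , x ∷ L′ , pa , trans (prep x p) (swap x a refl)

    module QuadStep {k : ℕ} {B : List ℤ³} (recN : DrainN k) (recP : DrainP k) (|B| : length B ℕ.≤ suc k) (gB : Good (sum³ B)) where

      -- The favourable case: dropping a zero weight brings a deficit of at most `10 / 3` down to
      -- `7 / 3`, which bounds the sum of the rest.
      drop-clean : ∀ {N O L w} → St N O L w 0ℤ → B ↭ O ++ vecs L → + 3 * defect N L ≤ + 10 * N →
        Any (λ x → proj₂ x ≡ 0ℤ) L → Drain B
      drop-clean {N} {O} {L} {w} s p h z = after (extract-zero z)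
        where
        after : (∃₂ λ u L′ → L ↭ (u , 0ℤ) ∷ L′) → Drain B
        after (u , L′ , pL) = drain-cons perm′ gB (recN (full N O ++ L′) len (N , w , s′ , ≤9 , good-state s′ ≤7))
          where
          perm′ : B ↭ u ∷ vecs (full N O ++ L′)
          perm′ = trans p (trans (++⁺ˡ O (map⁺ proj₁ pL)) (trans (shift u O (vecs L′)) (↭-reflexive (cong (u ∷_) (sym (vecs-absorb N O L′))))))
          len : length (full N O ++ L′) ℕ.≤ k
          len = ℕ.s≤s⁻¹ (subst (ℕ._≤ suc k) (≡.trans (↭-length perm′) (cong suc (Listₚ.length-map proj₁ (full N O ++ L′)))) |B|)
          s′ : St N [] (full N O ++ L′) w 0ℤ
          s′ = absorb (drop-zero (St-↭ pL s))
          d′ : + 3 * defect N (full N O ++ L′) ≡ + 3 * defect N L - + 3 * N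
          d′ = ≡.trans (cong (+ 3 *_) (defect-absorb N O L′)) (≡.trans (l N (defect N L′)) (cong (λ t → + 3 * t - + 3 * N) (sym (∑-↭ _ pL))))
            where
            l : ∀ N d → + 3 * d ≡ + 3 * (N - 0ℤ + d) - + 3 * N
            l = solve-∀
          ≤7 : + 3 * (defect N (full N O ++ L′) + 0ℤ) ≤ + 7 * N
          ≤7 = subst (_≤ + 7 * N) (≡.trans (sym d′) (cong (+ 3 *_) (sym (+-identityʳ _)))) (≤-by (l (defect N L) N) (dif h))
            where
            l : ∀ d N → + 10 * N - + 3 * d ≡ + 7 * N - (+ 3 * d - + 3 * N)
            l = solve-∀
          ≤9 : + 3 * defect N (full N O ++ L′) ≤ + 9 * N
          ≤9 = subst (_≤ + 9 * N) (cong (+ 3 *_) (+-identityʳ _)) (≤-trans ≤7 (*-monoʳ-≤-nonNeg N {{nonNegative (0<⇒0≤ (0<N s))}} (+≤+ (ℕₚ.m≤m+n 7 2))))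

      ordered : ∀ {a b c z} (P : Pair B (a ∷ b ∷ c ∷ z ∷ [])) → δ a ≡ Pair.N₁ P →
        + 3 * proj₂ (cur b) ≤ Pair.N₀ P → + 3 * proj₂ (cur c) ≤ Pair.N₀ P → Drain B
      ordered {a} {b} {c} {z} P e hb hc with ≤-total (δ b) (δ c)
      ... | inj₁ b≤c = finish recN recP |B| gB P e b≤c hb
      ... | inj₂ c≤b = finish recN recP |B| gB (Pair-↭ (prep a (swap b c refl)) P) e c≤b hc

      -- The weights x sum to at most 2 N₀ / 3, so at most one of b, c, z has x > N₀ / 3.
      two-light : ∀ {a b c z} (P : Pair B (a ∷ b ∷ c ∷ z ∷ [])) → δ a ≡ Pair.N₁ P → Drain B
      two-light {a@(_ , xa , _)} {b@(_ , xb , _)} {c@(_ , xc , _)} {z@(_ , xz , _)} P e with okL (Pair.s₀ P)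
      ... | (_ , 0≤xa , _) ∷ (_ , 0≤xb , _) ∷ (_ , 0≤xc , _) ∷ (_ , 0≤xz , _) ∷ [] =
        go (+ 3 * xb ≤? N₀) (+ 3 * xc ≤? N₀)
        where
        open Pair P
        swap-last : b ∷ c ∷ z ∷ [] ↭ b ∷ z ∷ c ∷ []
        swap-last = prep b (swap c z refl)
        rotate : b ∷ c ∷ z ∷ [] ↭ c ∷ z ∷ b ∷ []
        rotate = trans (swap b c refl) (prep c (swap b z refl))
        other : ∀ x y u v → 0ℤ ≤ u → 0ℤ ≤ v → + 10 * N₀ ≤ + 3 * (N₀ - x + (N₀ - y + (N₀ - u + (N₀ - v + 0ℤ)))) →
          ¬ + 3 * x ≤ N₀ → + 3 * y ≤ N₀
        other x y u v 0≤u 0≤v h ¬x = ≤-by (l N₀ x y u v) (0≤+ (dif h) (0≤+ (0<⇒0≤ (dif< (≰⇒> ¬x))) (0≤* (0≤ℕ 3) (0≤+ 0≤u 0≤v))))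
          where
          l : ∀ N x y u v → + 3 * (N - x + (N - y + (N - u + (N - v + 0ℤ)))) - + 10 * N + (+ 3 * x - N + + 3 * (u + v)) ≡ N - + 3 * y
          l = solve-∀
        p₁ : ∀ N a b c z → + 3 * (N - a + (N - b + (N - c + (N - z + 0ℤ)))) ≡ + 3 * (N - b + (N - c + (N - a + (N - z + 0ℤ))))
        p₁ = solve-∀
        p₂ : ∀ N a b c z → + 3 * (N - a + (N - b + (N - c + (N - z + 0ℤ)))) ≡ + 3 * (N - b + (N - z + (N - a + (N - c + 0ℤ))))
        p₂ = solve-∀
        p₃ : ∀ N a b c z → + 3 * (N - a + (N - b + (N - c + (N - z + 0ℤ)))) ≡ + 3 * (N - c + (N - z + (N - a + (N - b + 0ℤ))))
        p₃ = solve-∀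
        go : Dec (+ 3 * xb ≤ N₀) → Dec (+ 3 * xc ≤ N₀) → Drain B
        go (yes hb) (yes hc) = ordered P e hb hc
        go (yes hb) (no hc) = ordered (Pair-↭ (prep a swap-last) P) e hb
          (other xc xz xa xb 0≤xa 0≤xb (subst (+ 10 * N₀ ≤_) (p₃ N₀ xa xb xc xz) light) hc)
        go (no hb) _ = ordered (Pair-↭ (prep a rotate) P) e
          (other xb xc xa xz 0≤xa 0≤xz (subst (+ 10 * N₀ ≤_) (p₁ N₀ xa xb xc xz) light) hb)
          (other xb xz xa xc 0≤xa 0≤xc (subst (+ 10 * N₀ ≤_) (p₂ N₀ xa xb xc xz) light) hb)

      pair-step : ∀ {E} (P : Pair B E) → length E ≡ 4 → Any (λ a → δ a ≡ Pair.N₁ P) E → Drain B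
      pair-step {E} P 4E h = after (extract h)
        where
        after : (∃₂ λ a E′ → δ a ≡ Pair.N₁ P × E ↭ a ∷ E′) → Drain B
        after (a , b ∷ c ∷ z ∷ [] , e , p) = two-light (Pair-↭ p P) e
        after (a , [] , e , p) = contradiction (≡.trans (sym (↭-length p)) 4E) λ ()
        after (a , _ ∷ [] , e , p) = contradiction (≡.trans (sym (↭-length p)) 4E) λ ()
        after (a , _ ∷ _ ∷ [] , e , p) = contradiction (≡.trans (sym (↭-length p)) 4E) λ ()
        after (a , _ ∷ _ ∷ _ ∷ _ ∷ _ , e , p) = contradiction (≡.trans (sym (↭-length p)) 4E) λ ()

      -- An item of weight 1 would leave only three others, and these miss at most 3, short of
      -- `10 / 3`. So the event is a zero.
      must-vanish : ∀ {N O L w} → St N O L w 0ℤ → length L ≡ 4 → + 10 * N ≤ + 3 * defect N L → Any (Event N) L → Any (λ x → proj₂ x ≡ 0ℤ) L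
      must-vanish {N} {O} {L} {w} s 4L h ev with any-event ev
      ... | inj₁ z = z
      ... | inj₂ full-one = contradiction (after (extract full-one)) (<⇒≱ (0<N s))
        where
        after : (∃₂ λ x L′ → proj₂ x ≡ N × L ↭ x ∷ L′) → N ≤ 0ℤ
        after ((v , .N) , L′ , refl , p) = ≤-by (l N (defect N L′)) (0≤+ (dif (subst (λ t → + 10 * N ≤ + 3 * t) (∑-↭ _ p) h))
          (0≤* (0≤ℕ 3) (dif (subst (λ t → defect N L′ ≤ + t * N) (ℕₚ.suc-injective (≡.trans (sym (↭-length p)) 4L)) (defect-≤ L′ (All.tail (All-resp-↭ p (okL s))))))))
          where
          l : ∀ N d → + 3 * (N - N + d) - + 10 * N + + 3 * (+ 3 * N - d) ≡ 0ℤ - N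
          l = solve-∀

      -- Forward along the relation the deficit does not rise, so a weight reaching 0 is favourable.
      -- If instead a weight reaches 1, the backward move, whose deficit does not fall below
      -- `10 / 3`, must end in a zero; the two end points form the `Pair`.
      quad-step : ∀ {w} → Quad (+ 10) B w → Drain B
      quad-step {w} Qd = after (relation₃ F (subst (3 ℕ.<_) (sym four) ℕₚ.≤-refl))
        where
        open Quad Qd
        N = N′
        after : (∃ λ A → map cur A ≡ F × (∀ Q → moment Q (map dir A) ≡ 0ℤ) × 0ℤ ≤ ∑ δ A × Any (λ a → δ a ≢ 0ℤ) A) → Drain B
        after (A , eq , dep , 0≤∑ , nz) = both (move₀ A sA dep nz)
            (move₀ (map flip A) (subst (λ L → St N O L w 0ℤ) (sym (cur-flip A)) sA)
              (λ Q → ≡.trans (moment-flip Q A) (cong -_ (dep Q))) (nonzero-flip nz))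
          where
          sA : St N O (map cur A) w 0ℤ
          sA = subst (λ L → St N O L w 0ℤ) (sym eq) state
          dA : + 3 * defect N (map cur A) ≡ + 10 * N
          dA = ≡.trans (cong (λ L → + 3 * defect N L) eq) deficit
          4A : length A ≡ 4
          4A = ≡.trans (sym (Listₚ.length-map cur A)) (≡.trans (cong length eq) four)
          both : (∃₂ λ q p → 0ℤ < q × 0ℤ ≤ p × St (q * N) O (map (stepped q p) A) w 0ℤ × Any (Event (q * N)) (map (stepped q p) A)) →
            (∃₂ λ q p → 0ℤ < q × 0ℤ ≤ p × St (q * N) O (map (stepped q p) (map flip A)) w 0ℤ × Any (Event (q * N)) (map (stepped q p) (map flip A))) →
            Drain B
          both (q₁ , p₁ , _ , 0≤p₁ , s₁ , ev₁) (q₀ , p₀ , _ , 0≤p₀ , s₀ , ev₀) = decide (any-event ev₁)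
            where
            deficit-after : ∀ p q s d → + 3 * d ≡ + 10 * N → + 10 * (q * N) - + 3 * p * s ≡ + 3 * (q * d - p * s)
            deficit-after p q s d e = ≡.trans (l₁ p q N s) (≡.trans (cong (λ t → q * t - + 3 * p * s) (sym e)) (l₂ p q s d))
              where
              l₁ : ∀ p q N s → + 10 * (q * N) - + 3 * p * s ≡ q * (+ 10 * N) - + 3 * p * s
              l₁ = solve-∀
              l₂ : ∀ p q s d → q * (+ 3 * d) - + 3 * p * s ≡ + 3 * (q * d - p * s)
              l₂ = solve-∀
            d₁ : + 3 * defect (q₁ * N) (map (stepped q₁ p₁) A) ≤ + 10 * (q₁ * N)
            d₁ = subst (_≤ + 10 * (q₁ * N)) (≡.trans (deficit-after p₁ q₁ (∑ δ A) _ dA) (cong (+ 3 *_) (sym (defect-stepped q₁ p₁ N A))))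
              (≤-by (l (+ 10 * (q₁ * N)) (+ 3 * p₁ * ∑ δ A)) (0≤* (0≤* (0≤ℕ 3) 0≤p₁) 0≤∑))
              where
              l : ∀ a b → b ≡ a - (a - b)
              l = solve-∀
            perm₁ : B ↭ O ++ vecs (map (stepped q₁ p₁) A)
            perm₁ = subst (λ t → B ↭ O ++ t) (sym (≡.trans (vecs-stepped q₁ p₁ A) (cong vecs eq))) perm
            -- Both end points on the same four vectors: backward weights in the second component,
            -- forward weights in the third.
            E = map (λ (v , n , d) → v , q₀ * n + p₀ * - d , q₁ * n + p₁ * d) A
            cur-E : map cur E ≡ map (stepped q₀ p₀) (map flip A)
            cur-E = ≡.trans (sym (Listₚ.map-∘ A)) (Listₚ.map-∘ A)
            dir-E : map dir E ≡ map (stepped q₁ p₁) A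
            dir-E = sym (Listₚ.map-∘ A)
            light₀ : + 10 * (q₀ * N) ≤ + 3 * defect (q₀ * N) (map (stepped q₀ p₀) (map flip A))
            light₀ = subst (+ 10 * (q₀ * N) ≤_) (≡.trans (deficit-after p₀ q₀ (∑ δ (map flip A)) _ (≡.trans (cong (λ L → + 3 * defect N L) (cur-flip A)) dA))
                (cong (+ 3 *_) (sym (defect-stepped q₀ p₀ N (map flip A)))))
              (≤-by (≡.trans (l (+ 10 * (q₀ * N)) p₀ (∑ δ A)) (cong (λ t → + 10 * (q₀ * N) - + 3 * p₀ * t - + 10 * (q₀ * N)) (sym (∑δ-flip A)))) (0≤* (0≤* (0≤ℕ 3) 0≤p₀) 0≤∑))
              where
              l : ∀ a p s → + 3 * p * s ≡ a - + 3 * p * - s - a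
              l = solve-∀
            decide : _ → Drain B
            decide (inj₁ z) = drop-clean s₁ perm₁ d₁ z
            decide (inj₂ f) = pair-step P (≡.trans (Listₚ.length-map _ A) 4A) (Anyₚ.map⁻ (subst (Any _) (sym dir-E) f))
              where
              P : Pair B E
              P = record
                { s₀ = subst (λ L → St (q₀ * N) O L w 0ℤ) (sym cur-E) s₀
                ; s₁ = subst (λ L → St (q₁ * N) O L w 0ℤ) (sym dir-E) s₁
                ; light = subst (λ L → + 10 * (q₀ * N) ≤ + 3 * defect (q₀ * N) L) (sym cur-E) light₀
                ; vanish = subst (Any _) (sym cur-E) (must-vanish s₀ (≡.trans (Listₚ.length-map _ (map flip A)) (≡.trans (Listₚ.length-map flip A) 4A)) light₀ ev₀)
                ; perm = subst (λ t → B ↭ O ++ t) (sym (≡.trans (cong vecs cur-E) (≡.trans (vecs-stepped q₀ p₀ (map flip A)) (cong vecs (≡.trans (cur-flip A) eq))))) perm }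

    -- Emptying the system by induction on its size.

    Drain-↭ : ∀ {B B′} → B ↭ B′ → Drain B → Drain B′
    Drain-↭ p (R , q , g) = R , trans q p , g

    balls : ∀ {N w c} L → St N [] L w c → All Ball (vecs L)
    balls L s = Allₚ.map⁺ (All.map proj₁ (okL s))

    vecs-length : ∀ L {n} → length L ℕ.≤ n → length (vecs L) ℕ.≤ n
    vecs-length L = subst (ℕ._≤ _) (sym (Listₚ.length-map proj₁ L))

    -- At least four vectors leave room for a deficit of `10 / 3`. With at most three, any removal
    -- leaves two, and sums of at most two ball vectors are good in every order.
    drain-N : ∀ {k} → DrainN k → DrainP k → DrainN (suc k)
    drain-N {k} recN recP L h (N , w , s , d , g) = go (length L ℕ.≤? 3)
      where
      |B| = vecs-length L h
      tail-few : ∀ B → All Ball B → Good (sum³ B) → length B ℕ.≤ 3 → Drain B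
      tail-few [] _ _ _ = [] , refl , tt
      tail-few (v ∷ B) (_ ∷ hB) g h = drain-cons refl g (drain-few B hB (ℕ.s≤s⁻¹ h))
      continue : Removal (+ 10) (vecs L) w 0ℤ ⊎ Quad (+ 10) (vecs L) w → Drain (vecs L)
      continue (inj₂ q) = QuadStep.quad-step recN recP |B| g q
      continue (inj₁ r) = drain-cons perm g (recN rest
          (ℕ.s≤s⁻¹ (subst (ℕ._≤ suc k) (≡.trans (↭-length perm) (cong suc (Listₚ.length-map proj₁ rest))) |B|))
          (N′ , w , s′ , subst (_≤ + 9 * N′) (sym deficit) (*-monoʳ-≤-nonNeg N′ {{nonNegative (0<⇒0≤ (0<N state))}} (+≤+ (ℕₚ.m≤m+n 7 2))) ,
            good-state s′ (≤-reflexive (≡.trans (cong (+ 3 *_) (+-identityʳ _)) deficit))))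
        where
        open Removal r
        s′ = subst (St N′ [] rest w) (no-w refl) state
      go : Dec (length L ℕ.≤ 3) → Drain (vecs L)
      go (yes few) = tail-few (vecs L) (balls L s) g (vecs-length L few)
      go (no many) = continue (rescale-reduce (+ 9) (+ 10) (+≤+ (ℕₚ.m≤m+n 9 1)) s d (+≤+ (ℕₚ.m≤m+n 9 1))
          (≤-trans (+≤+ (ℕₚ.m≤m+n 10 2)) 12≤) (<-≤-trans (+<+ (ℕₚ.m≤m+n 10 2)) 12≤))
        where
        12≤ : + 12 ≤ + 3 * + length L
        12≤ = *-monoˡ-≤-nonNeg (+ 3) (+≤+ (ℕₚ.≰⇒> many))

    -- Removals start from deficit 3, so that 2 is left beside the debt. If four fractional weights
    -- block this, the debt has been used up and the system is an `NState` of the same size; hence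
    -- the appeal to `DrainN (suc k)`.
    drain-P : ∀ {k} → DrainP k → DrainN (suc k) → DrainP (suc k)
    drain-P {k} recP recN L h ps@(N , w , c , s , d) = go (length L ℕ.≤? 2)
      where
      |B| = vecs-length L h
      continue : Removal (+ 9) (vecs L) w c ⊎ Quad (+ 9) (vecs L) w → Drain (vecs L)
      continue (inj₁ r) = drain-cons perm (good-P L ps) (recP rest
          (ℕ.s≤s⁻¹ (subst (ℕ._≤ suc k) (≡.trans (↭-length perm) (cong suc (Listₚ.length-map proj₁ rest))) |B|))
          (N′ , w , c′ , state , ≤-reflexive deficit))
        where open Removal r
      continue (inj₂ q) = Drain-↭ (↭-sym perm′) (recN (full N′ O ++ F)
          (subst (ℕ._≤ suc k) (≡.trans (↭-length perm′) (Listₚ.length-map proj₁ (full N′ O ++ F))) |B|)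
          (N′ , w , absorb state , ≤-reflexive (≡.trans (cong (+ 3 *_) (defect-absorb N′ O F)) deficit) , subst Good (sum³-↭ perm′) (good-P L ps)))
        where
        open Quad q
        perm′ : vecs L ↭ vecs (full N′ O ++ F)
        perm′ = trans perm (↭-reflexive (sym (vecs-absorb N′ O F)))
      go : Dec (length L ℕ.≤ 2) → Drain (vecs L)
      go (yes few) = drain-few (vecs L) (balls L s) (vecs-length L few)
      go (no many) = continue (rescale-reduce (+ 6) (+ 9) ≤-refl s d (+≤+ (ℕₚ.m≤m+n 6 3)) 9≤ (<-≤-trans (+<+ (ℕₚ.m≤m+n 7 2)) 9≤))
        where
        9≤ : + 9 ≤ + 3 * + length L
        9≤ = *-monoˡ-≤-nonNeg (+ 3) (+≤+ (ℕₚ.≰⇒> many))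

    drain-all : ∀ k → DrainN k × DrainP k
    drain-all zero = (λ { [] _ _ → [] , refl , tt }) , (λ { [] _ _ → [] , refl , tt })
    drain-all (suc k) = let (recN , recP) = drain-all k ; drainN = drain-N recN recP in drainN , drain-P recP drainN

    steinitz : ∀ S → All Ball S → sum³ S ≡ 0³ → Drain S
    steinitz S hS z = subst Drain (vecs-full 1ℤ S) (proj₁ (drain-all (length (full 1ℤ S))) (full 1ℤ S) ℕₚ.≤-refl
      (1ℤ , 0³ , state , subst (λ t → + 3 * t ≤ + 9 * 1ℤ) (sym (defect-full 1ℤ S)) (+≤+ ℕ.z≤n) ,
        subst Good (sym (≡.trans (cong sum³ (vecs-full 1ℤ S)) z)) (0≤* (0≤ℕ 49) 0≤mm)))
      where
      state : St 1ℤ [] (full 1ℤ S) 0³ 0ℤ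
      state = record
        { 0<N = +<+ (ℕ.s≤s ℕ.z≤n) ; okO = [] ; okw = 0≤mm ; 0≤c = ≤-refl ; c≤N = +≤+ ℕ.z≤n
        ; okL = Allₚ.map⁺ (All.map (λ b → b , +≤+ ℕ.z≤n , ≤-refl) hS)
        ; zero-sum = λ Q → ≡.trans (cong (λ t → 1ℤ * 0ℤ + t + 0ℤ * (0³ · Q)) (≡.trans (moment-full 1ℤ Q S)
            (cong (1ℤ *_) (≡.trans (sym (·-sum³ S Q)) (cong (_· Q) z))))) (l (0³ · Q) (·-sum³ [] Q)) }
        where
        l : ∀ x → x ≡ 0ℤ → 1ℤ * 0ℤ + 1ℤ * x + 0ℤ * x ≡ 0ℤ
        l .0ℤ refl = refl

-- Rational estimates and Riemann sums for the Leibniz series.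

module RationalBounds where

  open import Data.Nat as ℕ using (ℕ; zero; suc)
  import Data.Nat.Properties as ℕₚ
  open import Data.Integer as ℤ using (ℤ; +_)
  import Data.Integer.Properties as ℤₚ
  open import Data.Rational
  open import Data.Rational.Properties
  import Data.Rational.Unnormalised as ℚᵘ
  import Data.Rational.Unnormalised.Properties as ℚᵘₚ
  open import Relation.Nullary.Decidable using (dec⇒maybe)
  open import Relation.Binary.PropositionalEquality
  open import Tactic.RingSolver.Core.AlmostCommutativeRing using (AlmostCommutativeRing; fromCommutativeRing)
  open import Tactic.RingSolver using (solve-∀)

  ℚ-ring : AlmostCommutativeRing _ _
  ℚ-ring = fromCommutativeRing +-*-commutativeRing (λ p → dec⇒maybe (0ℚ ≟ p))

  0≤p+q : ∀ {p q} → 0ℚ ≤ p → 0ℚ ≤ q → 0ℚ ≤ p + q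
  0≤p+q = +-mono-≤

  0≤p*q : ∀ {p q} → 0ℚ ≤ p → 0ℚ ≤ q → 0ℚ ≤ p * q
  0≤p*q {p} {q} 0≤p 0≤q = subst (_≤ p * q) (*-zeroˡ q) (*-monoʳ-≤-nonNeg q {{nonNegative 0≤q}} 0≤p)

  0≤q-p⇒p≤q : ∀ {p q e} → e ≡ q - p → 0ℚ ≤ e → p ≤ q
  0≤q-p⇒p≤q {p} {q} eq h = subst₂ _≤_ (+-identityʳ p) (l p q) (+-monoʳ-≤ p (subst (0ℚ ≤_) eq h))
    where
    l : ∀ p q → p + (q - p) ≡ q
    l = solve-∀ ℚ-ring

  p≤q⇒0≤q-p : ∀ {p q} → p ≤ q → 0ℚ ≤ q - p
  p≤q⇒0≤q-p {p} {q} h = subst (_≤ q - p) (+-inverseʳ p) (+-monoˡ-≤ (- p) h)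

  toℚᵘ-ℕ→ℚ : ∀ n → toℚᵘ (ℕ→ℚ n) ℚᵘ.≃ ℚᵘ.mkℚᵘ (+ n) 0
  toℚᵘ-ℕ→ℚ n = toℚᵘ-fromℚᵘ (ℚᵘ.mkℚᵘ (+ n) 0)

  ℕ→ℚ-+ : ∀ a b → ℕ→ℚ (a ℕ.+ b) ≡ ℕ→ℚ a + ℕ→ℚ b
  ℕ→ℚ-+ a b = toℚᵘ-injective (ℚᵘₚ.≃-trans (toℚᵘ-ℕ→ℚ (a ℕ.+ b)) (ℚᵘₚ.≃-trans
    (ℚᵘ.*≡* (cong (ℤ._* + 1) (trans (ℤₚ.pos-+ a b) (cong₂ ℤ._+_ (sym (ℤₚ.*-identityʳ (+ a))) (sym (ℤₚ.*-identityʳ (+ b)))))))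
    (ℚᵘₚ.≃-sym (ℚᵘₚ.≃-trans (toℚᵘ-homo-+ (ℕ→ℚ a) (ℕ→ℚ b)) (ℚᵘₚ.+-cong (toℚᵘ-ℕ→ℚ a) (toℚᵘ-ℕ→ℚ b))))))

  ℕ→ℚ-* : ∀ a b → ℕ→ℚ (a ℕ.* b) ≡ ℕ→ℚ a * ℕ→ℚ b
  ℕ→ℚ-* a b = toℚᵘ-injective (ℚᵘₚ.≃-trans (toℚᵘ-ℕ→ℚ (a ℕ.* b)) (ℚᵘₚ.≃-trans
    (ℚᵘ.*≡* (cong (ℤ._* + 1) (ℤₚ.pos-* a b)))
    (ℚᵘₚ.≃-sym (ℚᵘₚ.≃-trans (toℚᵘ-homo-* (ℕ→ℚ a) (ℕ→ℚ b)) (ℚᵘₚ.*-cong (toℚᵘ-ℕ→ℚ a) (toℚᵘ-ℕ→ℚ b))))))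

  ℕ→ℚ-mono : ∀ {a b} → a ℕ.≤ b → ℕ→ℚ a ≤ ℕ→ℚ b
  ℕ→ℚ-mono {a} {b} h = toℚᵘ-cancel-≤ (ℚᵘₚ.≤-respˡ-≃ (ℚᵘₚ.≃-sym (toℚᵘ-ℕ→ℚ a)) (ℚᵘₚ.≤-respʳ-≃ (ℚᵘₚ.≃-sym (toℚᵘ-ℕ→ℚ b))
    (ℚᵘ.*≤* (ℤₚ.*-monoʳ-≤-nonNeg (+ 1) (ℤ.+≤+ h)))))

  ℕ→ℚ-suc : ∀ n → ℕ→ℚ (suc n) ≡ 1ℚ + ℕ→ℚ n
  ℕ→ℚ-suc n = ℕ→ℚ-+ 1 n

  0≤ℕ→ℚ : ∀ n → 0ℚ ≤ ℕ→ℚ n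
  0≤ℕ→ℚ n = ℕ→ℚ-mono (ℕ.z≤n {n})

  unit-fraction : ℕ → ℚ
  unit-fraction d = (+ 1) / suc d

  ℕ→ℚ-unit-fraction : ∀ d → ℕ→ℚ (suc d) * unit-fraction d ≡ 1ℚ
  ℕ→ℚ-unit-fraction d = toℚᵘ-injective (ℚᵘₚ.≃-trans (toℚᵘ-homo-* (ℕ→ℚ (suc d)) (unit-fraction d))
    (ℚᵘₚ.≃-trans (ℚᵘₚ.*-cong (toℚᵘ-ℕ→ℚ (suc d)) (toℚᵘ-fromℚᵘ (ℚᵘ.mkℚᵘ (+ 1) d)))
      (ℚᵘ.*≡* (cong +_ (l d)))))
    where
    l : ∀ d → (suc d ℕ.* 1) ℕ.* 1 ≡ 1 ℕ.* suc (d ℕ.+ 0)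
    l d = trans (ℕₚ.*-identityʳ (suc d ℕ.* 1)) (trans (ℕₚ.*-identityʳ (suc d)) (sym (trans (ℕₚ.*-identityˡ _) (cong suc (ℕₚ.+-identityʳ d)))))

  0≤unit-fraction : ∀ d → 0ℚ ≤ unit-fraction d
  0≤unit-fraction d = nonNegative⁻¹ (unit-fraction d) {{normalize-nonNeg 1 (suc d)}}

  infixr 8 _^ℚ_

  _^ℚ_ : ℚ → ℕ → ℚ
  p ^ℚ zero = 1ℚ
  p ^ℚ suc n = p * p ^ℚ n

  0≤^ℚ : ∀ {p} n → 0ℚ ≤ p → 0ℚ ≤ p ^ℚ n
  0≤^ℚ zero h = ℕ→ℚ-mono (ℕ.z≤n {1})
  0≤^ℚ (suc n) h = 0≤p*q h (0≤^ℚ n h)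

  1^ℚ : ∀ n → 1ℚ ^ℚ n ≡ 1ℚ
  1^ℚ zero = refl
  1^ℚ (suc n) = trans (*-identityˡ _) (1^ℚ n)

  -- The mean value estimate for the power `p + 1`, with the derivative taken at the right end;
  -- `^ℚ-step-≥` takes it at the left end.
  ^ℚ-step-≤ : ∀ {a κ} p → 0ℚ ≤ a → 0ℚ ≤ κ → (a + κ) ^ℚ suc p ≤ a ^ℚ suc p + ℕ→ℚ (suc p) * κ * (a + κ) ^ℚ p
  ^ℚ-step-≤ {a} {κ} zero 0≤a 0≤κ = ≤-reflexive (l a κ)
    where
    l : ∀ a κ → (a + κ) * 1ℚ ≡ a * 1ℚ + 1ℚ * κ * 1ℚ
    l = solve-∀ ℚ-ring
  ^ℚ-step-≤ {a} {κ} (suc p) 0≤a 0≤κ = 0≤q-p⇒p≤q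
    (trans (l a κ (a ^ℚ suc p) ((a + κ) ^ℚ p) (ℕ→ℚ (suc p)))
      (cong (λ c → (a * a ^ℚ suc p + c * κ * ((a + κ) * (a + κ) ^ℚ p)) - (a + κ) * ((a + κ) * (a + κ) ^ℚ p)) (sym (ℕ→ℚ-suc (suc p)))))
    (0≤p+q (0≤p*q 0≤a (p≤q⇒0≤q-p (^ℚ-step-≤ p 0≤a 0≤κ)))
      (0≤p*q (0≤p*q (0≤ℕ→ℚ (suc p)) (0≤p*q 0≤κ 0≤κ)) (0≤^ℚ p (0≤p+q 0≤a 0≤κ))))
    where
    l : ∀ a κ A P c → a * (A + c * κ * P - (a + κ) * P) + c * (κ * κ) * P
      ≡ (a * A + (1ℚ + c) * κ * ((a + κ) * P)) - (a + κ) * ((a + κ) * P)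
    l = solve-∀ ℚ-ring

  ^ℚ-step-≥ : ∀ {a κ} p → 0ℚ ≤ a → 0ℚ ≤ κ → a ^ℚ suc p + ℕ→ℚ (suc p) * κ * a ^ℚ p ≤ (a + κ) ^ℚ suc p
  ^ℚ-step-≥ {a} {κ} zero 0≤a 0≤κ = ≤-reflexive (l a κ)
    where
    l : ∀ a κ → a * 1ℚ + 1ℚ * κ * 1ℚ ≡ (a + κ) * 1ℚ
    l = solve-∀ ℚ-ring
  ^ℚ-step-≥ {a} {κ} (suc p) 0≤a 0≤κ = 0≤q-p⇒p≤q
    (trans (l a κ (a ^ℚ p) ((a + κ) ^ℚ suc p) (ℕ→ℚ (suc p)))
      (cong (λ c → (a + κ) * (a + κ) ^ℚ suc p - (a * (a * a ^ℚ p) + c * κ * (a * a ^ℚ p))) (sym (ℕ→ℚ-suc (suc p)))))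
    (0≤p+q (0≤p*q (0≤p+q 0≤a 0≤κ) (p≤q⇒0≤q-p (^ℚ-step-≥ p 0≤a 0≤κ)))
      (0≤p*q (0≤p*q (0≤ℕ→ℚ (suc p)) (0≤p*q 0≤κ 0≤κ)) (0≤^ℚ p 0≤a)))
    where
    l : ∀ a κ A B c → (a + κ) * (B - (a * A + c * κ * A)) + c * (κ * κ) * A
      ≡ (a + κ) * B - (a * (a * A) + (1ℚ + c) * κ * (a * A))
    l = solve-∀ ℚ-ring

  ∑≤ : (ℕ → ℚ) → ℕ → ℚ
  ∑≤ f zero = f zero
  ∑≤ f (suc n) = ∑≤ f n + f (suc n)

  ∑≤-cong : ∀ {f g} → (∀ j → f j ≡ g j) → ∀ n → ∑≤ f n ≡ ∑≤ g n
  ∑≤-cong h zero = h zero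
  ∑≤-cong h (suc n) = cong₂ _+_ (∑≤-cong h n) (h (suc n))

  ∑≤-mono : ∀ {f g} n → (∀ j → j ℕ.≤ n → f j ≤ g j) → ∑≤ f n ≤ ∑≤ g n
  ∑≤-mono zero h = h zero ℕ.z≤n
  ∑≤-mono (suc n) h = +-mono-≤ (∑≤-mono n (λ j j≤n → h j (ℕₚ.m≤n⇒m≤1+n j≤n))) (h (suc n) ℕₚ.≤-refl)

  ∑≤-const : ∀ c n → ∑≤ (λ _ → c) n ≡ ℕ→ℚ (suc n) * c
  ∑≤-const c zero = sym (*-identityˡ c)
  ∑≤-const c (suc n) = trans (cong (_+ c) (∑≤-const c n)) (trans (l c (ℕ→ℚ (suc n))) (cong (_* c) (sym (ℕ→ℚ-suc (suc n)))))
    where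
    l : ∀ c k → k * c + c ≡ (1ℚ + k) * c
    l = solve-∀ ℚ-ring

  -- Riemann sums on the nodes t j = j κ of [0 , 1], where κ = 1 / K.
  module Riemann (k : ℕ) (κ : ℚ) (0≤κ : 0ℚ ≤ κ) (Kκ≡1 : ℕ→ℚ (suc k) * κ ≡ 1ℚ) where

    K : ℕ
    K = suc k

    t : ℕ → ℚ
    t j = ℕ→ℚ j * κ

    0≤t : ∀ j → 0ℚ ≤ t j
    0≤t j = 0≤p*q (0≤ℕ→ℚ j) 0≤κ

    t-suc : ∀ j → t (suc j) ≡ t j + κ
    t-suc j = trans (cong (_* κ) (ℕ→ℚ-suc j)) (l (ℕ→ℚ j) κ)
      where
      l : ∀ j κ → (1ℚ + j) * κ ≡ j * κ + κ
      l = solve-∀ ℚ-ring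

    t-K : t K ≡ 1ℚ
    t-K = Kκ≡1

    T : ℕ → ℕ → ℚ
    T p = ∑≤ (λ j → κ * t j ^ℚ p)

    -- Telescoping of `^ℚ-step-≤`: the sum over right end points dominates the integral of the
    -- power.
    T-≥ : ∀ p n → t n ^ℚ suc p ≤ ℕ→ℚ (suc p) * T p n
    T-≥ p zero = 0≤q-p⇒p≤q (trans (l (ℕ→ℚ (suc p)) κ (t 0 ^ℚ p)) (cong (λ z → ℕ→ℚ (suc p) * (κ * t 0 ^ℚ p) - z * t 0 ^ℚ p) (sym (*-zeroˡ κ))))
        (0≤p*q (0≤p*q (0≤ℕ→ℚ (suc p)) 0≤κ) (0≤^ℚ p (0≤t 0)))
      where
      l : ∀ c κ x → c * κ * x ≡ c * (κ * x) - 0ℚ * x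
      l = solve-∀ ℚ-ring
    T-≥ p (suc n) = subst (λ u → u ^ℚ suc p ≤ ℕ→ℚ (suc p) * (T p n + κ * u ^ℚ p)) (sym (t-suc n)) (0≤q-p⇒p≤q (l (ℕ→ℚ (suc p)) κ (T p n) (t n ^ℚ suc p) ((t n + κ) ^ℚ p) ((t n + κ) ^ℚ suc p))
        (0≤p+q (p≤q⇒0≤q-p (T-≥ p n)) (p≤q⇒0≤q-p (^ℚ-step-≤ p (0≤t n) 0≤κ))))
      where
      l : ∀ c κ T a b d → c * T - a + (a + c * κ * b - d) ≡ c * (T + κ * b) - d
      l = solve-∀ ℚ-ring

    -- Left end points stay below the integral, so only the term of the last node is in excess.
    T-≤ : ∀ p n → ℕ→ℚ (suc p) * T p n ≤ t n ^ℚ suc p + ℕ→ℚ (suc p) * κ * t n ^ℚ p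
    T-≤ p zero = 0≤q-p⇒p≤q (l (ℕ→ℚ (suc p)) κ (t 0 ^ℚ p) (t 0)) (0≤p*q (0≤t 0) (0≤^ℚ p (0≤t 0)))
      where
      l : ∀ c κ x t → t * x ≡ t * x + c * κ * x - c * (κ * x)
      l = solve-∀ ℚ-ring
    T-≤ p (suc n) = subst (λ u → ℕ→ℚ (suc p) * (T p n + κ * u ^ℚ p) ≤ u ^ℚ suc p + ℕ→ℚ (suc p) * κ * u ^ℚ p) (sym (t-suc n)) (0≤q-p⇒p≤q (l (ℕ→ℚ (suc p)) κ (T p n) (t n ^ℚ suc p) (t n ^ℚ p) ((t n + κ) ^ℚ suc p) ((t n + κ) ^ℚ p))
        (0≤p+q (p≤q⇒0≤q-p (T-≤ p n)) (p≤q⇒0≤q-p (^ℚ-step-≥ p (0≤t n) 0≤κ))))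
      where
      l : ∀ c κ T a b d e → (a + c * κ * b - c * T) + (d - (a + c * κ * b)) ≡ d + c * κ * e - c * (T + κ * e)
      l = solve-∀ ℚ-ring

    scaled-≤ : ∀ p {x y} → ℕ→ℚ (suc p) * x ≤ ℕ→ℚ (suc p) * y → x ≤ y
    scaled-≤ p {x} {y} h = 0≤q-p⇒p≤q (trans (l (ℕ→ℚ (suc p)) (unit-fraction p) x y) (trans (cong (λ u → u * (y - x)) (ℕ→ℚ-unit-fraction p)) (*-identityˡ _)))
        (0≤p*q (0≤unit-fraction p) (p≤q⇒0≤q-p h))
      where
      l : ∀ c u x y → u * (c * y - c * x) ≡ c * u * (y - x)
      l = solve-∀ ℚ-ring

    T-lower : ∀ p → unit-fraction p ≤ T p K
    T-lower p = scaled-≤ p (subst (_≤ ℕ→ℚ (suc p) * T p K) (trans (cong (_^ℚ suc p) t-K) (trans (1^ℚ (suc p)) (sym (ℕ→ℚ-unit-fraction p)))) (T-≥ p K))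

    T-upper : ∀ p → T p K ≤ unit-fraction p + κ
    T-upper p = scaled-≤ p (subst (ℕ→ℚ (suc p) * T p K ≤_)
        (trans (cong₂ (λ a b → a + ℕ→ℚ (suc p) * κ * b) (trans (cong (_^ℚ suc p) t-K) (1^ℚ (suc p))) (trans (cong (_^ℚ p) t-K) (1^ℚ p)))
          (trans (cong (λ u → u + ℕ→ℚ (suc p) * κ * 1ℚ) (sym (ℕ→ℚ-unit-fraction p))) (l (ℕ→ℚ (suc p)) κ (unit-fraction p)))) (T-≤ p K))
      where
      l : ∀ c κ u → c * u + c * κ * 1ℚ ≡ c * (u + κ)
      l = solve-∀ ℚ-ring

    -- This is `κ / (1 + t²) = K / (K² + j²)`; the argument of `unit-fraction` is `K² + j² - 1`.
    h : ℕ → ℚ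
    h j = ℕ→ℚ K * unit-fraction (k ℕ.+ k ℕ.* K ℕ.+ j ℕ.* j)

    0≤h : ∀ j → 0ℚ ≤ h j
    0≤h j = 0≤p*q (0≤ℕ→ℚ K) (0≤unit-fraction (k ℕ.+ k ℕ.* K ℕ.+ j ℕ.* j))

    h-spec : ∀ j → h j * (1ℚ + t j * t j) ≡ κ
    h-spec j = reciprocal (ℕ→ℚ K) (ℕ→ℚ j) (unit-fraction (k ℕ.+ k ℕ.* K ℕ.+ j ℕ.* j)) t-K
        (trans (cong (_* unit-fraction (k ℕ.+ k ℕ.* K ℕ.+ j ℕ.* j)) (sym (trans (ℕ→ℚ-+ (K ℕ.* K) (j ℕ.* j)) (cong₂ _+_ (ℕ→ℚ-* K K) (ℕ→ℚ-* j j)))))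
          (ℕ→ℚ-unit-fraction (k ℕ.+ k ℕ.* K ℕ.+ j ℕ.* j)))
      where
      reciprocal : ∀ a b u → a * κ ≡ 1ℚ → (a * a + b * b) * u ≡ 1ℚ → a * u * (1ℚ + b * κ * (b * κ)) ≡ κ
      reciprocal a b u aκ abu = trans (l₁ a b u κ) (trans (cong₂ (λ x y → x * y * κ + a * u * (1ℚ - x * x)) aκ abu) (l₂ (a * u) κ))
        where
        l₁ : ∀ a b u κ → a * u * (1ℚ + b * κ * (b * κ)) ≡ a * κ * ((a * a + b * b) * u) * κ + a * u * (1ℚ - a * κ * (a * κ))
        l₁ = solve-∀ ℚ-ring
        l₂ : ∀ x κ → 1ℚ * 1ℚ * κ + x * (1ℚ - 1ℚ * 1ℚ) ≡ κ
        l₂ = solve-∀ ℚ-ring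

    -- The geometric series cut after `2 n + 1` terms, matching `leib n` term by term. An odd number
    -- of terms leaves a non-negative remainder, so the truncation is an upper bound.
    g : ℕ → ℕ → ℚ
    g zero j = κ
    g (suc n) j = g n j - κ * t j ^ℚ (2 ℕ.+ 4 ℕ.* n) + κ * t j ^ℚ (4 ℕ.+ 4 ℕ.* n)

    -- The geometric series 1 / (1 + t²) = 1 - t² + t⁴ - ... with its remainder.
    g-spec : ∀ n j → g n j ≡ h j + h j * t j ^ℚ (2 ℕ.+ 4 ℕ.* n)
    g-spec zero j = trans (sym (h-spec j)) (l (h j) (t j))
      where
      l : ∀ h t → h * (1ℚ + t * t) ≡ h + h * (t * (t * 1ℚ))
      l = solve-∀ ℚ-ring
    g-spec (suc n) j = trans (cong₂ (λ a b → a - b * x + b * (t j * (t j * x))) (g-spec n j) (sym (h-spec j)))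
        (trans (l (h j) (t j) x) (cong (λ e → h j + h j * t j ^ℚ (2 ℕ.+ e)) (sym (ℕₚ.*-suc 4 n))))
      where
      x = t j ^ℚ (2 ℕ.+ 4 ℕ.* n)
      l : ∀ h t x → h + h * x - h * (1ℚ + t * t) * x + h * (1ℚ + t * t) * (t * (t * x)) ≡ h + h * (t * (t * (t * (t * x))))
      l = solve-∀ ℚ-ring

    h≤g : ∀ n j → h j ≤ g n j
    h≤g n j = 0≤q-p⇒p≤q (trans (l (h j) (t j ^ℚ (2 ℕ.+ 4 ℕ.* n))) (cong (_- h j) (sym (g-spec n j)))) (0≤p*q (0≤h j) (0≤^ℚ (2 ℕ.+ 4 ℕ.* n) (0≤t j)))
      where
      l : ∀ h x → h * x ≡ h + h * x - h
      l = solve-∀ ℚ-ring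

    -- Each of the `n + 1` positive terms exceeds its integral by at most `κ`; the negative ones
    -- cost nothing, by `T-lower`.
    ∑g-≤ : ∀ n → ∑≤ (g n) K ≤ leib n + ℕ→ℚ (suc n) * κ
    ∑g-≤ zero = ≤-reflexive (trans (∑≤-const κ K) (trans (cong (_* κ) (ℕ→ℚ-suc K)) (trans (l (ℕ→ℚ K) κ) (cong (_+ 1ℚ * κ) t-K))))
      where
      l : ∀ K κ → (1ℚ + K) * κ ≡ K * κ + 1ℚ * κ
      l = solve-∀ ℚ-ring
    ∑g-≤ (suc n) = subst (_≤ leib (suc n) + ℕ→ℚ (suc (suc n)) * κ) (sym split)
        (0≤q-p⇒p≤q (trans (l (leib n) (∑≤ (g n) K) (T (2 ℕ.+ 4 ℕ.* n) K) (T (4 ℕ.+ 4 ℕ.* n) K) (unit-fraction (2 ℕ.+ 4 ℕ.* n)) (unit-fraction (4 ℕ.+ 4 ℕ.* n)) (ℕ→ℚ (suc n)) κ)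
            (cong (λ c → (leib n - unit-fraction (2 ℕ.+ 4 ℕ.* n) + unit-fraction (4 ℕ.+ 4 ℕ.* n) + c * κ) - (∑≤ (g n) K - T (2 ℕ.+ 4 ℕ.* n) K + T (4 ℕ.+ 4 ℕ.* n) K)) (sym (ℕ→ℚ-suc (suc n)))))
          (0≤p+q (0≤p+q (p≤q⇒0≤q-p (∑g-≤ n)) (p≤q⇒0≤q-p (T-lower (2 ℕ.+ 4 ℕ.* n)))) (p≤q⇒0≤q-p (T-upper (4 ℕ.+ 4 ℕ.* n)))))
      where
      l : ∀ L G P Q a b c κ → (L + c * κ - G) + (P - a) + (b + κ - Q) ≡ (L - a + b + (1ℚ + c) * κ) - (G - P + Q)
      l = solve-∀ ℚ-ring
      expand : ∀ m → ∑≤ (g (suc n)) m ≡ ∑≤ (g n) m - T (2 ℕ.+ 4 ℕ.* n) m + T (4 ℕ.+ 4 ℕ.* n) m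
      expand zero = refl
      expand (suc m) = trans (cong (_+ g (suc n) (suc m)) (expand m)) (l′ (∑≤ (g n) m) (T (2 ℕ.+ 4 ℕ.* n) m) (T (4 ℕ.+ 4 ℕ.* n) m) (g n (suc m)) (κ * t (suc m) ^ℚ (2 ℕ.+ 4 ℕ.* n)) (κ * t (suc m) ^ℚ (4 ℕ.+ 4 ℕ.* n)))
        where
        l′ : ∀ a b c d e f → a - b + c + (d - e + f) ≡ a + d - (b + e) + (c + f)
        l′ = solve-∀ ℚ-ring
      split = expand K

    ∑h-≤ : ∀ n → ∑≤ h K ≤ leib n + ℕ→ℚ (suc n) * κ
    ∑h-≤ n = ≤-trans (∑≤-mono K (λ j _ → h≤g n j)) (∑g-≤ n)

-- Covering the lattice points of a ball by slices and sectors.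

module LatticePoints where

  open import Data.Nat
  open import Data.Nat.Properties
  open import Data.Nat.DivMod
  open import Data.Nat.Tactic.RingSolver using (solve-∀)
  open import Data.Integer as ℤ using (ℤ; +_; ∣_∣)
  import Data.Integer.Properties as ℤₚ
  open import Data.Product using (_×_; _,_; ∃; proj₁; proj₂)
  open import Data.Sum using (inj₁; inj₂)
  open import Data.List as List using (List; []; _∷_; length; _++_; map; concatMap)
  import Data.List.Properties as Listₚ
  open import Data.List.Relation.Unary.All as All using (All; []; _∷_)
  open import Data.List.Relation.Unary.Any using (here; there)
  open import Data.List.Relation.Unary.AllPairs using (AllPairs; []; _∷_)
  open import Data.List.Relation.Binary.Permutation.Propositional.Properties using (↭-length; ∈-resp-↭; shift)
  open import Data.List.Membership.Propositional using (_∈_; lose)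
  open import Data.List.Membership.Propositional.Properties using (∈-∃++; ∈-++⁺ˡ; ∈-++⁺ʳ; ∈-map⁺; ∈-concatMap⁺)
  open import Relation.Nullary using (Dec; yes; no; contradiction)
  open import Relation.Binary.PropositionalEquality

  ∑ᴺ : (ℕ → ℕ) → ℕ → ℕ
  ∑ᴺ f zero = f zero
  ∑ᴺ f (suc n) = ∑ᴺ f n + f (suc n)

  gather : ∀ {A : Set} → (ℕ → List A) → ℕ → List A
  gather f zero = f zero
  gather f (suc n) = gather f n ++ f (suc n)

  length-gather : ∀ {A : Set} (f : ℕ → List A) n → length (gather f n) ≡ ∑ᴺ (λ i → length (f i)) n
  length-gather f zero = refl
  length-gather f (suc n) = trans (Listₚ.length-++ (gather f n)) (cong (_+ length (f (suc n))) (length-gather f n))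

  ∈-gather : ∀ {A : Set} (f : ℕ → List A) {x} n i → i ≤ n → x ∈ f i → x ∈ gather f n
  ∈-gather f zero zero z≤n h = h
  ∈-gather f (suc n) i i≤n h with i ≟ suc n
  ... | yes refl = ∈-++⁺ʳ (gather f n) h
  ... | no i≢ = ∈-++⁺ˡ (∈-gather f n i (≤-pred (≤∧≢⇒< i≤n i≢)) h)

  ∑ᴺ-cong : ∀ {f g} → (∀ i → f i ≡ g i) → ∀ n → ∑ᴺ f n ≡ ∑ᴺ g n
  ∑ᴺ-cong h zero = h zero
  ∑ᴺ-cong h (suc n) = cong₂ _+_ (∑ᴺ-cong h n) (h (suc n))

  unique-length : ∀ {A : Set} {xs ys : List A} → AllPairs _≢_ xs → All (_∈ ys) xs → length xs ≤ length ys
  unique-length [] [] = z≤n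
  unique-length {xs = x ∷ xs} (x∉ ∷ u) (h ∷ hs) with ∈-∃++ h
  ... | ys₁ , ys₂ , refl = subst (suc (length xs) ≤_) (sym (↭-length p)) (s≤s (unique-length u (All.zipWith (λ (a , b) → other a b) (x∉ , hs))))
    where
    p = shift x ys₁ ys₂
    other : ∀ {y} → x ≢ y → y ∈ ys₁ ++ x ∷ ys₂ → y ∈ ys₁ ++ ys₂
    other x≢y y∈ with ∈-resp-↭ p y∈
    ... | here refl = contradiction refl x≢y
    ... | there h = h

  greatest : ∀ {P : ℕ → Set} → (∀ n → Dec (P n)) → P 0 → ∀ b → ∃ λ X → P X × X ≤ b × (∀ x → x ≤ b → P x → x ≤ X)
  greatest P? p₀ zero = 0 , p₀ , z≤n , λ x x≤0 _ → x≤0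
  greatest P? p₀ (suc b) with P? (suc b)
  ... | yes p = suc b , p , ≤-refl , λ x x≤ _ → x≤
  ... | no ¬p with greatest P? p₀ b
  ... | X , pX , X≤b , max = X , pX , m≤n⇒m≤1+n X≤b , λ x x≤ px → max x (≤-pred (≤∧≢⇒< x≤ (λ { refl → ¬p px }))) px

  -- Points of the octant 0 ≤ y ≤ x are sorted by the slot j with j / K ≤ y / x ≤ (j + 1) / K.
  module Slots (k : ℕ) where

    K : ℕ
    K = suc k

    -- A covering rather than an exact list: the admissible `y` fill an interval of length `x / K`,
    -- and `2 + x / K` consecutive integers from the floor of its lower end contain them all.
    line : ℕ → ℕ → List (ℕ × ℕ)
    line j x = gather (λ i → (x , (j * x) / K + i) ∷ []) (suc (x / K))

    ∑ᴺ-1 : ∀ n → ∑ᴺ (λ _ → 1) n ≡ suc n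
    ∑ᴺ-1 zero = refl
    ∑ᴺ-1 (suc n) = trans (cong (_+ 1) (∑ᴺ-1 n)) (+-comm (suc n) 1)

    length-line : ∀ j x → length (line j x) ≡ 2 + x / K
    length-line j x = trans (length-gather (λ i → (x , (j * x) / K + i) ∷ []) (suc (x / K))) (∑ᴺ-1 (suc (x / K)))

    below-next : ∀ a → a < K * suc (a / K)
    below-next a = subst (a <_) (*-comm (suc (a / K)) K)
      (subst (_< K + a / K * K) (sym (m≡m%n+[m/n]*n a K)) (+-monoˡ-< (a / K * K) (m%n<n a K)))

    ∈-line : ∀ j x y → j * x ≤ K * y → K * y ≤ j * x + x → (x , y) ∈ line j x
    ∈-line j x y lo hi = subst (λ t → (x , t) ∈ line j x) (m+[n∸m]≡n q≤y)
      (∈-gather (λ i → (x , q + i) ∷ []) (suc (x / K)) (y ∸ q) (m≤n+o⇒m∸n≤o y q y≤) (here refl))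
      where
      q = (j * x) / K
      q≤y : q ≤ y
      q≤y = *-cancelˡ-≤ K (≤-trans (subst (_≤ j * x) (*-comm q K) (m/n*n≤m (j * x) K)) lo)
      y≤ : y ≤ q + suc (x / K)
      y≤ = ≤-pred (*-cancelˡ-< K y (suc (q + suc (x / K))) (≤-<-trans hi
        (subst (j * x + x <_) (trans (sym (*-distribˡ-+ K (suc q) (suc (x / K)))) refl) (+-mono-< (below-next (j * x)) (below-next x)))))

    -- For positive `x` the slot is the integer part of `K y / x`; the diagonal `y = x` needs the
    -- extra slot `j = K`.
    slot : ∀ x y → y ≤ x → ∃ λ j → j ≤ K × j * x ≤ K * y × K * y ≤ j * x + x
    slot zero .0 z≤n = 0 , z≤n , z≤n , ≤-reflexive (*-zeroʳ K)
    slot (suc x) y y≤x = K * y / suc x , *-cancelʳ-≤ (K * y / suc x) K (suc x) (≤-trans (m/n*n≤m (K * y) (suc x)) (*-monoʳ-≤ K y≤x)) ,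
      m/n*n≤m (K * y) (suc x) ,
      <⇒≤ (subst (_< K * y / suc x * suc x + suc x) (sym (m≡m%n+[m/n]*n (K * y) (suc x)))
        (subst (_< K * y / suc x * suc x + suc x) (+-comm (K * y / suc x * suc x) _) (+-monoʳ-< (K * y / suc x * suc x) (m%n<n (K * y) (suc x)))))

    module _ (b D : ℕ) (b-bound : ∀ x → 9 * (x * x) ≤ D → x ≤ b) where

      -- The disc condition `9 (x² + y²) ≤ D` weakened by `y ≥ j x / K`. It bounds `x` alone, so the
      -- sector is enclosed in a triangle.
      Fits : ℕ → ℕ → Set
      Fits j x = 9 * (x * x) * (K * K + j * j) ≤ K * K * D

      fit : ∀ j → ∃ λ X → Fits j X × X ≤ b × (∀ x → x ≤ b → Fits j x → x ≤ X)
      fit j = greatest (λ x → 9 * (x * x) * (K * K + j * j) ≤? K * K * D) z≤n b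

      X : ℕ → ℕ
      X j = proj₁ (fit j)

      wedge : ℕ → List (ℕ × ℕ)
      wedge j = gather (line j) (X j)

      octant : List (ℕ × ℕ)
      octant = gather wedge K

      ∈-octant : ∀ x y → y ≤ x → 9 * (x * x + y * y) ≤ D → (x , y) ∈ octant
      ∈-octant x y y≤x h with slot x y y≤x
      ... | j , j≤K , lo , hi = ∈-gather wedge K j j≤K (∈-gather (line j) (X j) x (proj₂ (proj₂ (proj₂ (fit j))) x x≤b fits) (∈-line j x y lo hi))
        where
        x≤b = b-bound x (≤-trans (*-monoʳ-≤ 9 (m≤m+n (x * x) (y * y))) h)
        fits : Fits j x
        fits = begin
          9 * (x * x) * (K * K + j * j)             ≡⟨ l₁ x K j ⟩
          9 * (K * K * (x * x) + (j * x) * (j * x)) ≤⟨ *-monoʳ-≤ 9 (+-monoʳ-≤ (K * K * (x * x)) (*-mono-≤ lo lo)) ⟩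
          9 * (K * K * (x * x) + K * y * (K * y))   ≡⟨ l₂ x K y ⟩
          K * K * (9 * (x * x + y * y))             ≤⟨ *-monoʳ-≤ (K * K) h ⟩
          K * K * D ∎
          where
          open ≤-Reasoning
          l₁ : ∀ x K j → 9 * (x * x) * (K * K + j * j) ≡ 9 * (K * K * (x * x) + (j * x) * (j * x))
          l₁ = solve-∀
          l₂ : ∀ x K y → 9 * (K * K * (x * x) + K * y * (K * y)) ≡ K * K * (9 * (x * x + y * y))
          l₂ = solve-∀

      -- The main term is the area `X² / (2 K)` of the triangle; the term linear in `b` pays for
      -- rounding and boundary.
      length-wedge : ∀ j → 2 * K * length (wedge j) ≤ X j * X j + (7 + 8 * K) * (b + 1)
      length-wedge j = ≤-trans (subst (λ t → 2 * K * t ≤ X j * X j + X j + 4 * K * suc (X j)) (sym (trans (length-gather (line j) (X j)) (∑ᴺ-cong (length-line j) (X j)))) (triangle (X j)))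
          (subst (_≤ X j * X j + (7 + 8 * K) * (b + 1)) (sym (+-assoc (X j * X j) (X j) _)) (+-monoʳ-≤ (X j * X j) (begin
            X j + 4 * K * suc (X j) ≤⟨ +-mono-≤ X≤ (*-monoʳ-≤ (4 * K) (subst (suc (X j) ≤_) (+-comm 1 b) (s≤s (proj₁ (proj₂ (proj₂ (fit j))))))) ⟩
            b + 1 + 4 * K * (b + 1) ≤⟨ m≤m+n _ (6 * (b + 1) + 4 * K * (b + 1)) ⟩
            b + 1 + 4 * K * (b + 1) + (6 * (b + 1) + 4 * K * (b + 1)) ≡⟨ l b K ⟩
            (7 + 8 * K) * (b + 1) ∎)))
        where
        open ≤-Reasoning
        X≤ : X j ≤ b + 1
        X≤ = ≤-trans (proj₁ (proj₂ (proj₂ (fit j)))) (m≤m+n b 1)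
        l : ∀ b K → b + 1 + 4 * K * (b + 1) + (6 * (b + 1) + 4 * K * (b + 1)) ≡ (7 + 8 * K) * (b + 1)
        l = solve-∀
        triangle : ∀ n → 2 * K * ∑ᴺ (λ x → 2 + x / K) n ≤ n * n + n + 4 * K * suc n
        triangle zero = ≤-reflexive (l₀ K)
          where
          l₀ : ∀ K → 2 * K * 2 ≡ 4 * K * 1
          l₀ = solve-∀
        triangle (suc n) = begin
          2 * K * (∑ᴺ (λ x → 2 + x / K) n + (2 + suc n / K)) ≡⟨ l₁ K (∑ᴺ (λ x → 2 + x / K) n) (suc n / K) ⟩
          2 * K * ∑ᴺ (λ x → 2 + x / K) n + 4 * K + 2 * (suc n / K * K) ≤⟨ +-mono-≤ (+-monoˡ-≤ (4 * K) (triangle n)) (*-monoʳ-≤ 2 (m/n*n≤m (suc n) K)) ⟩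
          n * n + n + 4 * K * suc n + 4 * K + 2 * suc n ≡⟨ l₂ n K ⟩
          suc n * suc n + suc n + 4 * K * suc (suc n) ∎
          where
          l₁ : ∀ K s d → 2 * K * (s + (2 + d)) ≡ 2 * K * s + 4 * K + 2 * (d * K)
          l₁ = solve-∀
          l₂ : ∀ n K → n * n + n + 4 * K * suc n + 4 * K + 2 * suc n ≡ suc n * suc n + suc n + 4 * K * suc (suc n)
          l₂ = solve-∀

  Triple : Set
  Triple = ℕ × ℕ × ℕ

  ± : ℕ → List ℤ
  ± n = + n ∷ ℤ.- + n ∷ []

  swaps : ℤ → ℤ → ℤ → List ℤ³
  swaps c b a = (a , b , c) ∷ (b , a , c) ∷ []

  -- Eight sign patterns and the swap of the first two coordinates give the factor 16; repetitions
  -- do no harm to an upper bound.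
  symmetric : Triple → List ℤ³
  symmetric (x , y , z) = concatMap (λ c → concatMap (λ b → concatMap (swaps c b) (± x)) (± y)) (± z)

  ∈-± : ∀ a → a ∈ ± ∣ a ∣
  ∈-± (+ n) = here refl
  ∈-± ℤ.-[1+ n ] = there (here refl)

  ∈-symmetric : ∀ a b c {p} → p ∈ swaps c b a → p ∈ symmetric (∣ a ∣ , ∣ b ∣ , ∣ c ∣)
  ∈-symmetric a b c h = ∈-concatMap⁺ (λ c → concatMap (λ b → concatMap (swaps c b) (± ∣ a ∣)) (± ∣ b ∣)) (lose (∈-± c)
    (∈-concatMap⁺ (λ b → concatMap (swaps c b) (± ∣ a ∣)) (lose (∈-± b) (∈-concatMap⁺ (swaps c b) (lose (∈-± a) h)))))

  length-symmetric : ∀ L → length (concatMap symmetric L) ≡ 16 * length L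
  length-symmetric [] = refl
  length-symmetric (t ∷ L) = trans (cong (λ t → 16 + t) (length-symmetric L)) (sym (*-suc 16 (length L)))

  -- A list containing all lattice points of norm at most `7 m / 3`.

  module Points (k m : ℕ) where
    open Slots k

    -- Nine times the squared radius of the section at height `z`, as long as that section is not
    -- empty.
    D : ℕ → ℕ
    D z = 49 * (m * m) ∸ 9 * (z * z)

    b-bound : ∀ z x → 9 * (x * x) ≤ D z → x ≤ 7 * m
    b-bound z x h = ≮⇒≥ λ 7m<x → <⇒≱ (begin-strict
        49 * (m * m)    ≡⟨ l m ⟩
        7 * m * (7 * m) <⟨ *-mono-< 7m<x 7m<x ⟩
        x * x           ≤⟨ m≤n*m (x * x) 9 ⟩
        9 * (x * x) ∎) (≤-trans h (m∸n≤m (49 * (m * m)) (9 * (z * z))))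
      where
      open ≤-Reasoning
      l : ∀ m → 49 * (m * m) ≡ 7 * m * (7 * m)
      l = solve-∀

    Z : ℕ
    Z = proj₁ (greatest (λ z → 3 * z ≤? 7 * m) z≤n (7 * m))

    3Z≤7m : 3 * Z ≤ 7 * m
    3Z≤7m = proj₁ (proj₂ (greatest (λ z → 3 * z ≤? 7 * m) z≤n (7 * m)))

    disc : ℕ → List (ℕ × ℕ)
    disc z = octant (7 * m) (D z) (b-bound z)

    slice : ℕ → List Triple
    slice z = map (λ (x , y) → x , y , z) (disc z)

    triples : List Triple
    triples = gather slice Z

    points : List ℤ³
    points = concatMap symmetric triples

    length-points : length points ≡ 16 * ∑ᴺ (λ z → ∑ᴺ (λ j → length (wedge (7 * m) (D z) (b-bound z) j)) K) Z
    length-points = trans (length-symmetric triples) (cong (16 *_) (trans (length-gather slice Z)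
      (∑ᴺ-cong (λ z → trans (Listₚ.length-map _ (disc z)) (length-gather (wedge (7 * m) (D z) (b-bound z)) K)) Z)))

    ∈-triples : ∀ x y z → y ≤ x → 9 * (x * x + y * y + z * z) ≤ 49 * (m * m) → (x , y , z) ∈ triples
    ∈-triples x y z y≤x h = ∈-gather slice Z z z≤Z (∈-map⁺ (λ (x , y) → x , y , z) (∈-octant (7 * m) (D z) (b-bound z) x y y≤x hD))
      where
      h′ : 9 * (x * x + y * y) + 9 * (z * z) ≤ 49 * (m * m)
      h′ = subst (_≤ 49 * (m * m)) (*-distribˡ-+ 9 (x * x + y * y) (z * z)) h
      hD : 9 * (x * x + y * y) ≤ D z
      hD = m+n≤o⇒m≤o∸n (9 * (x * x + y * y)) h′
      3z≤ : 3 * z ≤ 7 * m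
      3z≤ = ≮⇒≥ λ lt → <⇒≱ (begin-strict
          49 * (m * m)    ≡⟨ l m ⟩
          7 * m * (7 * m) <⟨ *-mono-< lt lt ⟩
          3 * z * (3 * z) ≡⟨ l′ z ⟩
          9 * (z * z) ∎) (≤-trans (m≤n+m (9 * (z * z)) (9 * (x * x + y * y))) h′)
        where
        open ≤-Reasoning
        l : ∀ m → 49 * (m * m) ≡ 7 * m * (7 * m)
        l = solve-∀
        l′ : ∀ z → 3 * z * (3 * z) ≡ 9 * (z * z)
        l′ = solve-∀
      z≤Z : z ≤ Z
      z≤Z = proj₂ (proj₂ (proj₂ (greatest (λ z → 3 * z ≤? 7 * m) z≤n (7 * m)))) z (≤-trans (m≤n*m z 3) 3z≤) 3z≤

    sq-∣∣ : ∀ a → a ℤ.* a ≡ + (∣ a ∣ * ∣ a ∣)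
    sq-∣∣ (+ n) = sym (ℤₚ.pos-* n n)
    sq-∣∣ ℤ.-[1+ n ] = refl

    ∈-points : ∀ a b c → + 9 ℤ.* (a ℤ.* a ℤ.+ b ℤ.* b ℤ.+ c ℤ.* c) ℤ.≤ + 49 ℤ.* (+ m ℤ.* + m) → (a , b , c) ∈ points
    ∈-points a b c h with ≤-total ∣ b ∣ ∣ a ∣
    ... | inj₁ b≤a = ∈-concatMap⁺ symmetric (lose (∈-triples (∣ a ∣) (∣ b ∣) (∣ c ∣) b≤a h′) (∈-symmetric a b c (here refl)))
      where
      h′ : 9 * (∣ a ∣ * ∣ a ∣ + ∣ b ∣ * ∣ b ∣ + ∣ c ∣ * ∣ c ∣) ≤ 49 * (m * m)
      h′ = ℤₚ.drop‿+≤+ (subst₂ ℤ._≤_ (trans (cong (+ 9 ℤ.*_) (cong₂ ℤ._+_ (cong₂ ℤ._+_ (sq-∣∣ a) (sq-∣∣ b)) (sq-∣∣ c))) (sym (ℤₚ.pos-* 9 (∣ a ∣ * ∣ a ∣ + ∣ b ∣ * ∣ b ∣ + ∣ c ∣ * ∣ c ∣))))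
        (trans (cong (+ 49 ℤ.*_) (sym (ℤₚ.pos-* m m))) (sym (ℤₚ.pos-* 49 (m * m)))) h)
    ... | inj₂ a≤b = ∈-concatMap⁺ symmetric (lose (∈-triples (∣ b ∣) (∣ a ∣) (∣ c ∣) a≤b h′) (∈-symmetric b a c (there (here refl))))
      where
      h′ : 9 * (∣ b ∣ * ∣ b ∣ + ∣ a ∣ * ∣ a ∣ + ∣ c ∣ * ∣ c ∣) ≤ 49 * (m * m)
      h′ = ℤₚ.drop‿+≤+ (subst₂ ℤ._≤_ (trans (cong (+ 9 ℤ.*_) (cong₂ ℤ._+_ (trans (cong₂ ℤ._+_ (sq-∣∣ a) (sq-∣∣ b)) (ℤₚ.+-comm (+ (∣ a ∣ * ∣ a ∣)) (+ (∣ b ∣ * ∣ b ∣)))) (sq-∣∣ c))) (sym (ℤₚ.pos-* 9 (∣ b ∣ * ∣ b ∣ + ∣ a ∣ * ∣ a ∣ + ∣ c ∣ * ∣ c ∣))))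
        (trans (cong (+ 49 ℤ.*_) (sym (ℤₚ.pos-* m m))) (sym (ℤₚ.pos-* 49 (m * m)))) h)

-- The size of the covering as a Riemann sum for the volume.

module PointCount where

  open import Data.Nat as ℕ using (ℕ; zero; suc)
  import Data.Nat.Properties as ℕₚ
  import Data.Nat.Tactic.RingSolver as ℕ-Solver
  open import Data.Integer as ℤ using (ℤ; +_)
  import Data.Integer.Properties as ℤₚ
  open import Data.Rational
  open import Data.Rational.Properties
  import Data.Rational.Unnormalised as ℚᵘ
  import Data.Rational.Unnormalised.Properties as ℚᵘₚ
  open import Data.Product using (_,_; ∃; proj₁; proj₂)
  open import Data.List using (length)
  open import Relation.Binary.PropositionalEquality
  open import Tactic.RingSolver using (solve-∀)
  open RationalBounds
  open LatticePoints

  ≤-numerator : ∀ p → p ≤ ℕ→ℚ ℤ.∣ ↥ p ∣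
  ≤-numerator p@(mkℚ n d _) = toℚᵘ-cancel-≤ (ℚᵘₚ.≤-respʳ-≃ (ℚᵘₚ.≃-sym (toℚᵘ-ℕ→ℚ ℤ.∣ n ∣)) (ℚᵘ.*≤* (go n)))
    where
    go : ∀ n → n ℤ.* + 1 ℤ.≤ + ℤ.∣ n ∣ ℤ.* + suc d
    go (+ a) = subst₂ ℤ._≤_ (sym (ℤₚ.*-identityʳ (+ a))) (ℤₚ.pos-* a (suc d)) (ℤ.+≤+ (ℕₚ.m≤m*n a (suc d)))
    go ℤ.-[1+ a ] = ℤ.-≤+

  1≤*denominator : ∀ p → 0ℚ < p → 1ℚ ≤ p * ℕ→ℚ (↧ₙ p)
  1≤*denominator p@(mkℚ n d _) 0<p = toℚᵘ-cancel-≤ (ℚᵘₚ.≤-respʳ-≃ (ℚᵘₚ.≃-sym (ℚᵘₚ.≃-trans (toℚᵘ-homo-* p (ℕ→ℚ (suc d))) (ℚᵘₚ.*-congˡ {toℚᵘ p} (toℚᵘ-ℕ→ℚ (suc d)))))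
      (ℚᵘ.*≤* (go n (ℤₚ.<-≤-trans (drop-*<* 0<p) (ℤₚ.≤-reflexive (ℤₚ.*-identityʳ n))))))
    where
    go : ∀ n → ℤ.0ℤ ℤ.< n → + 1 ℤ.* + (suc d ℕ.* 1) ℤ.≤ n ℤ.* + suc d ℤ.* + 1
    go (+ suc a) _ = subst₂ ℤ._≤_ (sym (trans (ℤₚ.*-identityˡ (+ (suc d ℕ.* 1))) (cong +_ (ℕₚ.*-identityʳ (suc d))))) (sym (ℤₚ.*-identityʳ (+ suc a ℤ.* + suc d)))
      (subst (+ suc d ℤ.≤_) (ℤₚ.pos-* (suc a) (suc d)) (ℤ.+≤+ (ℕₚ.m≤n*m (suc d) (suc a))))
    go (+ 0) (ℤ.+<+ ())

  archimedean : ∀ ε C → 0ℚ < ε → ∃ λ M → C ≤ ε * ℕ→ℚ M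
  archimedean ε C 0<ε = c ℕ.* ↧ₙ ε , ≤-trans (≤-numerator C) (0≤q-p⇒p≤q
      (trans (l ε (ℕ→ℚ c) (ℕ→ℚ (↧ₙ ε))) (cong (λ x → ε * x - ℕ→ℚ c) (sym (ℕ→ℚ-* c (↧ₙ ε)))))
      (0≤p*q (0≤ℕ→ℚ c) (p≤q⇒0≤q-p (1≤*denominator ε 0<ε))))
    where
    c = ℤ.∣ ↥ C ∣
    l : ∀ ε c d → c * (ε * d - 1ℚ) ≡ ε * (c * d) - c
    l = solve-∀ ℚ-ring

  ℕ→ℚ-∑ : ∀ f n → ℕ→ℚ (∑ᴺ f n) ≡ ∑≤ (λ i → ℕ→ℚ (f i)) n
  ℕ→ℚ-∑ f zero = refl
  ℕ→ℚ-∑ f (suc n) = trans (ℕ→ℚ-+ (∑ᴺ f n) (f (suc n))) (cong (_+ ℕ→ℚ (f (suc n))) (ℕ→ℚ-∑ f n))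

  module _ (k m : ℕ) (κ : ℚ) (0≤κ : 0ℚ ≤ κ) (Kκ≡1 : ℕ→ℚ (suc k) * κ ≡ 1ℚ) where
    open Slots k using (wedge; length-wedge; X; fit)
    open Points k m
    open Riemann k κ 0≤κ Kκ≡1

    E : ℕ
    E = (7 ℕ.+ 8 ℕ.* K) ℕ.* (7 ℕ.* m ℕ.+ 1)

    -- The triangle area `κ X² / 2` with `X² ≤ D / (9 (1 + t²))` becomes `D h / 18`, one term of the
    -- Riemann sum.
    wedge-bound : ∀ D hD j → ℕ→ℚ 18 * ℕ→ℚ (length (wedge (7 ℕ.* m) D hD j)) ≤ ℕ→ℚ D * h j + ℕ→ℚ 9 * κ * ℕ→ℚ E
    wedge-bound D hD j = combine (ℕ→ℚ (length (wedge b D hD j))) (ℕ→ℚ x) (ℕ→ℚ E) (ℕ→ℚ D) (h j) (ℕ→ℚ K) (ℕ→ℚ j) (0≤h j) t-K (h-spec j)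
        (subst₂ _≤_ (trans (ℕ→ℚ-* (2 ℕ.* K) (length (wedge b D hD j))) (cong (λ a → a * ℕ→ℚ (length (wedge b D hD j))) (ℕ→ℚ-* 2 K)))
          (trans (ℕ→ℚ-+ (x ℕ.* x) E) (cong (λ a → a + ℕ→ℚ E) (ℕ→ℚ-* x x))) (ℕ→ℚ-mono (length-wedge b D hD j)))
        (subst₂ _≤_ (trans (ℕ→ℚ-* (9 ℕ.* (x ℕ.* x)) (K ℕ.* K ℕ.+ j ℕ.* j)) (cong₂ _*_ (trans (ℕ→ℚ-* 9 (x ℕ.* x)) (cong (ℕ→ℚ 9 *_) (ℕ→ℚ-* x x)))
              (trans (ℕ→ℚ-+ (K ℕ.* K) (j ℕ.* j)) (cong₂ _+_ (ℕ→ℚ-* K K) (ℕ→ℚ-* j j)))))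
          (trans (ℕ→ℚ-* (K ℕ.* K) D) (cong (_* ℕ→ℚ D) (ℕ→ℚ-* K K))) (ℕ→ℚ-mono (proj₁ (proj₂ (fit b D hD j)))))
      where
      b = 7 ℕ.* m
      x = X b D hD j
      combine : ∀ L X E D h K j → 0ℚ ≤ h → K * κ ≡ 1ℚ → h * (1ℚ + j * κ * (j * κ)) ≡ κ →
        ℕ→ℚ 2 * K * L ≤ X * X + E → ℕ→ℚ 9 * (X * X) * (K * K + j * j) ≤ K * K * D → ℕ→ℚ 18 * L ≤ D * h + ℕ→ℚ 9 * κ * E
      combine L X E D h K j 0≤h Kκ hs h₁ h₂ = 0≤q-p⇒p≤q
          (trans (l₁ L X E D h K j κ) (trans (cong (λ a → ℕ→ℚ 9 * κ * (X * X) + ℕ→ℚ 9 * κ * E - ℕ→ℚ 18 * a * L + h * D * a * a - ℕ→ℚ 9 * (X * X) * (h * (a * a + j * κ * (j * κ)))) Kκ)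
            (trans (cong (λ a → ℕ→ℚ 9 * κ * (X * X) + ℕ→ℚ 9 * κ * E - ℕ→ℚ 18 * 1ℚ * L + h * D * 1ℚ * 1ℚ - ℕ→ℚ 9 * (X * X) * a) hs) (l₂ L X E D h κ))))
          (0≤p+q (0≤p*q (0≤p*q (0≤ℕ→ℚ 9) 0≤κ) (p≤q⇒0≤q-p h₁)) (0≤p*q (0≤p*q 0≤h (0≤p*q 0≤κ 0≤κ)) (p≤q⇒0≤q-p h₂)))
        where
        l₁ : ∀ L X E D h K j κ → ℕ→ℚ 9 * κ * (X * X + E - ℕ→ℚ 2 * K * L) + h * (κ * κ) * (K * K * D - ℕ→ℚ 9 * (X * X) * (K * K + j * j))
          ≡ ℕ→ℚ 9 * κ * (X * X) + ℕ→ℚ 9 * κ * E - ℕ→ℚ 18 * (K * κ) * L + h * D * (K * κ) * (K * κ) - ℕ→ℚ 9 * (X * X) * (h * (K * κ * (K * κ) + j * κ * (j * κ)))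
        l₁ = solve-∀ ℚ-ring
        l₂ : ∀ L X E D h κ → ℕ→ℚ 9 * κ * (X * X) + ℕ→ℚ 9 * κ * E - ℕ→ℚ 18 * 1ℚ * L + h * D * 1ℚ * 1ℚ - ℕ→ℚ 9 * (X * X) * κ
          ≡ D * h + ℕ→ℚ 9 * κ * E - ℕ→ℚ 18 * L
        l₂ = solve-∀ ℚ-ring

    ∑≤-mono-scaled : ∀ c {f g} n → (∀ j → c * f j ≤ g j) → c * ∑≤ f n ≤ ∑≤ g n
    ∑≤-mono-scaled c zero h = h 0
    ∑≤-mono-scaled c {f} {g} (suc n) h = subst (_≤ ∑≤ g n + g (suc n)) (sym (*-distribˡ-+ c (∑≤ f n) (f (suc n)))) (+-mono-≤ (∑≤-mono-scaled c n h) (h (suc n)))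

    ∑≤-affine-const : ∀ a b f n → ∑≤ (λ j → a * f j + b) n ≡ a * ∑≤ f n + ℕ→ℚ (suc n) * b
    ∑≤-affine-const a b f zero = cong (_+_ (a * f 0)) (sym (*-identityˡ b))
    ∑≤-affine-const a b f (suc n) = trans (cong (_+ (a * f (suc n) + b)) (∑≤-affine-const a b f n))
        (trans (l a b (∑≤ f n) (f (suc n)) (ℕ→ℚ (suc n))) (cong (λ c → a * (∑≤ f n + f (suc n)) + c * b) (sym (ℕ→ℚ-suc (suc n)))))
      where
      l : ∀ a b p r c → a * p + c * b + (a * r + b) ≡ a * (p + r) + (1ℚ + c) * b
      l = solve-∀ ℚ-ring

    -- The sum of `9 z²` dominates its integral `3 n³`, with a surplus of `9 n + 6` in each step.
    -- The hypothesis makes the truncated subtraction in `D` exact.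
    ∑D-≤ : ∀ n → 3 ℕ.* n ℕ.≤ 7 ℕ.* m → ∑ᴺ D n ℕ.+ 3 ℕ.* (n ℕ.* n ℕ.* n) ℕ.≤ 49 ℕ.* (m ℕ.* m) ℕ.* suc n
    ∑D-≤ zero _ = ℕₚ.≤-reflexive (l m)
      where
      l : ∀ m → 49 ℕ.* (m ℕ.* m) ℕ.+ 0 ≡ 49 ℕ.* (m ℕ.* m) ℕ.* 1
      l = ℕ-Solver.solve-∀
    ∑D-≤ (suc n) h = begin
      ∑ᴺ D n ℕ.+ D (suc n) ℕ.+ 3 ℕ.* (suc n ℕ.* suc n ℕ.* suc n) ≤⟨ ℕₚ.m≤m+n _ (9 ℕ.* n ℕ.+ 6) ⟩
      ∑ᴺ D n ℕ.+ D (suc n) ℕ.+ 3 ℕ.* (suc n ℕ.* suc n ℕ.* suc n) ℕ.+ (9 ℕ.* n ℕ.+ 6) ≡⟨ l n (∑ᴺ D n) (D (suc n)) ⟩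
      ∑ᴺ D n ℕ.+ 3 ℕ.* (n ℕ.* n ℕ.* n) ℕ.+ (D (suc n) ℕ.+ 9 ℕ.* (suc n ℕ.* suc n)) ≡⟨ cong (λ a → ∑ᴺ D n ℕ.+ 3 ℕ.* (n ℕ.* n ℕ.* n) ℕ.+ a) (ℕₚ.m∸n+n≡m inside) ⟩
      ∑ᴺ D n ℕ.+ 3 ℕ.* (n ℕ.* n ℕ.* n) ℕ.+ 49 ℕ.* (m ℕ.* m) ≤⟨ ℕₚ.+-monoˡ-≤ (49 ℕ.* (m ℕ.* m)) (∑D-≤ n (ℕₚ.≤-trans (ℕₚ.*-monoʳ-≤ 3 (ℕₚ.n≤1+n n)) h)) ⟩
      49 ℕ.* (m ℕ.* m) ℕ.* suc n ℕ.+ 49 ℕ.* (m ℕ.* m) ≡⟨ l′ m n ⟩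
      49 ℕ.* (m ℕ.* m) ℕ.* suc (suc n) ∎
      where
      open ℕₚ.≤-Reasoning
      l : ∀ n s d → s ℕ.+ d ℕ.+ 3 ℕ.* (suc n ℕ.* suc n ℕ.* suc n) ℕ.+ (9 ℕ.* n ℕ.+ 6) ≡ s ℕ.+ 3 ℕ.* (n ℕ.* n ℕ.* n) ℕ.+ (d ℕ.+ 9 ℕ.* (suc n ℕ.* suc n))
      l = ℕ-Solver.solve-∀
      l′ : ∀ m n → 49 ℕ.* (m ℕ.* m) ℕ.* suc n ℕ.+ 49 ℕ.* (m ℕ.* m) ≡ 49 ℕ.* (m ℕ.* m) ℕ.* suc (suc n)
      l′ = ℕ-Solver.solve-∀
      inside : 9 ℕ.* (suc n ℕ.* suc n) ℕ.≤ 49 ℕ.* (m ℕ.* m)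
      inside = subst₂ ℕ._≤_ (l₁ (suc n)) (l₂ m) (ℕₚ.*-mono-≤ h h)
        where
        l₁ : ∀ n → 3 ℕ.* n ℕ.* (3 ℕ.* n) ≡ 9 ℕ.* (n ℕ.* n)
        l₁ = ℕ-Solver.solve-∀
        l₂ : ∀ m → 7 ℕ.* m ℕ.* (7 ℕ.* m) ≡ 49 ℕ.* (m ℕ.* m)
        l₂ = ℕ-Solver.solve-∀

    -- On `0 ≤ u ≤ r` the value `3 r² u - u³` is largest at `u = r`. With `u = 3 Z` and `r = 7 m`
    -- this avoids any analysis of the rounding in `Z`.
    tangent : ∀ u r → u ℕ.≤ r → 3 ℕ.* (r ℕ.* r ℕ.* u) ℕ.≤ 2 ℕ.* (r ℕ.* r ℕ.* r) ℕ.+ u ℕ.* u ℕ.* u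
    tangent u r u≤r = subst (λ r → 3 ℕ.* (r ℕ.* r ℕ.* u) ℕ.≤ 2 ℕ.* (r ℕ.* r ℕ.* r) ℕ.+ u ℕ.* u ℕ.* u) (ℕₚ.m+[n∸m]≡n u≤r)
        (ℕₚ.≤-trans (ℕₚ.m≤m+n _ _) (ℕₚ.≤-reflexive (l u (r ℕ.∸ u))))
      where
      l : ∀ u d → 3 ℕ.* ((u ℕ.+ d) ℕ.* (u ℕ.+ d) ℕ.* u) ℕ.+ (3 ℕ.* (u ℕ.* d ℕ.* d) ℕ.+ 2 ℕ.* (d ℕ.* d ℕ.* d))
        ≡ 2 ℕ.* ((u ℕ.+ d) ℕ.* (u ℕ.+ d) ℕ.* (u ℕ.+ d)) ℕ.+ u ℕ.* u ℕ.* u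
      l = ℕ-Solver.solve-∀

    -- The integral of `49 m² - 9 z²` over `0 ≤ z ≤ 7 m / 3` is `686 m³ / 9`.
    9∑D-≤ : 9 ℕ.* ∑ᴺ D Z ℕ.≤ 686 ℕ.* (m ℕ.* m ℕ.* m) ℕ.+ 441 ℕ.* (m ℕ.* m)
    9∑D-≤ = ℕₚ.+-cancelʳ-≤ (27 ℕ.* (Z ℕ.* Z ℕ.* Z)) _ _ (begin
      9 ℕ.* ∑ᴺ D Z ℕ.+ 27 ℕ.* (Z ℕ.* Z ℕ.* Z) ≡⟨ l₁ (∑ᴺ D Z) Z ⟩
      9 ℕ.* (∑ᴺ D Z ℕ.+ 3 ℕ.* (Z ℕ.* Z ℕ.* Z)) ≤⟨ ℕₚ.*-monoʳ-≤ 9 (∑D-≤ Z 3Z≤7m) ⟩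
      9 ℕ.* (49 ℕ.* (m ℕ.* m) ℕ.* suc Z) ≡⟨ l₂ m Z ⟩
      3 ℕ.* (7 ℕ.* m ℕ.* (7 ℕ.* m) ℕ.* (3 ℕ.* Z)) ℕ.+ 441 ℕ.* (m ℕ.* m) ≤⟨ ℕₚ.+-monoˡ-≤ (441 ℕ.* (m ℕ.* m)) (tangent (3 ℕ.* Z) (7 ℕ.* m) 3Z≤7m) ⟩
      2 ℕ.* (7 ℕ.* m ℕ.* (7 ℕ.* m) ℕ.* (7 ℕ.* m)) ℕ.+ 3 ℕ.* Z ℕ.* (3 ℕ.* Z) ℕ.* (3 ℕ.* Z) ℕ.+ 441 ℕ.* (m ℕ.* m) ≡⟨ l₃ m Z ⟩
      686 ℕ.* (m ℕ.* m ℕ.* m) ℕ.+ 441 ℕ.* (m ℕ.* m) ℕ.+ 27 ℕ.* (Z ℕ.* Z ℕ.* Z) ∎)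
      where
      open ℕₚ.≤-Reasoning
      l₁ : ∀ s Z → 9 ℕ.* s ℕ.+ 27 ℕ.* (Z ℕ.* Z ℕ.* Z) ≡ 9 ℕ.* (s ℕ.+ 3 ℕ.* (Z ℕ.* Z ℕ.* Z))
      l₁ = ℕ-Solver.solve-∀
      l₂ : ∀ m Z → 9 ℕ.* (49 ℕ.* (m ℕ.* m) ℕ.* suc Z) ≡ 3 ℕ.* (7 ℕ.* m ℕ.* (7 ℕ.* m) ℕ.* (3 ℕ.* Z)) ℕ.+ 441 ℕ.* (m ℕ.* m)
      l₂ = ℕ-Solver.solve-∀
      l₃ : ∀ m Z → 2 ℕ.* (7 ℕ.* m ℕ.* (7 ℕ.* m) ℕ.* (7 ℕ.* m)) ℕ.+ 3 ℕ.* Z ℕ.* (3 ℕ.* Z) ℕ.* (3 ℕ.* Z) ℕ.+ 441 ℕ.* (m ℕ.* m)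
        ≡ 686 ℕ.* (m ℕ.* m ℕ.* m) ℕ.+ 441 ℕ.* (m ℕ.* m) ℕ.+ 27 ℕ.* (Z ℕ.* Z ℕ.* Z)
      l₃ = ℕ-Solver.solve-∀

    wedges : ℕ → ℕ → ℕ
    wedges z j = length (wedge (7 ℕ.* m) (D z) (b-bound z) j)

    slice-bound : ∀ z → ℕ→ℚ 18 * ∑≤ (λ j → ℕ→ℚ (wedges z j)) K ≤ ∑≤ h K * ℕ→ℚ (D z) + ℕ→ℚ (suc K) * (ℕ→ℚ 9 * κ * ℕ→ℚ E)
    slice-bound z = ≤-trans (∑≤-mono-scaled (ℕ→ℚ 18) K (wedge-bound (D z) (b-bound z)))
        (≤-reflexive (trans (∑≤-affine-const (ℕ→ℚ (D z)) (ℕ→ℚ 9 * κ * ℕ→ℚ E) h K) (cong (λ a → a + ℕ→ℚ (suc K) * (ℕ→ℚ 9 * κ * ℕ→ℚ E)) (*-comm (ℕ→ℚ (D z)) (∑≤ h K)))))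

    total : ℚ
    total = ∑≤ (λ z → ∑≤ (λ j → ℕ→ℚ (wedges z j)) K) Z

    length-points-ℚ : ℕ→ℚ (length points) ≡ ℕ→ℚ 16 * total
    length-points-ℚ = trans (cong ℕ→ℚ length-points) (trans (ℕ→ℚ-* 16 (∑ᴺ (λ z → ∑ᴺ (wedges z) K) Z))
        (cong (ℕ→ℚ 16 *_) (trans (ℕ→ℚ-∑ (λ z → ∑ᴺ (wedges z) K) Z) (∑≤-cong (λ z → ℕ→ℚ-∑ (wedges z) K) Z))))

    total-bound : ℕ→ℚ 18 * total ≤ ∑≤ h K * ℕ→ℚ (∑ᴺ D Z) + ℕ→ℚ (suc Z) * (ℕ→ℚ (suc K) * (ℕ→ℚ 9 * κ * ℕ→ℚ E))
    total-bound = ≤-trans (∑≤-mono-scaled (ℕ→ℚ 18) Z slice-bound)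
        (≤-reflexive (trans (∑≤-affine-const (∑≤ h K) _ (λ z → ℕ→ℚ (D z)) Z)
          (cong (λ a → ∑≤ h K * a + ℕ→ℚ (suc Z) * (ℕ→ℚ (suc K) * (ℕ→ℚ 9 * κ * ℕ→ℚ E))) (sym (ℕ→ℚ-∑ D Z)))))

    error : ℕ
    error = suc K ℕ.* ((7 ℕ.+ 8 ℕ.* K) ℕ.* 64)

    error-≤ : 1 ℕ.≤ m → suc Z ℕ.* (suc K ℕ.* E) ℕ.≤ error ℕ.* (m ℕ.* m)
    error-≤ 1≤m = ℕₚ.≤-trans (ℕₚ.*-mono-≤ Z<8m (ℕₚ.*-monoʳ-≤ (suc K) (ℕₚ.*-monoʳ-≤ (7 ℕ.+ 8 ℕ.* K) (ℕₚ.+-monoʳ-≤ (7 ℕ.* m) 1≤m))))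
        (ℕₚ.≤-reflexive (l m K))
      where
      Z<8m : suc Z ℕ.≤ 8 ℕ.* m
      Z<8m = ℕₚ.+-mono-≤ 1≤m (ℕₚ.≤-trans (ℕₚ.m≤n*m Z 3) 3Z≤7m)
      l : ∀ m K → 8 ℕ.* m ℕ.* (suc K ℕ.* ((7 ℕ.+ 8 ℕ.* K) ℕ.* (7 ℕ.* m ℕ.+ m))) ≡ suc K ℕ.* ((7 ℕ.+ 8 ℕ.* K) ℕ.* 64) ℕ.* (m ℕ.* m)
      l = ℕ-Solver.solve-∀

    -- Here `81 · 16 = 72 · 18` and `72 = 8 · 9`, whence `8 · 686 = 5488`. Since `∑≤ h K` approaches
    -- `π / 4` as the grid is refined, `5488 / 81` turns into `1372 π / 81`.
    points-bound : 1 ℕ.≤ m → ℕ→ℚ 81 * ℕ→ℚ (length points) ≤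
      ∑≤ h K * (ℕ→ℚ 5488 * cube m + ℕ→ℚ 3528 * ℕ→ℚ (m ℕ.* m)) + ℕ→ℚ 648 * κ * (ℕ→ℚ error * ℕ→ℚ (m ℕ.* m))
    points-bound 1≤m = combine (∑≤ h K) total (ℕ→ℚ (∑ᴺ D Z)) (cube m) (ℕ→ℚ (m ℕ.* m)) (ℕ→ℚ (suc Z)) (ℕ→ℚ (suc K)) (ℕ→ℚ E) (ℕ→ℚ error) (ℕ→ℚ (length points))
        0≤H length-points-ℚ total-bound
        (subst₂ _≤_ (ℕ→ℚ-* 9 (∑ᴺ D Z)) (trans (ℕ→ℚ-+ (686 ℕ.* (m ℕ.* m ℕ.* m)) (441 ℕ.* (m ℕ.* m))) (cong₂ _+_ (ℕ→ℚ-* 686 (m ℕ.* m ℕ.* m)) (ℕ→ℚ-* 441 (m ℕ.* m)))) (ℕ→ℚ-mono 9∑D-≤))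
        (subst₂ _≤_ (trans (ℕ→ℚ-* (suc Z) (suc K ℕ.* E)) (cong (λ a → ℕ→ℚ (suc Z) * a) (ℕ→ℚ-* (suc K) E))) (ℕ→ℚ-* error (m ℕ.* m)) (ℕ→ℚ-mono (error-≤ 1≤m)))
      where
      ∑≤-nonneg : ∀ n → 0ℚ ≤ ∑≤ h n
      ∑≤-nonneg zero = 0≤h 0
      ∑≤-nonneg (suc n) = 0≤p+q (∑≤-nonneg n) (0≤h (suc n))
      0≤H = ∑≤-nonneg K
      combine : ∀ H t D c s Z K E e p → 0ℚ ≤ H → p ≡ ℕ→ℚ 16 * t → ℕ→ℚ 18 * t ≤ H * D + Z * (K * (ℕ→ℚ 9 * κ * E)) →
        ℕ→ℚ 9 * D ≤ ℕ→ℚ 686 * c + ℕ→ℚ 441 * s → Z * (K * E) ≤ e * s →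
        ℕ→ℚ 81 * p ≤ H * (ℕ→ℚ 5488 * c + ℕ→ℚ 3528 * s) + ℕ→ℚ 648 * κ * (e * s)
      combine H t D c s Z K E e .(ℕ→ℚ 16 * t) 0≤H refl h₁ h₂ h₃ = 0≤q-p⇒p≤q (l H t D c s Z K E e κ)
          (0≤p+q (0≤p+q (0≤p*q (0≤ℕ→ℚ 72) (p≤q⇒0≤q-p h₁)) (0≤p*q (0≤p*q (0≤ℕ→ℚ 8) 0≤H) (p≤q⇒0≤q-p h₂))) (0≤p*q (0≤p*q (0≤ℕ→ℚ 648) 0≤κ) (p≤q⇒0≤q-p h₃)))
        where
        l : ∀ H t D c s Z K E e κ → ℕ→ℚ 72 * (H * D + Z * (K * (ℕ→ℚ 9 * κ * E)) - ℕ→ℚ 18 * t) + ℕ→ℚ 8 * H * (ℕ→ℚ 686 * c + ℕ→ℚ 441 * s - ℕ→ℚ 9 * D)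
          + ℕ→ℚ 648 * κ * (e * s - Z * (K * E)) ≡ H * (ℕ→ℚ 5488 * c + ℕ→ℚ 3528 * s) + ℕ→ℚ 648 * κ * (e * s) - ℕ→ℚ 81 * (ℕ→ℚ 16 * t)
        l = solve-∀ ℚ-ring

-- The upper bound.

module UpperBound where

  open import Data.Nat as ℕ using (ℕ; suc)
  import Data.Nat.Properties as ℕₚ
  open import Data.Integer as ℤ using (ℤ; +_)
  import Data.Integer.Properties as ℤₚ
  open import Data.Rational
  open import Data.Rational.Properties
  open import Data.Product using (_×_; _,_; ∃; ∃₂; proj₁; proj₂)
  open import Data.List using (List; []; _∷_; _++_; length)
  import Data.List.Properties as Listₚ
  open import Data.List.Relation.Unary.All as All using (All; []; _∷_)
  open import Data.List.Relation.Unary.Any using (here; there)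
  open import Data.List.Relation.Unary.AllPairs using (AllPairs; []; _∷_)
  open import Data.List.Membership.Propositional using (_∈_)
  open import Data.List.Relation.Binary.Sublist.Propositional using (_⊆_; []; _∷ʳ_; _∷_; ⊆-refl)
  open import Data.List.Relation.Binary.Sublist.Propositional.Properties using (++⁺ʳ)
  open import Data.List.Relation.Binary.Permutation.Propositional as Perm using (_↭_)
  open import Data.List.Relation.Binary.Permutation.Propositional.Properties using (↭-length)
  open import Relation.Binary.PropositionalEquality
  open import Tactic.RingSolver using (solve-∀)
  import Data.Integer.Tactic.RingSolver as ℤ-Solver
  open RationalBounds
  open LatticePoints using (module Points; unique-length)
  open PointCount
  open SteinitzLemma using (≡³; sum³-↭; module Steinitz)

  -- The margin in `4 L < 81 q / 1372`, multiplied by 1372.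
  excess : ℚ → ℚ → ℚ
  excess q L = ℕ→ℚ 81 * q - ℕ→ℚ 5488 * L

  0<excess : ∀ q L → ((+ 4) / 1) * L < ((+ 81) / 1372) * q → 0ℚ < excess q L
  0<excess q L h = subst₂ _<_ (*-zeroʳ (ℕ→ℚ 1372)) (l q L)
      (*-monoʳ-<-pos (ℕ→ℚ 1372) (subst (_< ((+ 81) / 1372) * q - ((+ 4) / 1) * L) (+-inverseʳ (((+ 4) / 1) * L)) (+-monoˡ-< (- (((+ 4) / 1) * L)) h)))
    where
    l : ∀ q L → ℕ→ℚ 1372 * (((+ 81) / 1372) * q - ((+ 4) / 1) * L) ≡ ℕ→ℚ 81 * q - ℕ→ℚ 5488 * L
    l = solve-∀ ℚ-ring

  module _ (q : ℚ) (n k : ℕ) (κ : ℚ) (0≤κ : 0ℚ ≤ κ) (Kκ≡1 : ℕ→ℚ (suc k) * κ ≡ 1ℚ)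
    (fine : ℕ→ℚ 10976 * ℕ→ℚ (suc n) * κ ≤ excess q (leib n)) where
    open Riemann k κ 0≤κ Kκ≡1 using (h; ∑h-≤)

    grid-error : ℕ
    grid-error = suc (suc k) ℕ.* ((7 ℕ.+ 8 ℕ.* suc k) ℕ.* 64)

    -- The margin is split in two, `10976` being `2 · 5488`: one half pays for the grid error
    -- `n * κ`, the other half, times `m`, for all terms of order `m²`.
    finish : ∀ H L c s m e n p → c ≡ s * m → 0ℚ ≤ s → 0ℚ ≤ c → H ≤ L + n * κ → ℕ→ℚ 10976 * n * κ ≤ excess q L →
      ℕ→ℚ 2 * (ℕ→ℚ 3528 * H + ℕ→ℚ 648 * κ * e) ≤ excess q L * m →
      ℕ→ℚ 81 * p ≤ H * (ℕ→ℚ 5488 * c + ℕ→ℚ 3528 * s) + ℕ→ℚ 648 * κ * (e * s) → p ≤ q * c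
    finish H L .(s * m) s m e n p refl 0≤s 0≤c h₁ h₂ h₃ h₄ = *-cancelˡ-≤-pos (ℕ→ℚ 162) (0≤q-p⇒p≤q (l H L s m e n κ q p)
        (0≤p+q (0≤p+q (0≤p+q (0≤p*q (0≤p*q (0≤ℕ→ℚ 10976) 0≤c) (p≤q⇒0≤q-p h₁)) (0≤p*q 0≤c (p≤q⇒0≤q-p h₂))) (0≤p*q 0≤s (p≤q⇒0≤q-p h₃)))
          (0≤p*q (0≤ℕ→ℚ 2) (p≤q⇒0≤q-p h₄))))
      where
      l : ∀ H L s m e n κ q p → ℕ→ℚ 10976 * (s * m) * (L + n * κ - H) + s * m * (ℕ→ℚ 81 * q - ℕ→ℚ 5488 * L - ℕ→ℚ 10976 * n * κ)
        + s * ((ℕ→ℚ 81 * q - ℕ→ℚ 5488 * L) * m - ℕ→ℚ 2 * (ℕ→ℚ 3528 * H + ℕ→ℚ 648 * κ * e))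
        + ℕ→ℚ 2 * (H * (ℕ→ℚ 5488 * (s * m) + ℕ→ℚ 3528 * s) + ℕ→ℚ 648 * κ * (e * s) - ℕ→ℚ 81 * p)
        ≡ ℕ→ℚ 162 * (q * (s * m)) - ℕ→ℚ 162 * p
      l = solve-∀ ℚ-ring

    eventually : 0ℚ < excess q (leib n) → (∃ λ M → ℕ→ℚ 2 * (ℕ→ℚ 3528 * ∑≤ h (suc k) + ℕ→ℚ 648 * κ * ℕ→ℚ grid-error) ≤ excess q (leib n) * ℕ→ℚ M) →
      ∃ λ M → ∀ m → M ℕ.≤ m → ℕ→ℚ (length (Points.points k m)) ≤ q * cube m
    eventually 0<ε (M , large) = suc M , λ m M<m →
      finish (∑≤ h (suc k)) (leib n) (cube m) (ℕ→ℚ (m ℕ.* m)) (ℕ→ℚ m) (ℕ→ℚ grid-error) (ℕ→ℚ (suc n)) (ℕ→ℚ (length (Points.points k m)))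
        (ℕ→ℚ-* (m ℕ.* m) m) (0≤ℕ→ℚ (m ℕ.* m)) (0≤ℕ→ℚ (m ℕ.* m ℕ.* m)) (∑h-≤ n) fine
        (≤-trans large (*-monoˡ-≤-nonNeg (excess q (leib n)) {{nonNegative (<⇒≤ 0<ε)}} (ℕ→ℚ-mono (ℕₚ.<⇒≤ M<m))))
        (points-bound k m κ 0≤κ Kκ≡1 (ℕₚ.≤-trans (ℕ.s≤s ℕ.z≤n) M<m))

  refine-≤ : ∀ ε c k κ → 0ℚ < ε → 0ℚ ≤ κ → ℕ→ℚ (suc k) * κ ≡ 1ℚ → c ≤ ε * ℕ→ℚ k → c * κ ≤ ε
  refine-≤ ε c k κ 0<ε 0≤κ Kκ≡1 h = subst (c * κ ≤_) (trans (l ε (ℕ→ℚ (suc k)) κ) (trans (cong (ε *_) Kκ≡1) (*-identityʳ ε)))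
      (*-monoʳ-≤-nonNeg κ {{nonNegative 0≤κ}} (≤-trans h (*-monoˡ-≤-nonNeg ε {{nonNegative (<⇒≤ 0<ε)}} (ℕ→ℚ-mono (ℕₚ.n≤1+n k)))))
    where
    l : ∀ ε K κ → ε * K * κ ≡ ε * (K * κ)
    l = solve-∀ ℚ-ring

  Eventually : ℚ → ℕ → Set
  Eventually q k = ∃ λ M → ∀ m → M ℕ.≤ m → ℕ→ℚ (length (Points.points k m)) ≤ q * cube m

  at-step : ∀ q n k κ → 0ℚ < excess q (leib n) → 0ℚ ≤ κ → ℕ→ℚ (suc k) * κ ≡ 1ℚ →
    ℕ→ℚ 10976 * ℕ→ℚ (suc n) * κ ≤ excess q (leib n) → Eventually q k
  at-step q n k κ 0<ε 0≤κ Kκ≡1 fine = eventually q n k κ 0≤κ Kκ≡1 fine 0<ε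
    (archimedean (excess q (leib n)) (ℕ→ℚ 2 * (ℕ→ℚ 3528 * ∑≤ (Riemann.h k κ 0≤κ Kκ≡1) (suc k) + ℕ→ℚ 648 * κ * ℕ→ℚ (grid-error q n k κ 0≤κ Kκ≡1 fine))) 0<ε)

  at-size : ∀ q n k κ → 0ℚ < excess q (leib n) → 0ℚ ≤ κ → ℕ→ℚ (suc k) * κ ≡ 1ℚ →
    ℕ→ℚ 10976 * ℕ→ℚ (suc n) ≤ excess q (leib n) * ℕ→ℚ k → Eventually q k
  at-size q n k κ 0<ε 0≤κ Kκ≡1 le = at-step q n k κ 0<ε 0≤κ Kκ≡1
    (refine-≤ (excess q (leib n)) (ℕ→ℚ 10976 * ℕ→ℚ (suc n)) k κ 0<ε 0≤κ Kκ≡1 le)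

  above : ∀ q n → 0ℚ < excess q (leib n) → (∃ λ k → ℕ→ℚ 10976 * ℕ→ℚ (suc n) ≤ excess q (leib n) * ℕ→ℚ k) → ∃ (Eventually q)
  above q n 0<ε (k , le) = k , at-size q n k (unit-fraction k) 0<ε (0≤unit-fraction k) (ℕ→ℚ-unit-fraction k) le

  -- The order of choice matters: `n` provides the margin, `k` makes the grid fine enough for it,
  -- and `M` is taken last, depending on both.
  points-≤ : ∀ q → AboveUpperConst q → ∃ (Eventually q)
  points-≤ q (n , 4leib<) = above q n (0<excess q (leib n) 4leib<)
    (archimedean (excess q (leib n)) (ℕ→ℚ 10976 * ℕ→ℚ (suc n)) (0<excess q (leib n) 4leib<))

  -- Partial sums of a minimal zero-sum sequence.

  -- Carries a zero-sum sublist of the rearranged sequence back to the original list, for whose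
  -- sublists minimality is stated.
  ⊆-resp-↭ : ∀ {A : Set} {T R S : List A} → T ⊆ R → R ↭ S → ∃ λ T′ → T′ ⊆ S × T ↭ T′
  ⊆-resp-↭ T⊆R Perm.refl = _ , T⊆R , Perm.refl
  ⊆-resp-↭ (.x ∷ʳ T⊆R) (Perm.prep x p) with ⊆-resp-↭ T⊆R p
  ... | T′ , s , q = T′ , x ∷ʳ s , q
  ⊆-resp-↭ (refl ∷ T⊆R) (Perm.prep x p) with ⊆-resp-↭ T⊆R p
  ... | T′ , s , q = x ∷ T′ , refl ∷ s , Perm.prep x q
  ⊆-resp-↭ (.x ∷ʳ .y ∷ʳ T⊆R) (Perm.swap x y p) with ⊆-resp-↭ T⊆R p
  ... | T′ , s , q = T′ , y ∷ʳ x ∷ʳ s , q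
  ⊆-resp-↭ (.x ∷ʳ refl ∷ T⊆R) (Perm.swap x y p) with ⊆-resp-↭ T⊆R p
  ... | T′ , s , q = y ∷ T′ , refl ∷ x ∷ʳ s , Perm.prep y q
  ⊆-resp-↭ (refl ∷ .y ∷ʳ T⊆R) (Perm.swap x y p) with ⊆-resp-↭ T⊆R p
  ... | T′ , s , q = x ∷ T′ , y ∷ʳ refl ∷ s , Perm.prep x q
  ⊆-resp-↭ (refl ∷ refl ∷ T⊆R) (Perm.swap x y p) with ⊆-resp-↭ T⊆R p
  ... | T′ , s , q = y ∷ x ∷ T′ , refl ∷ refl ∷ s , Perm.swap x y q
  ⊆-resp-↭ T⊆R (Perm.trans p₁ p₂) with ⊆-resp-↭ T⊆R p₁
  ... | T₁ , s₁ , q₁ with ⊆-resp-↭ s₁ p₂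
  ... | T₂ , s₂ , q₂ = T₂ , s₂ , Perm.trans q₁ q₂

  sum³-++ : ∀ T Q → sum³ (T ++ Q) ≡ sum³ T +³ sum³ Q
  sum³-++ [] Q = ≡³ (sym (ℤₚ.+-identityˡ _)) (sym (ℤₚ.+-identityˡ _)) (sym (ℤₚ.+-identityˡ _))
  sum³-++ ((a , b , c) ∷ T) Q = trans (cong ((a , b , c) +³_) (sum³-++ T Q)) (≡³ (sym (ℤₚ.+-assoc a _ _)) (sym (ℤₚ.+-assoc b _ _)) (sym (ℤₚ.+-assoc c _ _)))

  +³-cancel : ∀ u v → u +³ v ≡ v → u ≡ 0³
  +³-cancel (a , b , c) (x , y , z) e = ≡³ (go a x (cong proj₁ e)) (go b y (cong (λ p → proj₁ (proj₂ p)) e)) (go c z (cong (λ p → proj₂ (proj₂ p)) e))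
    where
    l : ∀ a x → a ≡ a ℤ.+ x ℤ.- x
    l = ℤ-Solver.solve-∀
    go : ∀ a x → a ℤ.+ x ≡ x → a ≡ ℤ.0ℤ
    go a x h = trans (l a x) (trans (cong (ℤ._- x) h) (ℤₚ.+-inverseʳ x))

  tail-sums : List ℤ³ → List ℤ³
  tail-sums [] = []
  tail-sums (v ∷ R) = sum³ (v ∷ R) ∷ tail-sums R

  length-tail-sums : ∀ R → length (tail-sums R) ≡ length R
  length-tail-sums [] = refl
  length-tail-sums (v ∷ R) = cong suc (length-tail-sums R)

  ∈-tail-sums : ∀ R {x} → x ∈ tail-sums R → ∃₂ λ T Q → R ≡ T ++ Q × 0 ℕ.< length Q × x ≡ sum³ Q
  ∈-tail-sums (v ∷ R) (here e) = [] , v ∷ R , refl , ℕ.s≤s ℕ.z≤n , e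
  ∈-tail-sums (v ∷ R) (there h) with ∈-tail-sums R h
  ... | T , Q , e , pos , x≡ = v ∷ T , Q , cong (v ∷_) e , pos , x≡

  ZeroFree : ℕ → List ℤ³ → Set
  ZeroFree n R = ∀ T → T ⊆ R → 0 ℕ.< length T → length T ℕ.< n → sum³ T ≢ 0³

  -- Two equal suffix sums enclose a non-empty block of sum 0. The block is shorter than `n` because
  -- the shorter suffix is non-empty; the empty suffix is not listed, so the whole list may have sum
  -- 0.
  tail-sums-distinct : ∀ n R → length R ℕ.≤ n → ZeroFree n R → AllPairs _≢_ (tail-sums R)
  tail-sums-distinct n [] _ _ = []
  tail-sums-distinct n (v ∷ R) |R|≤n zf = All.tabulate apart ∷ tail-sums-distinct n R (ℕₚ.≤-trans (ℕₚ.n≤1+n _) |R|≤n) (λ T s → zf T (v ∷ʳ s))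
    where
    apart : ∀ {x} → x ∈ tail-sums R → sum³ (v ∷ R) ≢ x
    apart x∈ e with ∈-tail-sums R x∈
    ... | T , Q , refl , pos , refl = zf (v ∷ T) (refl ∷ ++⁺ʳ Q ⊆-refl) (ℕ.s≤s ℕ.z≤n)
        (ℕₚ.≤-trans (ℕ.s≤s (subst (length T ℕ.<_) (sym (Listₚ.length-++ T)) (ℕₚ.m<m+n (length T) pos))) |R|≤n)
        (+³-cancel (sum³ (v ∷ T)) (sum³ Q) (trans (sym (sum³-++ (v ∷ T) Q)) e))

  minimal-≤-points : ∀ k m S → MinimalZeroSum (InBall m) S → length S ℕ.≤ length (Points.points k m)
  minimal-≤-points k m S (_ , hS , z , min) with Steinitz.steinitz m S hS z
  ... | R , p , good = subst (ℕ._≤ length (Points.points k m)) (trans (length-tail-sums R) (↭-length p))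
      (unique-length (tail-sums-distinct (length S) R (ℕₚ.≤-reflexive (↭-length p)) zf) (inside R good))
    where
    zf : ZeroFree (length S) R
    zf T T⊆R pos short e with ⊆-resp-↭ T⊆R p
    ... | T′ , T′⊆S , q = min T′ T′⊆S (subst (0 ℕ.<_) (↭-length q) pos) (subst (ℕ._< length S) (↭-length q) short) (trans (sym (sum³-↭ q)) e)
    inside : ∀ R → Steinitz.GoodTails m R → All (_∈ Points.points k m) (tail-sums R)
    inside [] _ = []
    inside (v ∷ R) (g , gs) = Points.∈-points k m _ _ _ g ∷ inside R gs

  upper : ∀ (q : ℚ) → AboveUpperConst q → ∃ λ (M : ℕ) → ∀ (m : ℕ) → M ℕ.≤ m →
    ∀ (S : List ℤ³) → MinimalZeroSum (InBall m) S → ℕ→ℚ (length S) ≤ q * cube m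
  upper q hq = go (points-≤ q hq)
    where
    go : ∃ (Eventually q) → ∃ λ (M : ℕ) → ∀ (m : ℕ) → M ℕ.≤ m → ∀ (S : List ℤ³) → MinimalZeroSum (InBall m) S → ℕ→ℚ (length S) ≤ q * cube m
    go (k , M , bound) = M , λ m M≤m S hS → ≤-trans (ℕ→ℚ-mono (minimal-≤-points k m S hS)) (bound m M≤m)

-- The lower bound: the relation between four nearly tetrahedral vectors.

module LowerBound where

  open import Data.Empty using (⊥)
  open import Data.Nat as ℕ using (ℕ; zero; suc)
  import Data.Nat.Properties as ℕₚ
  import Data.Nat.Tactic.RingSolver as ℕ-Solver
  open import Data.Integer as ℤ using (ℤ; +_; -[1+_])
  import Data.Integer.Properties as ℤₚ
  import Data.Integer.Tactic.RingSolver as ℤ-Solver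
  open import Data.Rational
  open import Data.Rational.Properties
  open import Data.Product using (_×_; _,_; ∃; ∃₂; proj₁; proj₂)
  open import Data.Sum using (_⊎_; inj₁; inj₂)
  open import Data.List using (List; []; _∷_; _++_; length; replicate)
  import Data.List.Properties as Listₚ
  import Data.List.Relation.Unary.All.Properties as Allₚ
  open import Data.List.Relation.Binary.Sublist.Propositional using (_⊆_; []; _∷ʳ_; _∷_)
  open import Relation.Nullary using (contradiction)
  open import Relation.Binary.PropositionalEquality
  open import Tactic.RingSolver using (solve-∀)
  open RationalBounds
  open LatticePoints using (greatest)
  open PointCount using (archimedean)
  open SteinitzLemma using (_·³_; ≡³)
  open UpperBound using (sum³-++)

  ⊆-++⁻ : ∀ {A : Set} (xs : List A) {ys T} → T ⊆ xs ++ ys → ∃₂ λ T₁ T₂ → T ≡ T₁ ++ T₂ × T₁ ⊆ xs × T₂ ⊆ ys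
  ⊆-++⁻ [] s = [] , _ , refl , [] , s
  ⊆-++⁻ (x ∷ xs) (.x ∷ʳ s) with ⊆-++⁻ xs s
  ... | T₁ , T₂ , e , s₁ , s₂ = T₁ , T₂ , e , x ∷ʳ s₁ , s₂
  ⊆-++⁻ (x ∷ xs) (refl ∷ s) with ⊆-++⁻ xs s
  ... | T₁ , T₂ , refl , s₁ , s₂ = x ∷ T₁ , T₂ , refl , refl ∷ s₁ , s₂

  ⊆-replicate⁻ : ∀ {A : Set} n {x : A} {T} → T ⊆ replicate n x → ∃ λ c → c ℕ.≤ n × T ≡ replicate c x
  ⊆-replicate⁻ zero [] = 0 , ℕ.z≤n , refl
  ⊆-replicate⁻ (suc n) (_ ∷ʳ s) with ⊆-replicate⁻ n s
  ... | c , c≤n , e = c , ℕₚ.m≤n⇒m≤1+n c≤n , e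
  ⊆-replicate⁻ (suc n) (refl ∷ s) with ⊆-replicate⁻ n s
  ... | c , c≤n , refl = suc c , ℕ.s≤s c≤n , refl

  sum³-replicate : ∀ n v → sum³ (replicate n v) ≡ + n ·³ v
  sum³-replicate zero (x , y , z) = ≡³ (sym (ℤₚ.*-zeroˡ x)) (sym (ℤₚ.*-zeroˡ y)) (sym (ℤₚ.*-zeroˡ z))
  sum³-replicate (suc n) v@(x , y , z) = trans (cong (v +³_) (sum³-replicate n v)) (≡³ (l x (+ n)) (l y (+ n)) (l z (+ n)))
    where
    l : ∀ x n → x ℤ.+ n ℤ.* x ≡ (+ 1 ℤ.+ n) ℤ.* x
    l = ℤ-Solver.solve-∀

  abstract
    lin₄ : ℤ → ℤ → ℤ → ℤ → ℤ → ℤ → ℤ → ℤ → ℤ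
    lin₄ a b c d x y z w = a ℤ.* x ℤ.+ (b ℤ.* y ℤ.+ (c ℤ.* z ℤ.+ d ℤ.* w))

    lin₄-def : ∀ a b c d x y z w → lin₄ a b c d x y z w ≡ a ℤ.* x ℤ.+ (b ℤ.* y ℤ.+ (c ℤ.* z ℤ.+ d ℤ.* w))
    lin₄-def a b c d x y z w = refl

  combination₄ : ∀ a b c d x₁ y₁ z₁ x₂ y₂ z₂ x₃ y₃ z₃ x₄ y₄ z₄ →
    (a ·³ (x₁ , y₁ , z₁)) +³ ((b ·³ (x₂ , y₂ , z₂)) +³ ((c ·³ (x₃ , y₃ , z₃)) +³ (d ·³ (x₄ , y₄ , z₄)))) ≡
    (lin₄ a b c d x₁ x₂ x₃ x₄ , lin₄ a b c d y₁ y₂ y₃ y₄ , lin₄ a b c d z₁ z₂ z₃ z₄)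
  combination₄ a b c d x₁ y₁ z₁ x₂ y₂ z₂ x₃ y₃ z₃ x₄ y₄ z₄ =
    ≡³ (sym (lin₄-def a b c d x₁ x₂ x₃ x₄)) (sym (lin₄-def a b c d y₁ y₂ y₃ y₄)) (sym (lin₄-def a b c d z₁ z₂ z₃ z₄))

  -- Four vectors close to the vertices of a regular tetrahedron with centre 0; their determinants α₁, …, α₄ satisfy α₄ - α₁ = 1.
  module Tetrahedron (T g : ℤ) (g-def : g ≡ + 4 ℤ.* (T ℤ.* T) ℤ.- + 2 ℤ.* T ℤ.- + 1) (t α₁ α₂ α₃ α₄ : ℕ) (pos-t : + t ≡ T)
    (pos-α₁ : + α₁ ≡ T ℤ.* (+ 2 ℤ.+ g)) (pos-α₂ : + α₂ ≡ T ℤ.* (+ 2 ℤ.+ g ℤ.+ + 4 ℤ.* T))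
    (pos-α₃ : + α₃ ≡ T ℤ.* g) (pos-α₄ : + α₄ ≡ + 1 ℤ.+ T ℤ.* (+ 2 ℤ.+ g)) (0<α₄ : 0 ℕ.< α₄) where

    -- Perturbations of `T` times `(1 , 1 , 1)`, `(1 , -1 , -1)`, `(-1 , 1 , -1)`, `(-1 , -1 , 1)`.
    -- Unperturbed, these vectors already cancel with multiplicities 1; the small changes are what
    -- makes the shortest relation long.
    v₁ v₂ v₃ v₄ : ℤ³
    v₁ = T ℤ.+ + 1 , T , T
    v₂ = T ℤ.- + 1 , + 1 ℤ.- T , ℤ.- T
    v₃ = ℤ.- T ℤ.- + 1 , T , + 1 ℤ.- T
    v₄ = ℤ.- T , ℤ.- T , T

    multiset : ℕ → ℕ → ℕ → ℕ → List ℤ³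
    multiset c₁ c₂ c₃ c₄ = replicate c₁ v₁ ++ replicate c₂ v₂ ++ replicate c₃ v₃ ++ replicate c₄ v₄

    S : List ℤ³
    S = multiset α₁ α₂ α₃ α₄

    length-multiset : ∀ c₁ c₂ c₃ c₄ → length (multiset c₁ c₂ c₃ c₄) ≡ c₁ ℕ.+ (c₂ ℕ.+ (c₃ ℕ.+ c₄))
    length-multiset c₁ c₂ c₃ c₄ = trans (Listₚ.length-++ (replicate c₁ v₁)) (cong₂ ℕ._+_ (Listₚ.length-replicate c₁)
      (trans (Listₚ.length-++ (replicate c₂ v₂)) (cong₂ ℕ._+_ (Listₚ.length-replicate c₂)
        (trans (Listₚ.length-++ (replicate c₃ v₃)) (cong₂ ℕ._+_ (Listₚ.length-replicate c₃) (Listₚ.length-replicate c₄))))))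

    X Y Z : ℤ → ℤ → ℤ → ℤ → ℤ
    X a b c d = lin₄ a b c d (T ℤ.+ + 1) (T ℤ.- + 1) (ℤ.- T ℤ.- + 1) (ℤ.- T)
    Y a b c d = lin₄ a b c d T (+ 1 ℤ.- T) T (ℤ.- T)
    Z a b c d = lin₄ a b c d T (ℤ.- T) (+ 1 ℤ.- T) T

    sum-multiset : ∀ c₁ c₂ c₃ c₄ → sum³ (multiset c₁ c₂ c₃ c₄) ≡ (X (+ c₁) (+ c₂) (+ c₃) (+ c₄) , Y (+ c₁) (+ c₂) (+ c₃) (+ c₄) , Z (+ c₁) (+ c₂) (+ c₃) (+ c₄))
    sum-multiset c₁ c₂ c₃ c₄ = trans (trans (sum³-++ (replicate c₁ v₁) _) (cong₂ _+³_ (sum³-replicate c₁ v₁)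
      (trans (sum³-++ (replicate c₂ v₂) _) (cong₂ _+³_ (sum³-replicate c₂ v₂)
        (trans (sum³-++ (replicate c₃ v₃) _) (cong₂ _+³_ (sum³-replicate c₃ v₃) (sum³-replicate c₄ v₄)))))))
      (combination₄ (+ c₁) (+ c₂) (+ c₃) (+ c₄) (T ℤ.+ + 1) T T (T ℤ.- + 1) (+ 1 ℤ.- T) (ℤ.- T) (ℤ.- T ℤ.- + 1) T (+ 1 ℤ.- T) (ℤ.- T) (ℤ.- T) T)

    sum-S : sum³ S ≡ 0³
    sum-S = trans (sum-multiset α₁ α₂ α₃ α₄) (balanced g (+ α₁) (+ α₂) (+ α₃) (+ α₄) g-def pos-α₁ pos-α₂ pos-α₃ pos-α₄)
      where
      balanced : ∀ g a b c d → g ≡ + 4 ℤ.* (T ℤ.* T) ℤ.- + 2 ℤ.* T ℤ.- + 1 → a ≡ T ℤ.* (+ 2 ℤ.+ g) → b ≡ T ℤ.* (+ 2 ℤ.+ g ℤ.+ + 4 ℤ.* T) → c ≡ T ℤ.* g → d ≡ + 1 ℤ.+ T ℤ.* (+ 2 ℤ.+ g) →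
        (X a b c d , Y a b c d , Z a b c d) ≡ 0³
      balanced _ _ _ _ _ refl refl refl refl refl = ≡³
        (trans (lin₄-def (T ℤ.* (+ 2 ℤ.+ (+ 4 ℤ.* (T ℤ.* T) ℤ.- + 2 ℤ.* T ℤ.- + 1))) (T ℤ.* (+ 2 ℤ.+ (+ 4 ℤ.* (T ℤ.* T) ℤ.- + 2 ℤ.* T ℤ.- + 1) ℤ.+ + 4 ℤ.* T)) (T ℤ.* (+ 4 ℤ.* (T ℤ.* T) ℤ.- + 2 ℤ.* T ℤ.- + 1)) (+ 1 ℤ.+ T ℤ.* (+ 2 ℤ.+ (+ 4 ℤ.* (T ℤ.* T) ℤ.- + 2 ℤ.* T ℤ.- + 1))) (T ℤ.+ + 1) (T ℤ.- + 1) (ℤ.- T ℤ.- + 1) (ℤ.- T)) (l₁ T))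
        (trans (lin₄-def (T ℤ.* (+ 2 ℤ.+ (+ 4 ℤ.* (T ℤ.* T) ℤ.- + 2 ℤ.* T ℤ.- + 1))) (T ℤ.* (+ 2 ℤ.+ (+ 4 ℤ.* (T ℤ.* T) ℤ.- + 2 ℤ.* T ℤ.- + 1) ℤ.+ + 4 ℤ.* T)) (T ℤ.* (+ 4 ℤ.* (T ℤ.* T) ℤ.- + 2 ℤ.* T ℤ.- + 1)) (+ 1 ℤ.+ T ℤ.* (+ 2 ℤ.+ (+ 4 ℤ.* (T ℤ.* T) ℤ.- + 2 ℤ.* T ℤ.- + 1))) T (+ 1 ℤ.- T) T (ℤ.- T)) (l₂ T))
        (trans (lin₄-def (T ℤ.* (+ 2 ℤ.+ (+ 4 ℤ.* (T ℤ.* T) ℤ.- + 2 ℤ.* T ℤ.- + 1))) (T ℤ.* (+ 2 ℤ.+ (+ 4 ℤ.* (T ℤ.* T) ℤ.- + 2 ℤ.* T ℤ.- + 1) ℤ.+ + 4 ℤ.* T)) (T ℤ.* (+ 4 ℤ.* (T ℤ.* T) ℤ.- + 2 ℤ.* T ℤ.- + 1)) (+ 1 ℤ.+ T ℤ.* (+ 2 ℤ.+ (+ 4 ℤ.* (T ℤ.* T) ℤ.- + 2 ℤ.* T ℤ.- + 1))) T (ℤ.- T) (+ 1 ℤ.- T) T) (l₃ T))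
        where
        l₁ : ∀ T → (T ℤ.* (+ 2 ℤ.+ (+ 4 ℤ.* (T ℤ.* T) ℤ.- + 2 ℤ.* T ℤ.- + 1))) ℤ.* (T ℤ.+ + 1) ℤ.+ ((T ℤ.* (+ 2 ℤ.+ (+ 4 ℤ.* (T ℤ.* T) ℤ.- + 2 ℤ.* T ℤ.- + 1) ℤ.+ + 4 ℤ.* T)) ℤ.* (T ℤ.- + 1) ℤ.+ ((T ℤ.* (+ 4 ℤ.* (T ℤ.* T) ℤ.- + 2 ℤ.* T ℤ.- + 1)) ℤ.* (ℤ.- T ℤ.- + 1) ℤ.+ (+ 1 ℤ.+ T ℤ.* (+ 2 ℤ.+ (+ 4 ℤ.* (T ℤ.* T) ℤ.- + 2 ℤ.* T ℤ.- + 1))) ℤ.* (ℤ.- T))) ≡ + 0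
        l₁ = ℤ-Solver.solve-∀
        l₂ : ∀ T → (T ℤ.* (+ 2 ℤ.+ (+ 4 ℤ.* (T ℤ.* T) ℤ.- + 2 ℤ.* T ℤ.- + 1))) ℤ.* T ℤ.+ ((T ℤ.* (+ 2 ℤ.+ (+ 4 ℤ.* (T ℤ.* T) ℤ.- + 2 ℤ.* T ℤ.- + 1) ℤ.+ + 4 ℤ.* T)) ℤ.* (+ 1 ℤ.- T) ℤ.+ ((T ℤ.* (+ 4 ℤ.* (T ℤ.* T) ℤ.- + 2 ℤ.* T ℤ.- + 1)) ℤ.* T ℤ.+ (+ 1 ℤ.+ T ℤ.* (+ 2 ℤ.+ (+ 4 ℤ.* (T ℤ.* T) ℤ.- + 2 ℤ.* T ℤ.- + 1))) ℤ.* (ℤ.- T))) ≡ + 0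
        l₂ = ℤ-Solver.solve-∀
        l₃ : ∀ T → (T ℤ.* (+ 2 ℤ.+ (+ 4 ℤ.* (T ℤ.* T) ℤ.- + 2 ℤ.* T ℤ.- + 1))) ℤ.* T ℤ.+ ((T ℤ.* (+ 2 ℤ.+ (+ 4 ℤ.* (T ℤ.* T) ℤ.- + 2 ℤ.* T ℤ.- + 1) ℤ.+ + 4 ℤ.* T)) ℤ.* (ℤ.- T) ℤ.+ ((T ℤ.* (+ 4 ℤ.* (T ℤ.* T) ℤ.- + 2 ℤ.* T ℤ.- + 1)) ℤ.* (+ 1 ℤ.- T) ℤ.+ (+ 1 ℤ.+ T ℤ.* (+ 2 ℤ.+ (+ 4 ℤ.* (T ℤ.* T) ℤ.- + 2 ℤ.* T ℤ.- + 1))) ℤ.* T)) ≡ + 0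
        l₃ = ℤ-Solver.solve-∀

    -- The kernel of (v₁ v₂ v₃ v₄) is spanned by (α₁ , α₂ , α₃ , α₄), and the difference of the outer coordinates is the coordinate along it.
    Multiple : ℤ → ℕ → ℕ → ℕ → ℕ → Set
    Multiple k c₁ c₂ c₃ c₄ = + c₁ ≡ k ℤ.* + α₁ × + c₂ ≡ k ℤ.* + α₂ × + c₃ ≡ k ℤ.* + α₃ × + c₄ ≡ k ℤ.* + α₄

    relation-multiple : ∀ c₁ c₂ c₃ c₄ → sum³ (multiset c₁ c₂ c₃ c₄) ≡ 0³ → Multiple (+ c₄ ℤ.- + c₁) c₁ c₂ c₃ c₄
    relation-multiple c₁ c₂ c₃ c₄ e = solved g (+ c₁) (+ c₂) (+ c₃) (+ c₄) (+ α₁) (+ α₂) (+ α₃) (+ α₄) g-def pos-α₁ pos-α₂ pos-α₃ pos-α₄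
        (cong proj₁ e′) (cong (λ p → proj₁ (proj₂ p)) e′) (cong (λ p → proj₂ (proj₂ p)) e′)
      where
      e′ = trans (sym (sum-multiset c₁ c₂ c₃ c₄)) e
      -- Each multiplicity equals its claimed multiple plus a combination of the three coordinate
      -- sums, with polynomials in `T` as multipliers.
      eliminate : ∀ {x y : ℤ} a b c d p q r → x ≡ y ℤ.+
          (p ℤ.* (a ℤ.* (T ℤ.+ + 1) ℤ.+ (b ℤ.* (T ℤ.- + 1) ℤ.+ (c ℤ.* (ℤ.- T ℤ.- + 1) ℤ.+ d ℤ.* (ℤ.- T)))) ℤ.+
           q ℤ.* (a ℤ.* T ℤ.+ (b ℤ.* (+ 1 ℤ.- T) ℤ.+ (c ℤ.* T ℤ.+ d ℤ.* (ℤ.- T)))) ℤ.+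
           r ℤ.* (a ℤ.* T ℤ.+ (b ℤ.* (ℤ.- T) ℤ.+ (c ℤ.* (+ 1 ℤ.- T) ℤ.+ d ℤ.* T)))) →
        X a b c d ≡ + 0 → Y a b c d ≡ + 0 → Z a b c d ≡ + 0 → x ≡ y
      eliminate {x} {y} a b c d p q r eq e₁ e₂ e₃ = trans eq (trans (cong (λ u → y ℤ.+ u) (cong₂ ℤ._+_ (cong₂ ℤ._+_
          (cong (p ℤ.*_) (trans (sym (lin₄-def a b c d (T ℤ.+ + 1) (T ℤ.- + 1) (ℤ.- T ℤ.- + 1) (ℤ.- T))) e₁))
          (cong (q ℤ.*_) (trans (sym (lin₄-def a b c d T (+ 1 ℤ.- T) T (ℤ.- T))) e₂)))
          (cong (r ℤ.*_) (trans (sym (lin₄-def a b c d T (ℤ.- T) (+ 1 ℤ.- T) T)) e₃)))) (l y p q r))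
        where
        l : ∀ y p q r → y ℤ.+ (p ℤ.* + 0 ℤ.+ q ℤ.* + 0 ℤ.+ r ℤ.* + 0) ≡ y
        l = ℤ-Solver.solve-∀
      solved : ∀ g a b c d x y z w → g ≡ + 4 ℤ.* (T ℤ.* T) ℤ.- + 2 ℤ.* T ℤ.- + 1 → x ≡ T ℤ.* (+ 2 ℤ.+ g) → y ≡ T ℤ.* (+ 2 ℤ.+ g ℤ.+ + 4 ℤ.* T) → z ≡ T ℤ.* g → w ≡ + 1 ℤ.+ T ℤ.* (+ 2 ℤ.+ g) →
        X a b c d ≡ + 0 → Y a b c d ≡ + 0 → Z a b c d ≡ + 0 →
        a ≡ (d ℤ.- a) ℤ.* x × b ≡ (d ℤ.- a) ℤ.* y × c ≡ (d ℤ.- a) ℤ.* z × d ≡ (d ℤ.- a) ℤ.* w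
      solved _ a b c d _ _ _ _ refl refl refl refl refl e₁ e₂ e₃ =
        -- The first and the last claim have the same multipliers: as `α₄ - α₁ = 1`, their
        -- difference is the identity `d - a = d - a`.
        eliminate a b c d (+ 1 ℤ.- + 2 ℤ.* T ℤ.+ + 2 ℤ.* (T ℤ.* T)) (+ 1 ℤ.- T ℤ.+ + 2 ℤ.* (T ℤ.* T)) (+ 1 ℤ.- T) (l₁ a b c d T) e₁ e₂ e₃ ,
        eliminate a b c d (+ 2 ℤ.* (T ℤ.* T)) (+ 1 ℤ.+ T ℤ.+ + 2 ℤ.* (T ℤ.* T)) (ℤ.- T) (l₂ a b c d T) e₁ e₂ e₃ ,
        eliminate a b c d (+ 2 ℤ.* (T ℤ.* T) ℤ.- + 2 ℤ.* T) (+ 2 ℤ.* (T ℤ.* T) ℤ.- T) (+ 1 ℤ.- T) (l₃ a b c d T) e₁ e₂ e₃ ,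
        eliminate a b c d (+ 1 ℤ.- + 2 ℤ.* T ℤ.+ + 2 ℤ.* (T ℤ.* T)) (+ 1 ℤ.- T ℤ.+ + 2 ℤ.* (T ℤ.* T)) (+ 1 ℤ.- T) (l₄ a b c d T) e₁ e₂ e₃
        where
        l₁ : ∀ a b c d T → a ≡ (d ℤ.- a) ℤ.* (T ℤ.* (+ 2 ℤ.+ (+ 4 ℤ.* (T ℤ.* T) ℤ.- + 2 ℤ.* T ℤ.- + 1))) ℤ.+
          ((+ 1 ℤ.- + 2 ℤ.* T ℤ.+ + 2 ℤ.* (T ℤ.* T)) ℤ.* (a ℤ.* (T ℤ.+ + 1) ℤ.+ (b ℤ.* (T ℤ.- + 1) ℤ.+ (c ℤ.* (ℤ.- T ℤ.- + 1) ℤ.+ d ℤ.* ℤ.- T))) ℤ.+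
           (+ 1 ℤ.- T ℤ.+ + 2 ℤ.* (T ℤ.* T)) ℤ.* (a ℤ.* T ℤ.+ (b ℤ.* (+ 1 ℤ.- T) ℤ.+ (c ℤ.* T ℤ.+ d ℤ.* ℤ.- T))) ℤ.+
           (+ 1 ℤ.- T) ℤ.* (a ℤ.* T ℤ.+ (b ℤ.* ℤ.- T ℤ.+ (c ℤ.* (+ 1 ℤ.- T) ℤ.+ d ℤ.* T))))
        l₁ = ℤ-Solver.solve-∀
        l₂ : ∀ a b c d T → b ≡ (d ℤ.- a) ℤ.* (T ℤ.* (+ 2 ℤ.+ (+ 4 ℤ.* (T ℤ.* T) ℤ.- + 2 ℤ.* T ℤ.- + 1) ℤ.+ + 4 ℤ.* T)) ℤ.+
          ((+ 2 ℤ.* (T ℤ.* T)) ℤ.* (a ℤ.* (T ℤ.+ + 1) ℤ.+ (b ℤ.* (T ℤ.- + 1) ℤ.+ (c ℤ.* (ℤ.- T ℤ.- + 1) ℤ.+ d ℤ.* ℤ.- T))) ℤ.+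
           (+ 1 ℤ.+ T ℤ.+ + 2 ℤ.* (T ℤ.* T)) ℤ.* (a ℤ.* T ℤ.+ (b ℤ.* (+ 1 ℤ.- T) ℤ.+ (c ℤ.* T ℤ.+ d ℤ.* ℤ.- T))) ℤ.+
           (ℤ.- T) ℤ.* (a ℤ.* T ℤ.+ (b ℤ.* ℤ.- T ℤ.+ (c ℤ.* (+ 1 ℤ.- T) ℤ.+ d ℤ.* T))))
        l₂ = ℤ-Solver.solve-∀
        l₃ : ∀ a b c d T → c ≡ (d ℤ.- a) ℤ.* (T ℤ.* (+ 4 ℤ.* (T ℤ.* T) ℤ.- + 2 ℤ.* T ℤ.- + 1)) ℤ.+
          ((+ 2 ℤ.* (T ℤ.* T) ℤ.- + 2 ℤ.* T) ℤ.* (a ℤ.* (T ℤ.+ + 1) ℤ.+ (b ℤ.* (T ℤ.- + 1) ℤ.+ (c ℤ.* (ℤ.- T ℤ.- + 1) ℤ.+ d ℤ.* ℤ.- T))) ℤ.+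
           (+ 2 ℤ.* (T ℤ.* T) ℤ.- T) ℤ.* (a ℤ.* T ℤ.+ (b ℤ.* (+ 1 ℤ.- T) ℤ.+ (c ℤ.* T ℤ.+ d ℤ.* ℤ.- T))) ℤ.+
           (+ 1 ℤ.- T) ℤ.* (a ℤ.* T ℤ.+ (b ℤ.* ℤ.- T ℤ.+ (c ℤ.* (+ 1 ℤ.- T) ℤ.+ d ℤ.* T))))
        l₃ = ℤ-Solver.solve-∀
        l₄ : ∀ a b c d T → d ≡ (d ℤ.- a) ℤ.* (+ 1 ℤ.+ T ℤ.* (+ 2 ℤ.+ (+ 4 ℤ.* (T ℤ.* T) ℤ.- + 2 ℤ.* T ℤ.- + 1))) ℤ.+
          ((+ 1 ℤ.- + 2 ℤ.* T ℤ.+ + 2 ℤ.* (T ℤ.* T)) ℤ.* (a ℤ.* (T ℤ.+ + 1) ℤ.+ (b ℤ.* (T ℤ.- + 1) ℤ.+ (c ℤ.* (ℤ.- T ℤ.- + 1) ℤ.+ d ℤ.* ℤ.- T))) ℤ.+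
           (+ 1 ℤ.- T ℤ.+ + 2 ℤ.* (T ℤ.* T)) ℤ.* (a ℤ.* T ℤ.+ (b ℤ.* (+ 1 ℤ.- T) ℤ.+ (c ℤ.* T ℤ.+ d ℤ.* ℤ.- T))) ℤ.+
           (+ 1 ℤ.- T) ℤ.* (a ℤ.* T ℤ.+ (b ℤ.* ℤ.- T ℤ.+ (c ℤ.* (+ 1 ℤ.- T) ℤ.+ d ℤ.* T))))
        l₄ = ℤ-Solver.solve-∀

    -- The last multiplicity alone decides: `0 ≤ c₄ ≤ α₄` with `α₄` positive leaves only the factors
    -- 0 and 1.
    multiple-trivial : ∀ k {c₁ c₂ c₃ c₄} → Multiple k c₁ c₂ c₃ c₄ → c₄ ℕ.≤ α₄ →
      (c₁ ≡ 0 × c₂ ≡ 0 × c₃ ≡ 0 × c₄ ≡ 0) ⊎ (c₁ ≡ α₁ × c₂ ≡ α₂ × c₃ ≡ α₃ × c₄ ≡ α₄)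
    multiple-trivial (+ 0) (e₁ , e₂ , e₃ , e₄) _ = inj₁ (z α₁ e₁ , z α₂ e₂ , z α₃ e₃ , z α₄ e₄)
      where
      z : ∀ {c} a → + c ≡ + 0 ℤ.* + a → c ≡ 0
      z a e = ℤₚ.+-injective (trans e (ℤₚ.*-zeroˡ (+ a)))
    multiple-trivial (+ 1) (e₁ , e₂ , e₃ , e₄) _ = inj₂ (u e₁ , u e₂ , u e₃ , u e₄)
      where
      u : ∀ {c a} → + c ≡ + 1 ℤ.* + a → c ≡ a
      u {c} {a} e = ℤₚ.+-injective (trans e (ℤₚ.*-identityˡ (+ a)))
    multiple-trivial (+ suc (suc j)) {c₄ = c₄} (_ , _ , _ , e₄) c₄≤ = contradiction c₄≤ (ℕₚ.<⇒≱
        (subst (α₄ ℕ.<_) (sym (ℤₚ.+-injective (trans e₄ (sym (ℤₚ.pos-* (2 ℕ.+ j) α₄))))) (ℕₚ.m<m+n α₄ (ℕₚ.≤-trans 0<α₄ (ℕₚ.m≤m+n α₄ (j ℕ.* α₄))))))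
    multiple-trivial -[1+ j ] {c₄ = c₄} (_ , _ , _ , e₄) _ = contradiction (ℤₚ.≤-trans (ℤ.+≤+ ℕ.z≤n) (ℤₚ.≤-reflexive e₄)) (ℤₚ.<⇒≱
        (subst (-[1+ j ] ℤ.* + α₄ ℤ.<_) (ℤₚ.*-zeroʳ -[1+ j ]) (ℤₚ.*-monoˡ-<-neg -[1+ j ] (ℤ.+<+ 0<α₄))))

    minimal : ∀ {m} → 3 ℕ.* ((t ℕ.+ 1) ℕ.* (t ℕ.+ 1)) ℕ.≤ m ℕ.* m → MinimalZeroSum (InBall m) S
    minimal {m} fits = subst (0 ℕ.<_) (sym (length-multiset α₁ α₂ α₃ α₄)) (ℕₚ.≤-trans 0<α₄ (ℕₚ.≤-trans (ℕₚ.m≤n+m α₄ α₃) (ℕₚ.≤-trans (ℕₚ.m≤n+m (α₃ ℕ.+ α₄) α₂) (ℕₚ.m≤n+m (α₂ ℕ.+ (α₃ ℕ.+ α₄)) α₁)))) ,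
        Allₚ.++⁺ (Allₚ.replicate⁺ α₁ b₁) (Allₚ.++⁺ (Allₚ.replicate⁺ α₂ b₂) (Allₚ.++⁺ (Allₚ.replicate⁺ α₃ b₃) (Allₚ.replicate⁺ α₄ b₄))) ,
        sum-S , irreducible
      where
      fits′ : + 3 ℤ.* ((T ℤ.+ + 1) ℤ.* (T ℤ.+ + 1)) ℤ.≤ + m ℤ.* + m
      fits′ = subst₂ ℤ._≤_ (trans (ℤₚ.pos-* 3 ((t ℕ.+ 1) ℕ.* (t ℕ.+ 1))) (cong (+ 3 ℤ.*_) (trans (ℤₚ.pos-* (t ℕ.+ 1) (t ℕ.+ 1)) (cong (λ u → (u ℤ.+ + 1) ℤ.* (u ℤ.+ + 1)) pos-t)))) (ℤₚ.pos-* m m) (ℤ.+≤+ fits)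
      within : ∀ {x y e} → e ≡ y ℤ.- x → + 0 ℤ.≤ e → y ℤ.≤ + m ℤ.* + m → x ℤ.≤ + m ℤ.* + m
      within eq h y≤ = ℤₚ.≤-trans (ℤₚ.0≤i-j⇒j≤i (subst (+ 0 ℤ.≤_) eq h)) y≤
      nonneg : ∀ a b → + 0 ℤ.≤ + a ℤ.* T ℤ.+ + b
      nonneg a b = subst (+ 0 ℤ.≤_) (cong (ℤ._+ + b) (trans (ℤₚ.pos-* a t) (cong (+ a ℤ.*_) pos-t))) (ℤ.+≤+ ℕ.z≤n)
      b₁ : InBall m v₁
      b₁ = within (l T) (nonneg 4 2) fits′
        where
        l : ∀ T → + 4 ℤ.* T ℤ.+ + 2 ≡ + 3 ℤ.* ((T ℤ.+ + 1) ℤ.* (T ℤ.+ + 1)) ℤ.- ((T ℤ.+ + 1) ℤ.* (T ℤ.+ + 1) ℤ.+ T ℤ.* T ℤ.+ T ℤ.* T)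
        l = ℤ-Solver.solve-∀
      b₂ : InBall m v₂
      b₂ = within (l T) (nonneg 10 1) fits′
        where
        l : ∀ T → + 10 ℤ.* T ℤ.+ + 1 ≡ + 3 ℤ.* ((T ℤ.+ + 1) ℤ.* (T ℤ.+ + 1)) ℤ.- ((T ℤ.- + 1) ℤ.* (T ℤ.- + 1) ℤ.+ (+ 1 ℤ.- T) ℤ.* (+ 1 ℤ.- T) ℤ.+ ℤ.- T ℤ.* ℤ.- T)
        l = ℤ-Solver.solve-∀
      b₃ : InBall m v₃
      b₃ = within (l T) (nonneg 6 1) fits′
        where
        l : ∀ T → + 6 ℤ.* T ℤ.+ + 1 ≡ + 3 ℤ.* ((T ℤ.+ + 1) ℤ.* (T ℤ.+ + 1)) ℤ.- ((ℤ.- T ℤ.- + 1) ℤ.* (ℤ.- T ℤ.- + 1) ℤ.+ T ℤ.* T ℤ.+ (+ 1 ℤ.- T) ℤ.* (+ 1 ℤ.- T))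
        l = ℤ-Solver.solve-∀
      b₄ : InBall m v₄
      b₄ = within (l T) (nonneg 6 3) fits′
        where
        l : ∀ T → + 6 ℤ.* T ℤ.+ + 3 ≡ + 3 ℤ.* ((T ℤ.+ + 1) ℤ.* (T ℤ.+ + 1)) ℤ.- (ℤ.- T ℤ.* ℤ.- T ℤ.+ ℤ.- T ℤ.* ℤ.- T ℤ.+ T ℤ.* T)
        l = ℤ-Solver.solve-∀
      -- As `S` consists of four constant blocks, a sublist is given by four multiplicities, and a
      -- zero-sum sublist by a relation between the vectors.
      irreducible : ∀ U → U ⊆ S → 0 ℕ.< length U → length U ℕ.< length S → sum³ U ≡ 0³ → ⊥
      irreducible U U⊆S 0<|U| |U|<|S| e with ⊆-++⁻ (replicate α₁ v₁) U⊆S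
      ... | _ , _ , refl , s₁ , r₁ with ⊆-++⁻ (replicate α₂ v₂) r₁
      ... | _ , _ , refl , s₂ , r₂ with ⊆-++⁻ (replicate α₃ v₃) r₂
      ... | _ , _ , refl , s₃ , s₄ with ⊆-replicate⁻ α₁ s₁ | ⊆-replicate⁻ α₂ s₂ | ⊆-replicate⁻ α₃ s₃ | ⊆-replicate⁻ α₄ s₄
      ... | c₁ , _ , refl | c₂ , _ , refl | c₃ , _ , refl | c₄ , c₄≤ , refl
        with multiple-trivial (+ c₄ ℤ.- + c₁) (relation-multiple c₁ c₂ c₃ c₄ e) c₄≤
      ... | inj₁ (refl , refl , refl , refl) = contradiction 0<|U| λ ()
      ... | inj₂ (refl , refl , refl , refl) = ℕₚ.<-irrefl refl |U|<|S|

    length-S : length S ≡ α₁ ℕ.+ (α₂ ℕ.+ (α₃ ℕ.+ α₄))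
    length-S = length-multiset α₁ α₂ α₃ α₄

  -- Here `γ` is `4 t² - 2 t - 1` written without subtraction, and the total is
  -- `16 t³ - 4 t² + 2 t + 1`.
  tetrahedron-length : ℕ → ℕ
  tetrahedron-length s = a ℕ.+ (t ℕ.* (2 ℕ.+ γ ℕ.+ 4 ℕ.* t) ℕ.+ (t ℕ.* γ ℕ.+ (1 ℕ.+ a)))
    where
    t = suc s
    γ = 4 ℕ.* (s ℕ.* s) ℕ.+ 6 ℕ.* s ℕ.+ 1
    a = t ℕ.* (2 ℕ.+ γ)

  tetrahedron : ∀ s {m} → 3 ℕ.* ((suc s ℕ.+ 1) ℕ.* (suc s ℕ.+ 1)) ℕ.≤ m ℕ.* m →
    ∃ λ S → MinimalZeroSum (InBall m) S × length S ≡ tetrahedron-length s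
  tetrahedron s {m} fits = S , minimal {m} fits , length-S
    where
    t γ α₁ : ℕ
    t = suc s
    γ = 4 ℕ.* (s ℕ.* s) ℕ.+ 6 ℕ.* s ℕ.+ 1
    α₁ = t ℕ.* (2 ℕ.+ γ)
    γ-def : ∀ S T → T ≡ + 1 ℤ.+ S → + 4 ℤ.* (S ℤ.* S) ℤ.+ + 6 ℤ.* S ℤ.+ + 1 ≡ + 4 ℤ.* (T ℤ.* T) ℤ.- + 2 ℤ.* T ℤ.- + 1
    γ-def S _ refl = l S
      where
      l : ∀ S → + 4 ℤ.* (S ℤ.* S) ℤ.+ + 6 ℤ.* S ℤ.+ + 1 ≡ + 4 ℤ.* ((+ 1 ℤ.+ S) ℤ.* (+ 1 ℤ.+ S)) ℤ.- + 2 ℤ.* (+ 1 ℤ.+ S) ℤ.- + 1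
      l = ℤ-Solver.solve-∀
    pos-γ : + γ ≡ + 4 ℤ.* (+ t ℤ.* + t) ℤ.- + 2 ℤ.* + t ℤ.- + 1
    pos-γ = trans (cong₂ (λ a b → a ℤ.+ b ℤ.+ + 1) (trans (ℤₚ.pos-* 4 (s ℕ.* s)) (cong (λ a → + 4 ℤ.* a) (ℤₚ.pos-* s s))) (ℤₚ.pos-* 6 s))
      (γ-def (+ s) (+ t) refl)
    open Tetrahedron (+ t) (+ γ) pos-γ t α₁ (t ℕ.* (2 ℕ.+ γ ℕ.+ 4 ℕ.* t)) (t ℕ.* γ) (1 ℕ.+ α₁) refl
      (ℤₚ.pos-* t (2 ℕ.+ γ)) (trans (ℤₚ.pos-* t (2 ℕ.+ γ ℕ.+ 4 ℕ.* t)) (cong (λ h → + t ℤ.* (+ 2 ℤ.+ + γ ℤ.+ h)) (ℤₚ.pos-* 4 t)))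
      (ℤₚ.pos-* t γ) (cong (λ h → + 1 ℤ.+ h) (ℤₚ.pos-* t (2 ℕ.+ γ))) (ℕ.s≤s ℕ.z≤n)

  -- The square of the length begins with `256 t⁶ - 128 t⁵`, and what follows is positive.
  tetrahedron-length-≥ : ∀ s → let t = suc s in
    256 ℕ.* (t ℕ.* t ℕ.* t ℕ.* (t ℕ.* t ℕ.* t)) ℕ.≤ tetrahedron-length s ℕ.* tetrahedron-length s ℕ.+ 128 ℕ.* (t ℕ.* t ℕ.* t ℕ.* (t ℕ.* t))
  tetrahedron-length-≥ s = ℕₚ.m+n≤o⇒m≤o (256 ℕ.* (suc s ℕ.* suc s ℕ.* suc s ℕ.* (suc s ℕ.* suc s ℕ.* suc s))) (ℕₚ.≤-reflexive (l s))
    where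
    l : ∀ s → 256 ℕ.* (suc s ℕ.* suc s ℕ.* suc s ℕ.* (suc s ℕ.* suc s ℕ.* suc s)) ℕ.+
        (80 ℕ.* (suc s ℕ.* suc s ℕ.* (suc s ℕ.* suc s)) ℕ.+ 4 ℕ.* (suc s ℕ.* suc s) ℕ.* (4 ℕ.* s ℕ.+ 3) ℕ.+ 4 ℕ.* suc s ℕ.+ 1)
      ≡ (suc s ℕ.* (2 ℕ.+ (4 ℕ.* (s ℕ.* s) ℕ.+ 6 ℕ.* s ℕ.+ 1)) ℕ.+ (suc s ℕ.* (2 ℕ.+ (4 ℕ.* (s ℕ.* s) ℕ.+ 6 ℕ.* s ℕ.+ 1) ℕ.+ 4 ℕ.* suc s) ℕ.+ (suc s ℕ.* (4 ℕ.* (s ℕ.* s) ℕ.+ 6 ℕ.* s ℕ.+ 1) ℕ.+ (1 ℕ.+ suc s ℕ.* (2 ℕ.+ (4 ℕ.* (s ℕ.* s) ℕ.+ 6 ℕ.* s ℕ.+ 1)))))) ℕ.*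
        (suc s ℕ.* (2 ℕ.+ (4 ℕ.* (s ℕ.* s) ℕ.+ 6 ℕ.* s ℕ.+ 1)) ℕ.+ (suc s ℕ.* (2 ℕ.+ (4 ℕ.* (s ℕ.* s) ℕ.+ 6 ℕ.* s ℕ.+ 1) ℕ.+ 4 ℕ.* suc s) ℕ.+ (suc s ℕ.* (4 ℕ.* (s ℕ.* s) ℕ.+ 6 ℕ.* s ℕ.+ 1) ℕ.+ (1 ℕ.+ suc s ℕ.* (2 ℕ.+ (4 ℕ.* (s ℕ.* s) ℕ.+ 6 ℕ.* s ℕ.+ 1)))))) ℕ.+
        128 ℕ.* (suc s ℕ.* suc s ℕ.* suc s ℕ.* (suc s ℕ.* suc s))
    l = ℕ-Solver.solve-∀

  -- Comparing squared lengths with sixth powers of the radius.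

  sixth : ℕ → ℕ
  sixth x = x ℕ.* x ℕ.* x ℕ.* (x ℕ.* x ℕ.* x)

  fifth : ℕ → ℕ
  fifth x = x ℕ.* x ℕ.* x ℕ.* (x ℕ.* x)

  sixth-shift : ∀ s t u → t ≡ 1 ℕ.+ s → u ≡ 3 ℕ.+ s → sixth u ℕ.≤ sixth t ℕ.+ 728 ℕ.* fifth t
  sixth-shift s _ _ refl refl = ℕₚ.m+n≤o⇒m≤o ((3 ℕ.+ s) ℕ.* (3 ℕ.+ s) ℕ.* (3 ℕ.+ s) ℕ.* ((3 ℕ.+ s) ℕ.* (3 ℕ.+ s) ℕ.* (3 ℕ.+ s))) (ℕₚ.≤-reflexive (l s))
    where
    l : ∀ s → (3 ℕ.+ s) ℕ.* (3 ℕ.+ s) ℕ.* (3 ℕ.+ s) ℕ.* ((3 ℕ.+ s) ℕ.* (3 ℕ.+ s) ℕ.* (3 ℕ.+ s)) ℕ.+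
        (716 ℕ.* (s ℕ.* s ℕ.* s ℕ.* (s ℕ.* s)) ℕ.+ 3520 ℕ.* (s ℕ.* s ℕ.* (s ℕ.* s)) ℕ.+ 6760 ℕ.* (s ℕ.* s ℕ.* s) ℕ.+ 6080 ℕ.* (s ℕ.* s) ℕ.+ 2188 ℕ.* s)
      ≡ (1 ℕ.+ s) ℕ.* (1 ℕ.+ s) ℕ.* (1 ℕ.+ s) ℕ.* ((1 ℕ.+ s) ℕ.* (1 ℕ.+ s) ℕ.* (1 ℕ.+ s)) ℕ.+ 728 ℕ.* ((1 ℕ.+ s) ℕ.* (1 ℕ.+ s) ℕ.* (1 ℕ.+ s) ℕ.* ((1 ℕ.+ s) ℕ.* (1 ℕ.+ s)))
    l = ℕ-Solver.solve-∀

  tetrahedron-length-sixth : ∀ s t → t ≡ 1 ℕ.+ s → 256 ℕ.* sixth t ℕ.≤ tetrahedron-length s ℕ.* tetrahedron-length s ℕ.+ 128 ℕ.* fifth t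
  tetrahedron-length-sixth s _ refl = tetrahedron-length-≥ s

  sixth-≤ : ∀ {t u} → t ℕ.≤ u → sixth t ℕ.≤ sixth u
  sixth-≤ h = ℕₚ.*-mono-≤ (ℕₚ.*-mono-≤ (ℕₚ.*-mono-≤ h h) h) (ℕₚ.*-mono-≤ (ℕₚ.*-mono-≤ h h) h)

  sixth-mono : ∀ {m u} → m ℕ.* m ℕ.≤ 3 ℕ.* (u ℕ.* u) → m ℕ.* m ℕ.* m ℕ.* (m ℕ.* m ℕ.* m) ℕ.≤ 27 ℕ.* sixth u
  sixth-mono {m} {u} h = subst₂ ℕ._≤_ (l₁ m) (l₂ u) (ℕₚ.*-mono-≤ (ℕₚ.*-mono-≤ h h) h)
    where
    l₁ : ∀ m → m ℕ.* m ℕ.* (m ℕ.* m) ℕ.* (m ℕ.* m) ≡ m ℕ.* m ℕ.* m ℕ.* (m ℕ.* m ℕ.* m)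
    l₁ = ℕ-Solver.solve-∀
    l₂ : ∀ u → 3 ℕ.* (u ℕ.* u) ℕ.* (3 ℕ.* (u ℕ.* u)) ℕ.* (3 ℕ.* (u ℕ.* u)) ≡ 27 ℕ.* (u ℕ.* u ℕ.* u ℕ.* (u ℕ.* u ℕ.* u))
    l₂ = ℕ-Solver.solve-∀

  square-cancel-≤ : ∀ {x y} → 0ℚ ≤ y → x * x ≤ y * y → x ≤ y
  square-cancel-≤ {x} {y} 0≤y h = ≮⇒≥ λ y<x → <-irrefl refl (<-≤-trans (≤-<-trans
    (*-monoˡ-≤-nonNeg y {{nonNegative 0≤y}} (<⇒≤ y<x)) (*-monoˡ-<-pos′ y<x)) h)
    where
    *-monoˡ-<-pos′ : y < x → y * x < x * x
    *-monoˡ-<-pos′ y<x = *-monoˡ-<-pos x {{positive (≤-<-trans 0≤y y<x)}} y<x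

  sixth-fifth : ∀ x → x ℕ.* x ℕ.* x ℕ.* (x ℕ.* x ℕ.* x) ≡ x ℕ.* x ℕ.* x ℕ.* (x ℕ.* x) ℕ.* x
  sixth-fifth = ℕ-Solver.solve-∀
  0≤q² : ∀ q → 0ℚ ≤ q * q
  0≤q² q with ≤-total 0ℚ q
  ... | inj₁ 0≤q = 0≤p*q 0≤q 0≤q
  ... | inj₂ q≤0 = subst (0ℚ ≤_) (l q) (0≤p*q (p≤q⇒0≤q-p q≤0) (p≤q⇒0≤q-p q≤0))
    where
    l : ∀ q → (0ℚ - q) * (0ℚ - q) ≡ q * q
    l = solve-∀ ℚ-ring
  -- Used with `a = 256`, `b = 27`, `r = 728`, `k = 128`. Writing `ε` for `a - b q²`, the gain
  -- `ε t⁶` outweighs the losses of order `t⁵` as soon as `ε t ≥ a r + k`.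
  combine : ∀ a b r k q c y t U A B → 0ℚ ≤ a → 0ℚ ≤ a - b * (q * q) → 0ℚ ≤ q * q → 0ℚ ≤ B → A ≡ B * t →
    a * A ≤ y * y + k * B → c * c ≤ b * U → U ≤ A + r * B → A ≤ U →
    a * r + k ≤ (a - b * (q * q)) * t → q * c * (q * c) ≤ y * y
  combine a b r k q c y t U .(B * t) B 0≤a 0≤ε 0≤qq 0≤B refl h₁ h₂ h₃ h₄ h₅ = 0≤q-p⇒p≤q (l a b r k q c y t U B)
      (0≤p+q (0≤p+q (0≤p+q (0≤p+q (p≤q⇒0≤q-p h₁) (0≤p*q 0≤qq (p≤q⇒0≤q-p h₂))) (0≤p*q 0≤ε (p≤q⇒0≤q-p h₄))) (0≤p*q 0≤a (p≤q⇒0≤q-p h₃))) (0≤p*q 0≤B (p≤q⇒0≤q-p h₅)))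
    where
    l : ∀ a b r k q c y t U B → y * y + k * B - a * (B * t) + q * q * (b * U - c * c) + (a - b * (q * q)) * (U - B * t)
      + a * (B * t + r * B - U) + B * ((a - b * (q * q)) * t - (a * r + k)) ≡ y * y - q * c * (q * c)
    l = solve-∀ ℚ-ring

  compare-length : ∀ q t u m ℓ → ℕ→ℚ 27 * (q * q) < ℕ→ℚ 256 → ℕ→ℚ 256 * ℕ→ℚ 728 + ℕ→ℚ 128 ≤ (ℕ→ℚ 256 - ℕ→ℚ 27 * (q * q)) * ℕ→ℚ t → m ℕ.* m ℕ.≤ 3 ℕ.* (u ℕ.* u) →
     256 ℕ.* sixth t ℕ.≤ ℓ ℕ.* ℓ ℕ.+ 128 ℕ.* fifth t → sixth u ℕ.≤ sixth t ℕ.+ 728 ℕ.* fifth t → sixth t ℕ.≤ sixth u → q * cube m ≤ ℕ→ℚ ℓ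
  compare-length q t u m ℓ h large near long shift t≤u = square-cancel-≤ (0≤ℕ→ℚ ℓ) (combine (ℕ→ℚ 256) (ℕ→ℚ 27) (ℕ→ℚ 728) (ℕ→ℚ 128) q (cube m) (ℕ→ℚ ℓ) (ℕ→ℚ t) (ℕ→ℚ (sixth u)) (ℕ→ℚ (sixth t)) (ℕ→ℚ (fifth t))
    (0≤ℕ→ℚ 256) (p≤q⇒0≤q-p (<⇒≤ h)) (0≤q² q) (0≤ℕ→ℚ (fifth t))
    (trans (cong ℕ→ℚ (sixth-fifth t)) (ℕ→ℚ-* (fifth t) t))
    (subst₂ _≤_ (ℕ→ℚ-* 256 (sixth t)) (trans (ℕ→ℚ-+ (ℓ ℕ.* ℓ) (128 ℕ.* fifth t)) (cong₂ _+_ (ℕ→ℚ-* ℓ ℓ) (ℕ→ℚ-* 128 (fifth t)))) (ℕ→ℚ-mono long))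
    (subst₂ _≤_ (ℕ→ℚ-* (m ℕ.* m ℕ.* m) (m ℕ.* m ℕ.* m)) (ℕ→ℚ-* 27 (sixth u)) (ℕ→ℚ-mono (sixth-mono {m} {u} near)))
    (subst (ℕ→ℚ (sixth u) ≤_) (trans (ℕ→ℚ-+ (sixth t) (728 ℕ.* fifth t)) (cong (λ a → ℕ→ℚ (sixth t) + a) (ℕ→ℚ-* 728 (fifth t)))) (ℕ→ℚ-mono shift))
    (ℕ→ℚ-mono t≤u) large)

  compare : ∀ q → ℕ→ℚ 27 * (q * q) < ℕ→ℚ 256 → ∀ s t u m → t ≡ 1 ℕ.+ s → u ≡ 3 ℕ.+ s →
    ℕ→ℚ 256 * ℕ→ℚ 728 + ℕ→ℚ 128 ≤ (ℕ→ℚ 256 - ℕ→ℚ 27 * (q * q)) * ℕ→ℚ t → m ℕ.* m ℕ.≤ 3 ℕ.* (u ℕ.* u) → q * cube m ≤ ℕ→ℚ (tetrahedron-length s)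
  compare q h s t u m t≡ u≡ large near = compare-length q t u m (tetrahedron-length s) h large near (tetrahedron-length-sixth s t t≡) (sixth-shift s t u t≡ u≡)
      (sixth-≤ {t} {u} (subst₂ ℕ._≤_ (sym t≡) (sym u≡) (ℕₚ.m≤n+m (1 ℕ.+ s) 2)))

  -- The largest `s` whose tetrahedron fits. Because `3 (s + 2)² ≤ (2 (s + 2))²`, every `s` with
  -- `2 (s + 2) ≤ m` qualifies, so `s₀` is reached; maximality gives the bound on `m` from above.
  inscribed : ∀ m s₀ → 2 ℕ.* (2 ℕ.+ s₀) ℕ.≤ m → ∃ λ s → s₀ ℕ.≤ s × 3 ℕ.* ((suc s ℕ.+ 1) ℕ.* (suc s ℕ.+ 1)) ℕ.≤ m ℕ.* m × m ℕ.* m ℕ.≤ 3 ℕ.* ((3 ℕ.+ s) ℕ.* (3 ℕ.+ s))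
  inscribed m s₀ h = go (greatest (λ s → Fits s ℕ.≤? m ℕ.* m) (fits 0 (ℕₚ.≤-trans (ℕₚ.*-monoʳ-≤ 2 (ℕₚ.m≤m+n 2 s₀)) h)) m)
    where
    Fits : ℕ → ℕ
    Fits s = 3 ℕ.* ((suc s ℕ.+ 1) ℕ.* (suc s ℕ.+ 1))
    fits : ∀ s → 2 ℕ.* (2 ℕ.+ s) ℕ.≤ m → Fits s ℕ.≤ m ℕ.* m
    fits s h = ℕₚ.≤-trans (ℕₚ.m+n≤o⇒m≤o (Fits s) (ℕₚ.≤-reflexive (l s))) (ℕₚ.*-mono-≤ h h)
      where
      l : ∀ s → 3 ℕ.* ((suc s ℕ.+ 1) ℕ.* (suc s ℕ.+ 1)) ℕ.+ (2 ℕ.+ s) ℕ.* (2 ℕ.+ s) ≡ 2 ℕ.* (2 ℕ.+ s) ℕ.* (2 ℕ.* (2 ℕ.+ s))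
      l = ℕ-Solver.solve-∀
    s₀≤m : s₀ ℕ.≤ m
    s₀≤m = ℕₚ.≤-trans (ℕₚ.≤-trans (ℕₚ.m≤n+m s₀ 2) (ℕₚ.m≤n*m (2 ℕ.+ s₀) 2)) h
    go : (∃ λ s → Fits s ℕ.≤ m ℕ.* m × s ℕ.≤ m × (∀ x → x ℕ.≤ m → Fits x ℕ.≤ m ℕ.* m → x ℕ.≤ s)) → _
    go (s , fit , s≤m , max) = s , max s₀ s₀≤m (fits s₀ h) , fit , subst (λ u → m ℕ.* m ℕ.≤ 3 ℕ.* (u ℕ.* u)) (ℕₚ.+-comm (2 ℕ.+ s) 1) (ℕₚ.<⇒≤ (ℕₚ.≰⇒> λ fit′ → ℕₚ.1+n≰n (max (suc s) (s<m fit′) fit′)))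
      where
      s<m : Fits (suc s) ℕ.≤ m ℕ.* m → suc s ℕ.≤ m
      s<m f = ℕₚ.≮⇒≥ λ m<s → ℕₚ.<⇒≱ (ℕₚ.<-≤-trans (ℕₚ.*-mono-< m<s m<s) (ℕₚ.≤-trans (ℕₚ.*-mono-≤ le le) (ℕₚ.m≤n*m _ 3))) f
        where
        le : suc s ℕ.≤ suc (suc s) ℕ.+ 1
        le = ℕₚ.≤-trans (ℕₚ.n≤1+n (suc s)) (ℕₚ.m≤m+n (suc (suc s)) 1)

  Attained : ℚ → ℕ → Set
  Attained q m = ∃ λ (S : List ℤ³) → MinimalZeroSum (InBall m) S × q * cube m ≤ ℕ→ℚ (length S)

  lower-at : ∀ q m → (∃ λ s → 3 ℕ.* ((suc s ℕ.+ 1) ℕ.* (suc s ℕ.+ 1)) ℕ.≤ m ℕ.* m × q * cube m ≤ ℕ→ℚ (tetrahedron-length s)) → Attained q m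
  lower-at q m (s , fit , le) = go (tetrahedron s {m} fit)
    where
    go : (∃ λ S → MinimalZeroSum (InBall m) S × length S ≡ tetrahedron-length s) → Attained q m
    go (S , min , len) = S , min , subst (λ n → q * cube m ≤ ℕ→ℚ n) (sym len) le

  lower : ∀ q → BelowLowerConst q → ∃ λ M → ∀ m → M ℕ.≤ m → Attained q m
  -- Any length will do for `q ≤ 0`; 4 is the threshold of `inscribed` for `s₀ = 0`.
  lower q (inj₁ q≤0) = 4 , λ m 4≤m → lower-at q m (below m (inscribed m 0 4≤m))
    where
    below : ∀ m → _ → ∃ λ s → 3 ℕ.* ((suc s ℕ.+ 1) ℕ.* (suc s ℕ.+ 1)) ℕ.≤ m ℕ.* m × q * cube m ≤ ℕ→ℚ (tetrahedron-length s)
    below m (s , _ , fit , _) = s , fit , ≤-trans (subst (q * cube m ≤_) (*-zeroˡ (cube m)) (*-monoʳ-≤-nonNeg (cube m) {{nonNegative (0≤ℕ→ℚ (m ℕ.* m ℕ.* m))}} q≤0)) (0≤ℕ→ℚ (tetrahedron-length s))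
  lower q (inj₂ (0<q , h′)) = go (archimedean (ℕ→ℚ 256 - ℕ→ℚ 27 * (q * q)) (ℕ→ℚ 256 * ℕ→ℚ 728 + ℕ→ℚ 128) 0<ε)
    where
    27≡ : (+ 27) / 1 ≡ ℕ→ℚ 27
    27≡ = refl
    256≡ : (+ 256) / 1 ≡ ℕ→ℚ 256
    256≡ = refl
    h : ℕ→ℚ 27 * (q * q) < ℕ→ℚ 256
    h = subst₂ (λ a b → a * (q * q) < b) 27≡ 256≡ h′
    0<ε : 0ℚ < ℕ→ℚ 256 - ℕ→ℚ 27 * (q * q)
    0<ε = subst (_< ℕ→ℚ 256 - ℕ→ℚ 27 * (q * q)) (+-inverseʳ (ℕ→ℚ 27 * (q * q))) (+-monoˡ-< (- (ℕ→ℚ 27 * (q * q))) h)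
    go : (∃ λ s₀ → ℕ→ℚ 256 * ℕ→ℚ 728 + ℕ→ℚ 128 ≤ (ℕ→ℚ 256 - ℕ→ℚ 27 * (q * q)) * ℕ→ℚ s₀) → ∃ λ M → ∀ m → M ℕ.≤ m → Attained q m
    go (s₀ , large) = 2 ℕ.* (2 ℕ.+ s₀) , λ m M≤m → lower-at q m (far m (inscribed m s₀ M≤m))
      where
      far : ∀ m → (∃ λ s → s₀ ℕ.≤ s × 3 ℕ.* ((suc s ℕ.+ 1) ℕ.* (suc s ℕ.+ 1)) ℕ.≤ m ℕ.* m × m ℕ.* m ℕ.≤ 3 ℕ.* ((3 ℕ.+ s) ℕ.* (3 ℕ.+ s))) →
        ∃ λ s → 3 ℕ.* ((suc s ℕ.+ 1) ℕ.* (suc s ℕ.+ 1)) ℕ.≤ m ℕ.* m × q * cube m ≤ ℕ→ℚ (tetrahedron-length s)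
      far m (s , s₀≤s , fit , near) = s , fit , compare q h s (suc s) (3 ℕ.+ s) m refl refl
        (≤-trans large (*-monoˡ-≤-nonNeg (ℕ→ℚ 256 - ℕ→ℚ 27 * (q * q)) {{nonNegative (<⇒≤ 0<ε)}} (ℕ→ℚ-mono (ℕₚ.m≤n⇒m≤1+n s₀≤s)))) near

theorem6 : (∀ (q : ℚ) → BelowLowerConst q →
    ∃ λ (M : ℕ) → ∀ (m : ℕ) → M ℕ.≤ m →
    ∃ λ (S : List ℤ³) → MinimalZeroSum (InBall m) S × q ℚ.* cube m ℚ.≤ ℕ→ℚ (length S))
    ×
    (∀ (q : ℚ) → AboveUpperConst q →
    ∃ λ (M : ℕ) → ∀ (m : ℕ) → M ℕ.≤ m →
    ∀ (S : List ℤ³) → MinimalZeroSum (InBall m) S → ℕ→ℚ (length S) ℚ.≤ q ℚ.* cube m)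
theorem6 = LowerBound.lower , UpperBound.upper
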